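{- Let $n\ge1$, $0\le\ell\le n/2$ and $\lambda=(2^\ell,1^{n-2\ell})$, with $2$-split $(\lambda^{(1)},\ldots,\lambda^{(r)})$. Then $$s^{(2)}_\lambda[X;q]=\mathbb{B}_{\lambda^{(1)}}\mathbb{B}_{\lambda^{(2)}}\cdots\mathbb{B}_{\lambda^{(r)}}(1),$$ i.e. the $2$-Schur function equals the generalized Hall–Littlewood polynomial indexed by the $2$-split of $\lambda$.
   Context: $\Lambda$: symmetric functions over $\mathbb{Q}(q)$ with the Hall inner product; $f^\perp$ is the adjoint of multiplication by $f$; $h_r,e_r$ complete homogeneous and elementary symmetric functions ($h_0=e_0=1$, zero for $r<0$). For $a\in\mathbb{Z}$: $\mathbb{S}_a=\sum_{r\ge0}(-1)^rh_{a+r}e_r^\perp$, $\mathbb{B}_a=\sum_{j\ge0}q^j\mathbb{S}_{a+j}h_j^\perp$. For a partition $\nu=(\nu_1,\ldots,\nu_\ell)$, $\mathbb{B}_\nu=\sum_{\sigma\in S_\ell}\mathrm{sgn}(\sigma)\mathbb{B}_{\nu_1+\sigma(1)-1}\cdots\mathbb{B}_{\nu_\ell+\sigma(\ell)-\ell}$. A partition is $k$-bounded if its parts are $\le k$; the hook length of $\nu\ne\emptyset$ is $\nu_1+\ell(\nu)-1$. The $k$-split $(\lambda^{(1)},\ldots,\lambda^{(r)})$ of a $k$-bounded $\lambda$ is obtained by successively taking the longest initial segment of the remaining parts whose hook length is $\le k$. $C^{(k)}_\lambda=\mathbb{B}_{\lambda^{(1)}}\cdots\mathbb{B}_{\lambda^{(r)}}(1)$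 ($C^{(k)}_\emptyset=1$); these are linearly independent over $k$-bounded $\lambda$, and $T^{(k)}_i$ is the linear operator on their span with $T^{(k)}_iC^{(k)}_\lambda=C^{(k)}_\lambda$ if $\lambda_1=i$ and $0$ otherwise. $k$-Schur functions: $s^{(k)}_\emptyset=1$, $s^{(k)}_{(a)}=s_a$ for $1\le a\le k$, and $s^{(k)}_{(m,\lambda)}=T^{(k)}_m\mathbb{B}_ms^{(k)}_\lambda$ for nonempty $k$-bounded $\lambda$ with $\lambda_1\le m\le k$. -}

module Defs where

open import Data.Nat as ℕ using (ℕ; zero; suc; _∸_; _⊔_; _⊓_)
open import Data.Integer as ℤ using (ℤ; +_; -[1+_])
open import Data.List using (List; []; _∷_; map; concatMap; foldr; length; take; drop; replicate; _++_; upTo; zipWith)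
open import Data.Bool using (Bool; true; false; _∧_; if_then_else_)
open import Data.Product using (Σ; _×_; _,_; proj₁; proj₂)
open import Data.List.Relation.Unary.All using (All)
open import Relation.Binary.PropositionalEquality using (_≡_)
open import Relation.Nullary using (¬_)

-- Coefficient ring ℤ[q]: polynomials as coefficient lists (constant
-- term first), compared coefficientwise.

ZPoly : Set
ZPoly = List ℤ

coeffP : ZPoly → ℕ → ℤ
coeffP []       _       = + 0
coeffP (a ∷ p)  zero    = a
coeffP (a ∷ p)  (suc i) = coeffP p i

infix 4 _≈P_
_≈P_ : ZPoly → ZPoly → Set
p ≈P r = ∀ i → coeffP p i ≡ coeffP r i

_+P_ : ZPoly → ZPoly → ZPoly
[]      +P r       = r
(a ∷ p) +P []      = a ∷ p
(a ∷ p) +P (b ∷ r) = (a ℤ.+ b) ∷ (p +P r)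

cscaleP : ℤ → ZPoly → ZPoly
cscaleP c p = map (c ℤ.*_) p

_*P_ : ZPoly → ZPoly → ZPoly
p *P r = foldr (λ a acc → cscaleP a r +P (+ 0 ∷ acc)) [] p

shiftP : ℕ → ZPoly → ZPoly
shiftP j p = replicate j (+ 0) ++ p

sumP : List ZPoly → ZPoly
sumP = foldr _+P_ []

get : List ℕ → ℕ → ℕ
get []       _       = 0
get (x ∷ xs) zero    = x
get (x ∷ xs) (suc i) = get xs i

size : List ℕ → ℕ
size = foldr ℕ._+_ 0

isPartition : List ℕ → Bool
isPartition []           = true
isPartition (x ∷ [])     = 1 ℕ.≤ᵇ x
isPartition (x ∷ y ∷ xs) = (y ℕ.≤ᵇ x) ∧ isPartition (y ∷ xs)

IsPartition : List ℕ → Set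
IsPartition λ' = isPartition λ' ≡ true

allB : (ℕ → Bool) → List ℕ → Bool
allB p []       = true
allB p (x ∷ xs) = p x ∧ allB p xs

KBounded : ℕ → List ℕ → Set
KBounded k λ' = (isPartition λ' ∧ allB (λ x → x ℕ.≤ᵇ k) λ') ≡ true

range : ℕ → ℕ → List ℕ
range from len = map (from ℕ.+_) (upTo len)

partsF : ℕ → ℕ → ℕ → List (List ℕ)
partsF zero    zero    b = [] ∷ []
partsF zero    (suc m) b = []
partsF (suc f) zero    b = [] ∷ []
partsF (suc f) (suc m) b =
  concatMap (λ a → map (a ∷_) (partsF f (suc m ∸ a) a)) (range 1 (b ⊓ suc m))

partitions : ℕ → List (List ℕ)
partitions m = partsF m m m

horiz : List ℕ → List ℕ → Bool
horiz ν μ = (length μ ℕ.≤ᵇ length ν) ∧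
  allB (λ i → (get μ i ℕ.≤ᵇ get ν i) ∧ (get ν (suc i) ℕ.≤ᵇ get μ i)) (upTo (length ν))

vert : List ℕ → List ℕ → Bool
vert μ ν = (length ν ℕ.≤ᵇ length μ) ∧
  allB (λ i → (get ν i ℕ.≤ᵇ get μ i) ∧ (get μ i ℕ.≤ᵇ suc (get ν i))) (upTo (length μ))

-- Symmetric functions over ℤ[q], in the Schur basis:
-- f μ = coefficient of s_μ in f (only partitions μ are meaningful).

SF : Set
SF = List ℕ → ZPoly

infix 4 _≈_
_≈_ : SF → SF → Set
f ≈ g = ∀ μ → IsPartition μ → f μ ≈P g μ

zeroSF : SF
zeroSF _ = []

oneSF : SF
oneSF [] = + 1 ∷ []
oneSF (_ ∷ _) = []

schurRow : ℕ → SF     -- s_(a) = h_a  (a ≥ 1)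
schurRow a μ = if isSingle μ then + 1 ∷ [] else []
  where
  isSingle : List ℕ → Bool
  isSingle (x ∷ []) = x ℕ.≡ᵇ a
  isSingle _        = false

_+SF_ : SF → SF → SF
(f +SF g) μ = f μ +P g μ

scaleSF : ZPoly → SF → SF
scaleSF p f μ = p *P f μ

cscaleSF : ℤ → SF → SF
cscaleSF c f μ = cscaleP c (f μ)

sumOver : List (List ℕ) → (List ℕ → Bool) → SF → ZPoly
sumOver μs p f = sumP (map (λ μ → if p μ then f μ else []) μs)

-- multiplication by h_r (Pieri rule)
hMul : ℕ → SF → SF
hMul r f ν = if r ℕ.≤ᵇ size ν then sumOver (partitions (size ν ∸ r)) (horiz ν) f else []

hMulℤ : ℤ → SF → SF
hMulℤ (+ r)      f = hMul r f
hMulℤ -[1+ r ]   f = zeroSF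

-- h_j^⊥ (adjoint of hMul j for the Hall inner product)
hPerp : ℕ → SF → SF
hPerp j f ν = sumOver (partitions (size ν ℕ.+ j)) (λ μ → horiz μ ν) f

-- e_r^⊥ (adjoint of multiplication by e_r; dual Pieri rule)
ePerp : ℕ → SF → SF
ePerp r f ν = sumOver (partitions (size ν ℕ.+ r)) (λ μ → vert μ ν) f

sign : ℕ → ℤ
sign zero          = + 1
sign (suc zero)    = ℤ.- (+ 1)
sign (suc (suc r)) = sign r

-- 𝕊_a = Σ_{r≥0} (-1)^r h_{a+r} e_r^⊥ ; on the coefficient of s_ν only
-- r ≤ |ν| + |a| can contribute, so the sum is truncated there.
S : ℤ → SF → SF
S a f ν = sumP (map (λ r → cscaleP (sign r) (hMulℤ (a ℤ.+ + r) (ePerp r f) ν))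
                    (upTo (suc (size ν ℕ.+ ℤ.∣ a ∣))))

-- 𝔹_a = Σ_{j≥0} q^j 𝕊_{a+j} h_j^⊥ ; only j ≤ |ν| + |a| contribute.
B : ℤ → SF → SF
B a f ν = sumP (map (λ j → shiftP j (S (a ℤ.+ + j) (hPerp j f) ν))
                    (upTo (suc (size ν ℕ.+ ℤ.∣ a ∣))))

insertAt : ℕ → ℕ → List ℕ → List ℕ
insertAt zero    x xs       = x ∷ xs
insertAt (suc i) x []       = x ∷ []
insertAt (suc i) x (y ∷ ys) = y ∷ insertAt i x ys

-- permutations of {1,…,n} in one-line notation, with their signs
perms : ℕ → List (List ℕ × ℤ)
perms zero    = ([] , + 1) ∷ []
perms (suc n) =
  concatMap (λ p → map (λ i → insertAt i (suc n) (proj₁ p) , proj₂ p ℤ.* sign (n ∸ i))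
                       (upTo (suc n)))
            (perms n)

bIndices : ℕ → List ℕ → List ℕ → List ℤ
bIndices i (x ∷ xs) (s ∷ ss) = ((+ x ℤ.+ + s) ℤ.- + i) ∷ bIndices (suc i) xs ss
bIndices i _        _        = []

applyBs : List ℤ → SF → SF
applyBs []       f = f
applyBs (a ∷ as) f = B a (applyBs as f)

Bν : List ℕ → SF → SF
Bν ν f μ = sumP (map (λ p → cscaleP (proj₂ p) (applyBs (bIndices 1 ν (proj₁ p)) f μ))
                     (perms (length ν)))

splitF : ℕ → ℕ → List ℕ → List (List ℕ)
splitF k zero    _        = []
splitF k (suc f) []       = []
splitF k (suc f) (x ∷ xs) =
  take (1 ⊔ (suc k ∸ x)) (x ∷ xs) ∷ splitF k f (drop (1 ⊔ (suc k ∸ x)) (x ∷ xs))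

kSplit : ℕ → List ℕ → List (List ℕ)
kSplit k λ' = splitF k (length λ') λ'

C : ℕ → List ℕ → SF
C k λ' = foldr Bν oneSF (kSplit k λ')

-- T^{(k)}_i, relationally.  T i f g means: f lies in the Q(q)-span of the
-- C^{(k)}_λ (λ k-bounded) and g = T^{(k)}_i f.  Denominators are cleared:
-- d·f = Σ c_λ C_λ with d ≠ 0, c_λ ∈ ℤ[q], and d·g = Σ_{λ₁ = i} c_λ C_λ.

lin : ℕ → List (List ℕ × ZPoly) → SF
lin k cs = foldr (λ p acc → scaleSF (proj₂ p) (C k (proj₁ p)) +SF acc) zeroSF cs

headIs : ℕ → List ℕ → Bool
headIs i []      = false
headIs i (x ∷ _) = x ℕ.≡ᵇ i

filterHead : ℕ → List (List ℕ × ZPoly) → List (List ℕ × ZPoly)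
filterHead i []       = []
filterHead i (p ∷ ps) = if headIs i (proj₁ p) then p ∷ filterHead i ps else filterHead i ps

TRel : ℕ → ℕ → SF → SF → Set
TRel k i f g =
  Σ ZPoly λ d → (¬ (d ≈P [])) ×
  Σ (List (List ℕ × ZPoly)) λ cs →
    All (λ p → KBounded k (proj₁ p)) cs ×
    (scaleSF d f ≈ lin k cs) ×
    (scaleSF d g ≈ lin k (filterHead i cs))

data IsKSchur (k : ℕ) : List ℕ → SF → Set where
  kEmpty  : ∀ {f} → f ≈ oneSF → IsKSchur k [] f
  kSingle : ∀ {a f} → 1 ℕ.≤ a → a ℕ.≤ k → f ≈ schurRow a → IsKSchur k (a ∷ []) f
  kStep   : ∀ {m x xs f g} → x ℕ.≤ m → m ℕ.≤ k →
            IsKSchur k (x ∷ xs) f → TRel k m (B (+ m) f) g →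
            IsKSchur k (m ∷ x ∷ xs) g

twoOne : ℕ → ℕ → List ℕ
twoOne n ℓ = replicate ℓ 2 ++ replicate (n ∸ 2 ℕ.* ℓ) 1

{-# OPTIONS --safe #-}
module Submission where

-- Write 𝔹₁₁ = 𝔹₁𝔹₁ - 𝔹₂𝔹₀. The exchange relation
--   𝔹_a 𝔹_b + 𝔹_{b-1} 𝔹_{a+1} = q (𝔹_{a+1} 𝔹_{b-1} + 𝔹_b 𝔹_a)
-- gives 𝔹₁𝔹₂ = q 𝔹₂𝔹₁, 𝔹₀𝔹₁ = q 𝔹₁𝔹₀ and 𝔹₀𝔹₂ = q 𝔹₂𝔹₀ + (q - 1) 𝔹₁𝔹₁.
-- Hence 𝔹₁ commutes with 𝔹₁₁, and the span of the 𝔹₂ᵃ 𝔹₁₁ᶜ (1) is stable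
-- under 𝔹₀ and 𝔹₁₁. Adding a part 2, or a part 1 to (1²ᶜ), the new C_λ is
-- simply 𝔹_{λ₁} of the old one. In the remaining case
--   𝔹₁ C_{(1²ᶜ⁺¹)} = C_{(1²ᶜ⁺²)} + 𝔹₂ 𝔹₀ 𝔹₁₁ᶜ (1),
-- and the last term is a combination of C_μ with μ₁ = 2, so T₁ kills it.
--
-- The exchange relation follows from the commutation relations of the Pieri
-- operators. On Schur coefficients these count the partitions that form
-- strips with two given partitions; those partitions are the integer points
-- of a box, and reflecting the box matches the two sides.

open import Defs
open import Data.Bool using (Bool; true; false; _∧_; if_then_else_; T)
open import Data.Empty using (⊥-elim)
open import Data.Integer as ℤ using (ℤ; +_; -[1+_]; _+_; _*_; -_; _-_)
import Data.Integer.Properties as ℤₚ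
open import Data.Integer.Tactic.RingSolver using (solve-∀)
open import Data.List using (List; []; _∷_; map; concatMap; foldr; length; replicate; upTo; applyUpTo; _++_)
import Data.List.Properties as Listₚ
open import Data.List.Relation.Unary.All as All using (All; []; _∷_)
import Data.List.Relation.Unary.All.Properties as Allₚ
open import Data.Nat as ℕ using (ℕ; zero; suc; _∸_; _≤_; _<_; _⊔_; _⊓_; z≤n; s≤s)
open import Data.Nat.Induction using (<-rec)
import Data.Nat.Properties as ℕₚ
open import Algebra.Properties.CommutativeSemigroup ℕₚ.+-commutativeSemigroup
  using (interchange; x∙yz≈y∙xz; x∙yz≈xz∙y)
open import Data.Product using (_×_; _,_; proj₁; proj₂; ∃)
open import Data.Sum using (_⊎_; inj₁; inj₂)
open import Function using (id; _∘_)
open import Relation.Binary using (Setoid; tri<; tri≈; tri>)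
open import Relation.Binary.PropositionalEquality
open import Relation.Nullary using (¬_; Dec; yes; no; does; contradiction)
import Algebra.Properties.AbelianGroup ℤₚ.+-0-abelianGroup as ℤG

-- The exchange relation comes from normal ordering, with multiplications to the left of adjoints.
-- Writing N and M for normally ordered products, 𝕊_a 𝕊_b = N(a,b) - N(a+1,b-1) with N symmetric, so
-- 𝕊_a 𝕊_b + 𝕊_{b-1} 𝕊_{a+1} = 0. Likewise 𝔹_a 𝔹_b = M(a,b) + q 𝔹_{a+1} 𝔹_{b-1}, and the relation
-- for 𝕊 gives M(a,b) + M(b-1,a+1) = 0. The obstacle is that 𝕊 and 𝔹 are truncated at a point
-- depending on the coefficient that is read off, so a product is not literally a double sum. Degree
-- bounds (`Bd`) replace these cut-offs by a uniform one, which is why the relations are stated for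
-- functions of bounded degree. The adjoints of e_r are never commuted by counting: they are
-- eliminated through the alternating sum of e_i^⊥ h_{n-i}^⊥, which vanishes for n > 0. Stability of
-- the span is not immediate, since 𝔹₁₁ does not commute with 𝔹₂. Moving 𝔹₁₁ past 𝔹₂ creates 𝔹₀, and
-- moving 𝔹₀ inwards creates 𝔹₁₁, each time in front of a word with one letter fewer; so both
-- statements are proved together.

+ˡ : ∀ a {b c : ℤ} → b ≡ c → a + b ≡ a + c
+ˡ a = cong (λ x → a + x)

+ʳ : ∀ {a b c : ℤ} → a ≡ b → a + c ≡ b + c
+ʳ {c = c} = cong (λ x → x + c)

-- Finite sums of integers

∑ : {A : Set} → List A → (A → ℤ) → ℤ
∑ []       g = + 0
∑ (x ∷ xs) g = g x + ∑ xs g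

module _ {A : Set} where

  ∑-cong-All : {xs : List A} {g h : A → ℤ} → All (λ x → g x ≡ h x) xs → ∑ xs g ≡ ∑ xs h
  ∑-cong-All []       = refl
  ∑-cong-All (e ∷ es) = cong₂ _+_ e (∑-cong-All es)

  ∑-cong : (xs : List A) {g h : A → ℤ} → (∀ x → g x ≡ h x) → ∑ xs g ≡ ∑ xs h
  ∑-cong []       e = refl
  ∑-cong (x ∷ xs) e = cong₂ _+_ (e x) (∑-cong xs e)

  ∑-0 : (xs : List A) → ∑ xs (λ _ → + 0) ≡ + 0
  ∑-0 []       = refl
  ∑-0 (x ∷ xs) = trans (ℤₚ.+-identityˡ _) (∑-0 xs)

  ∑-zero : {xs : List A} {g : A → ℤ} → All (λ x → g x ≡ + 0) xs → ∑ xs g ≡ + 0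
  ∑-zero {xs} e = trans (∑-cong-All e) (∑-0 xs)

  ∑-+ : (xs : List A) (g h : A → ℤ) → ∑ xs (λ x → g x + h x) ≡ ∑ xs g + ∑ xs h
  ∑-+ []       g h = refl
  ∑-+ (x ∷ xs) g h = trans (+ˡ (g x + h x) (∑-+ xs g h)) (lemma (g x) (h x) _ _)
    where
    lemma : ∀ a b c d → (a + b) + (c + d) ≡ (a + c) + (b + d)
    lemma = solve-∀

  ∑-* : (xs : List A) (c : ℤ) (g : A → ℤ) → ∑ xs (λ x → c * g x) ≡ c * ∑ xs g
  ∑-* []       c g = sym (ℤₚ.*-zeroʳ c)
  ∑-* (x ∷ xs) c g = trans (+ˡ (c * g x) (∑-* xs c g)) (sym (ℤₚ.*-distribˡ-+ c (g x) (∑ xs g)))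

  ∑-*ʳ : (xs : List A) (g : A → ℤ) (c : ℤ) → ∑ xs (λ x → g x * c) ≡ ∑ xs g * c
  ∑-*ʳ xs g c = trans (∑-cong xs (λ x → ℤₚ.*-comm (g x) c))
                      (trans (∑-* xs c g) (ℤₚ.*-comm c (∑ xs g)))

  ∑-++ : (xs ys : List A) (g : A → ℤ) → ∑ (xs ++ ys) g ≡ ∑ xs g + ∑ ys g
  ∑-++ []       ys g = sym (ℤₚ.+-identityˡ _)
  ∑-++ (x ∷ xs) ys g = trans (+ˡ (g x) (∑-++ xs ys g)) (sym (ℤₚ.+-assoc (g x) _ _))

  ∑-map : {B : Set} (f : A → B) (xs : List A) (g : B → ℤ) → ∑ (map f xs) g ≡ ∑ xs (g ∘ f)
  ∑-map f []       g = refl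
  ∑-map f (x ∷ xs) g = +ˡ (g (f x)) (∑-map f xs g)

∑-swap : {A B : Set} (xs : List A) (ys : List B) (g : A → B → ℤ) →
         ∑ xs (λ x → ∑ ys (g x)) ≡ ∑ ys (λ y → ∑ xs (λ x → g x y))
∑-swap []       ys g = sym (∑-0 ys)
∑-swap (x ∷ xs) ys g =
  trans (+ˡ (∑ ys (g x)) (∑-swap xs ys g)) (sym (∑-+ ys (g x) _))

∑-concatMap : {A B : Set} (f : A → List B) (xs : List A) (g : B → ℤ) →
              ∑ (concatMap f xs) g ≡ ∑ xs (λ x → ∑ (f x) g)
∑-concatMap f []       g = refl
∑-concatMap f (x ∷ xs) g =
  trans (∑-++ (f x) (concatMap f xs) g) (+ˡ (∑ (f x) g) (∑-concatMap f xs g))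

∑< : ℕ → (ℕ → ℤ) → ℤ
∑< n g = ∑ (upTo n) g

∑<-cong : ∀ n {g h : ℕ → ℤ} → (∀ x → x < n → g x ≡ h x) → ∑< n g ≡ ∑< n h
∑<-cong n e = ∑-cong-All (All.map (e _) (Allₚ.all-upTo n))

∑<-zero : ∀ n {g : ℕ → ℤ} → (∀ x → x < n → g x ≡ + 0) → ∑< n g ≡ + 0
∑<-zero n e = ∑-zero (All.map (e _) (Allₚ.all-upTo n))

∑-applyUpTo : ∀ {A : Set} (f : ℕ → A) n (g : A → ℤ) → ∑ (applyUpTo f n) g ≡ ∑< n (g ∘ f)
∑-applyUpTo f zero    g = refl
∑-applyUpTo f (suc n) g =
  +ˡ (g (f 0)) (trans (∑-applyUpTo (f ∘ suc) n g) (sym (∑-applyUpTo suc n (g ∘ f))))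

∑<-suc : ∀ n g → ∑< (suc n) g ≡ g 0 + ∑< n (g ∘ suc)
∑<-suc n g = +ˡ (g 0) (∑-applyUpTo suc n g)

∑<-split : ∀ m n g → ∑< (m ℕ.+ n) g ≡ ∑< m g + ∑< n (λ x → g (m ℕ.+ x))
∑<-split zero    n g = sym (ℤₚ.+-identityˡ _)
∑<-split (suc m) n g = begin
  ∑< (suc m ℕ.+ n) g                                       ≡⟨ ∑<-suc (m ℕ.+ n) g ⟩
  g 0 + ∑< (m ℕ.+ n) (g ∘ suc)                             ≡⟨ +ˡ (g 0) (∑<-split m n (g ∘ suc)) ⟩
  g 0 + (∑< m (g ∘ suc) + ∑< n (λ x → g (suc m ℕ.+ x)))    ≡⟨ ℤₚ.+-assoc (g 0) _ _ ⟨
  (g 0 + ∑< m (g ∘ suc)) + ∑< n (λ x → g (suc m ℕ.+ x))    ≡⟨ +ʳ (∑<-suc m g) ⟨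
  ∑< (suc m) g + ∑< n (λ x → g (suc m ℕ.+ x))              ∎
  where open ≡-Reasoning

∑<-last : ∀ n g → ∑< (suc n) g ≡ ∑< n g + g n
∑<-last n g = begin
  ∑< (suc n) g                          ≡⟨ cong (λ m → ∑< m g) (ℕₚ.+-comm 1 n) ⟩
  ∑< (n ℕ.+ 1) g                        ≡⟨ ∑<-split n 1 g ⟩
  ∑< n g + (g (n ℕ.+ 0) + + 0)          ≡⟨ +ˡ (∑< n g) (ℤₚ.+-identityʳ _) ⟩
  ∑< n g + g (n ℕ.+ 0)                  ≡⟨ cong (λ m → ∑< n g + g m) (ℕₚ.+-identityʳ n) ⟩
  ∑< n g + g n                          ∎
  where open ≡-Reasoning

∑<-extend : ∀ {m n} g → m ≤ n → (∀ x → m ≤ x → g x ≡ + 0) → ∑< m g ≡ ∑< n g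
∑<-extend {m} {n} g m≤n z = begin
  ∑< m g                                     ≡⟨ ℤₚ.+-identityʳ _ ⟨
  ∑< m g + + 0                               ≡⟨ +ˡ (∑< m g) (∑<-zero (n ∸ m) (λ x _ → z (m ℕ.+ x) (ℕₚ.m≤m+n m x))) ⟨
  ∑< m g + ∑< (n ∸ m) (λ x → g (m ℕ.+ x))    ≡⟨ ∑<-split m (n ∸ m) g ⟨
  ∑< (m ℕ.+ (n ∸ m)) g                       ≡⟨ cong (λ k → ∑< k g) (ℕₚ.m+[n∸m]≡n m≤n) ⟩
  ∑< n g                                     ∎
  where open ≡-Reasoning

∑<-extend₂ : ∀ m n g → (∀ x → m ≤ x → g x ≡ + 0) → (∀ x → n ≤ x → g x ≡ + 0) → ∑< m g ≡ ∑< n g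
∑<-extend₂ m n g z z′ =
  trans (∑<-extend g (ℕₚ.m≤m+n m n) z) (sym (∑<-extend g (ℕₚ.m≤n+m n m) z′))

∑<-reverse : ∀ n g → ∑< n g ≡ ∑< n (λ x → g (n ∸ suc x))
∑<-reverse zero    g = refl
∑<-reverse (suc n) g = begin
  ∑< (suc n) g                           ≡⟨ ∑<-last n g ⟩
  ∑< n g + g n                           ≡⟨ +ʳ (∑<-reverse n g) ⟩
  ∑< n (λ x → g (n ∸ suc x)) + g n       ≡⟨ ℤₚ.+-comm _ (g n) ⟩
  g n + ∑< n (λ x → g (n ∸ suc x))       ≡⟨ ∑<-suc n (λ x → g (suc n ∸ suc x)) ⟨
  ∑< (suc n) (λ x → g (suc n ∸ suc x))   ∎
  where open ≡-Reasoning

-- Empty when hi < lo.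
∑[_,_] : ℕ → ℕ → (ℕ → ℤ) → ℤ
∑[ lo , hi ] g = ∑< (suc hi ∸ lo) (λ t → g (lo ℕ.+ t))

m<n∸o⇒o+m<n : ∀ {m n} o → m < n ∸ o → o ℕ.+ m < n
m<n∸o⇒o+m<n {m} {n} o p = subst (_< n) (ℕₚ.+-comm m o) (ℕₚ.m≤o∸n⇒m+n≤o (suc m) (o≤n p) p)
  where
  o≤n : suc m ≤ n ∸ o → o ≤ n
  o≤n p with ℕₚ.≤-total o n
  ... | inj₁ le = le
  ... | inj₂ ge = contradiction (subst (suc m ≤_) (ℕₚ.m≤n⇒m∸n≡0 ge) p) λ ()

∑[]-cong : ∀ lo hi {g h : ℕ → ℤ} → (∀ x → lo ≤ x → x ≤ hi → g x ≡ h x) → ∑[ lo , hi ] g ≡ ∑[ lo , hi ] h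
∑[]-cong lo hi e = ∑<-cong (suc hi ∸ lo) λ t p →
  e (lo ℕ.+ t) (ℕₚ.m≤m+n lo t) (ℕₚ.≤-pred (m<n∸o⇒o+m<n lo p))

∑[]-zero : ∀ lo hi {g : ℕ → ℤ} → (∀ x → lo ≤ x → x ≤ hi → g x ≡ + 0) → ∑[ lo , hi ] g ≡ + 0
∑[]-zero lo hi e = trans (∑[]-cong lo hi e) (∑-0 (upTo (suc hi ∸ lo)))

∑[]-reflect : ∀ lo hi (g : ℕ → ℤ) → ∑[ lo , hi ] g ≡ ∑[ lo , hi ] (λ x → g (lo ℕ.+ hi ∸ x))
∑[]-reflect lo hi g = begin
  ∑< N (λ t → g (lo ℕ.+ t))                       ≡⟨ ∑<-reverse N _ ⟩
  ∑< N (λ t → g (lo ℕ.+ (N ∸ suc t)))             ≡⟨ ∑<-cong N (λ t p → cong g (index t p)) ⟩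
  ∑< N (λ t → g (lo ℕ.+ hi ∸ (lo ℕ.+ t)))         ∎
  where
  open ≡-Reasoning
  N = suc hi ∸ lo
  index : ∀ t → t < N → lo ℕ.+ (N ∸ suc t) ≡ lo ℕ.+ hi ∸ (lo ℕ.+ t)
  index t p = begin
    lo ℕ.+ (suc hi ∸ lo ∸ suc t)         ≡⟨ cong (lo ℕ.+_) (ℕₚ.∸-+-assoc (suc hi) lo (suc t)) ⟩
    lo ℕ.+ (suc hi ∸ (lo ℕ.+ suc t))     ≡⟨ cong (λ k → lo ℕ.+ (suc hi ∸ k)) (ℕₚ.+-suc lo t) ⟩
    lo ℕ.+ (hi ∸ (lo ℕ.+ t))             ≡⟨ ℕₚ.+-∸-assoc lo (ℕₚ.≤-pred (m<n∸o⇒o+m<n lo p)) ⟨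
    lo ℕ.+ hi ∸ (lo ℕ.+ t)               ∎

∑[]-singleton : ∀ m g → ∑[ m , m ] g ≡ g m
∑[]-singleton m g = begin
  ∑< (suc m ∸ m) (λ t → g (m ℕ.+ t))    ≡⟨ cong (λ k → ∑< k (λ t → g (m ℕ.+ t))) (ℕₚ.m+n∸n≡m 1 m) ⟩
  g (m ℕ.+ 0) + + 0                     ≡⟨ ℤₚ.+-identityʳ _ ⟩
  g (m ℕ.+ 0)                           ≡⟨ cong g (ℕₚ.+-identityʳ m) ⟩
  g m                                   ∎
  where open ≡-Reasoning

∑[]-pair : ∀ m g → ∑[ m , suc m ] g ≡ g m + g (suc m)
∑[]-pair m g = begin
  ∑< (suc (suc m) ∸ m) (λ t → g (m ℕ.+ t))   ≡⟨ cong (λ k → ∑< k (λ t → g (m ℕ.+ t))) (ℕₚ.m+n∸n≡m 2 m) ⟩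
  g (m ℕ.+ 0) + (g (m ℕ.+ 1) + + 0)          ≡⟨ cong₂ (λ a b → g a + b) (ℕₚ.+-identityʳ m) (ℤₚ.+-identityʳ _) ⟩
  g m + g (m ℕ.+ 1)                          ≡⟨ cong (λ k → g m + g k) (ℕₚ.+-comm m 1) ⟩
  g m + g (suc m)                            ∎
  where open ≡-Reasoning

∑[]-as-∑< : ∀ lo hi N (g G : ℕ → ℤ) → hi < N →
            (∀ x → lo ≤ x → x ≤ hi → G x ≡ g x) →
            (∀ x → x < lo → G x ≡ + 0) → (∀ x → hi < x → G x ≡ + 0) →
            ∑[ lo , hi ] g ≡ ∑< N G
∑[]-as-∑< lo hi N g G hi<N e zˡ zʳ = begin
  ∑[ lo , hi ] g                          ≡⟨ ∑[]-cong lo hi e ⟨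
  ∑< (suc hi ∸ lo) (λ t → G (lo ℕ.+ t))   ≡⟨ ℤₚ.+-identityˡ _ ⟨
  + 0 + ∑< (suc hi ∸ lo) (λ t → G (lo ℕ.+ t)) ≡⟨ +ʳ (∑<-zero lo zˡ) ⟨
  ∑< lo G + ∑< (suc hi ∸ lo) (λ t → G (lo ℕ.+ t)) ≡⟨ ∑<-split lo (suc hi ∸ lo) G ⟨
  ∑< (lo ℕ.+ (suc hi ∸ lo)) G             ≡⟨ ∑<-extend₂ (lo ℕ.+ (suc hi ∸ lo)) N G
                                               (λ x p → zʳ x (ℕₚ.≤-trans (ℕₚ.m≤n+m∸n (suc hi) lo) p))
                                               (λ x p → zʳ x (ℕₚ.<-≤-trans hi<N p)) ⟩
  ∑< N G                                  ∎
  where open ≡-Reasoning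

-- Sums over the integer points of a box

δ : ℤ → ℕ → ℤ
δ (+ m)    n = if m ℕ.≡ᵇ n then + 1 else + 0
δ -[1+ m ] n = + 0

δ-refl : ∀ n → δ (+ n) n ≡ + 1
δ-refl zero    = refl
δ-refl (suc n) = δ-refl n

δ-≢ : ∀ m n → m ≢ n → δ (+ m) n ≡ + 0
δ-≢ zero    zero    p = contradiction refl p
δ-≢ zero    (suc n) p = refl
δ-≢ (suc m) zero    p = refl
δ-≢ (suc m) (suc n) p = δ-≢ m n (p ∘ cong suc)

δ-shift : ∀ x m n → δ (+ (x ℕ.+ m)) (x ℕ.+ n) ≡ δ (+ m) n
δ-shift zero    m n = refl
δ-shift (suc x) m n = δ-shift x m n

sumTo : ℕ → (ℕ → ℕ) → ℕ
sumTo zero    f = 0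
sumTo (suc n) f = f 0 ℕ.+ sumTo n (f ∘ suc)

-- Box L lo hi w = Σ w(x₀ + ⋯ + x_{L-1}) over the integer points of the
-- box lo i ≤ xᵢ ≤ hi i.
Box : ℕ → (lo hi : ℕ → ℕ) → (ℕ → ℤ) → ℤ
Box zero    lo hi w = w 0
Box (suc L) lo hi w = ∑[ lo 0 , hi 0 ] λ x → Box L (lo ∘ suc) (hi ∘ suc) (λ s → w (x ℕ.+ s))

-- The total of a point lies between the totals of the two extreme corners. Reflection needs this
-- sharper congruence, because its truncated subtraction is exact only in that range.
Box-cong-range : ∀ L lo hi {w w′ : ℕ → ℤ} →
                 (∀ s → sumTo L lo ≤ s → s ≤ sumTo L hi → w s ≡ w′ s) →
                 Box L lo hi w ≡ Box L lo hi w′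
Box-cong-range zero    lo hi e = e 0 z≤n z≤n
Box-cong-range (suc L) lo hi e = ∑[]-cong (lo 0) (hi 0) λ x l h →
  Box-cong-range L (lo ∘ suc) (hi ∘ suc) λ s l′ h′ →
    e (x ℕ.+ s) (ℕₚ.+-mono-≤ l l′) (ℕₚ.+-mono-≤ h h′)

Box-cong : ∀ L lo hi {w w′ : ℕ → ℤ} → (∀ s → w s ≡ w′ s) → Box L lo hi w ≡ Box L lo hi w′
Box-cong L lo hi e = Box-cong-range L lo hi (λ s _ _ → e s)

Box-zero : ∀ L lo hi {w : ℕ → ℤ} → (∀ s → w s ≡ + 0) → Box L lo hi w ≡ + 0
Box-zero zero    lo hi e = e 0
Box-zero (suc L) lo hi e = ∑[]-zero (lo 0) (hi 0) λ x _ _ →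
  Box-zero L (lo ∘ suc) (hi ∘ suc) (λ s → e (x ℕ.+ s))

Box-∑ : ∀ {A : Set} (xs : List A) L lo hi (w : A → ℕ → ℤ) →
        Box L lo hi (λ s → ∑ xs (λ a → w a s)) ≡ ∑ xs (λ a → Box L lo hi (w a))
Box-∑ xs zero    lo hi w = refl
Box-∑ xs (suc L) lo hi w =
  trans (∑[]-cong (lo 0) (hi 0) (λ x _ _ → Box-∑ xs L (lo ∘ suc) (hi ∘ suc) (λ a s → w a (x ℕ.+ s))))
        (∑-swap (upTo (suc (hi 0) ∸ lo 0)) xs _)

Box-* : ∀ L lo hi c (w : ℕ → ℤ) → Box L lo hi (λ s → c * w s) ≡ c * Box L lo hi w
Box-* zero    lo hi c w = refl
Box-* (suc L) lo hi c w =
  trans (∑[]-cong (lo 0) (hi 0) (λ x _ _ → Box-* L (lo ∘ suc) (hi ∘ suc) c (λ s → w (x ℕ.+ s))))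
        (∑-* (upTo (suc (hi 0) ∸ lo 0)) c _)

-- Reflect every coordinate: xᵢ ↦ lo i + hi i - xᵢ.
Box-reflect : ∀ L lo hi w →
  Box L lo hi w ≡ Box L lo hi (λ s → w (sumTo L lo ℕ.+ sumTo L hi ∸ s))
Box-reflect zero    lo hi w = refl
Box-reflect (suc L) lo hi w = trans (∑[]-reflect (lo 0) (hi 0) (λ x → Box L lo′ hi′ (λ s → w (x ℕ.+ s))))
  (∑[]-cong (lo 0) (hi 0) λ x _ x≤ →
    trans (Box-reflect L lo′ hi′ (λ s → w (l ℕ.+ h ∸ x ℕ.+ s)))
          (Box-cong-range L lo′ hi′ λ s _ s≤ → cong w (index x s x≤ s≤)))
  where
  open ≡-Reasoning
  lo′ = lo ∘ suc
  hi′ = hi ∘ suc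
  l = lo 0
  h = hi 0
  l′ = sumTo L lo′
  h′ = sumTo L hi′
  index : ∀ x s → x ≤ h → s ≤ h′ →
          (l ℕ.+ h ∸ x) ℕ.+ (l′ ℕ.+ h′ ∸ s) ≡ (l ℕ.+ l′) ℕ.+ (h ℕ.+ h′) ∸ (x ℕ.+ s)
  index x s x≤ s≤ = begin
    (l ℕ.+ h ∸ x) ℕ.+ (l′ ℕ.+ h′ ∸ s)         ≡⟨ ℕₚ.+-∸-assoc (l ℕ.+ h ∸ x) (ℕₚ.≤-trans s≤ (ℕₚ.m≤n+m h′ l′)) ⟨
    (l ℕ.+ h ∸ x) ℕ.+ (l′ ℕ.+ h′) ∸ s         ≡⟨ cong (_∸ s) (ℕₚ.+-∸-comm (l′ ℕ.+ h′) (ℕₚ.≤-trans x≤ (ℕₚ.m≤n+m h l))) ⟨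
    (l ℕ.+ h) ℕ.+ (l′ ℕ.+ h′) ∸ x ∸ s         ≡⟨ ℕₚ.∸-+-assoc ((l ℕ.+ h) ℕ.+ (l′ ℕ.+ h′)) x s ⟩
    (l ℕ.+ h) ℕ.+ (l′ ℕ.+ h′) ∸ (x ℕ.+ s)     ≡⟨ cong (_∸ (x ℕ.+ s)) (interchange l h l′ h′) ⟩
    (l ℕ.+ l′) ℕ.+ (h ℕ.+ h′) ∸ (x ℕ.+ s)     ∎

-- With hi (i + 1) ≤ lo i and hi 0 = 0 the only candidate point is 0.
Box-degenerate : ∀ L lo hi w → (∀ i → hi (suc i) ≤ lo i) → hi 0 ≡ 0 → w 0 ≡ + 0 → Box L lo hi w ≡ + 0
Box-degenerate zero    lo hi w chain h₀ w₀ = w₀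
Box-degenerate (suc L) lo hi w chain h₀ w₀ = ∑[]-zero (lo 0) (hi 0) λ x l h →
  let x≡0 = ℕₚ.n≤0⇒n≡0 (ℕₚ.≤-trans h (ℕₚ.≤-reflexive h₀))
      l≡0 = ℕₚ.n≤0⇒n≡0 (ℕₚ.≤-trans l (ℕₚ.≤-reflexive x≡0))
  in Box-degenerate L (lo ∘ suc) (hi ∘ suc) (λ s → w (x ℕ.+ s)) (chain ∘ suc)
       (ℕₚ.n≤0⇒n≡0 (ℕₚ.≤-trans (chain 0) (ℕₚ.≤-reflexive l≡0)))
       (trans (cong (λ y → w (y ℕ.+ 0)) x≡0) w₀)

-- Partitions and their enumeration

≤ᵇ-true : ∀ {m n} → m ≤ n → (m ℕ.≤ᵇ n) ≡ true
≤ᵇ-true {m} {n} p with m ℕ.≤ᵇ n | ℕₚ.≤⇒≤ᵇ p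
... | true | _ = refl

true-≤ᵇ : ∀ {m n} → (m ℕ.≤ᵇ n) ≡ true → m ≤ n
true-≤ᵇ {m} {n} e = ℕₚ.≤ᵇ⇒≤ m n (subst T (sym e) _)

∧-true : ∀ {a b} → (a ∧ b) ≡ true → a ≡ true × b ≡ true
∧-true {true} {true} _ = refl , refl

true-∧ : ∀ {a b} → a ≡ true → b ≡ true → (a ∧ b) ≡ true
true-∧ refl refl = refl

partition-∷ : ∀ {x} κ → 1 ≤ x → IsPartition κ → get κ 0 ≤ x → IsPartition (x ∷ κ)
partition-∷ []      1≤x p h = ≤ᵇ-true 1≤x
partition-∷ (_ ∷ _) 1≤x p h = true-∧ (≤ᵇ-true h) p

partition-tail : ∀ {x} κ → IsPartition (x ∷ κ) → IsPartition κ
partition-tail []      p = refl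
partition-tail (_ ∷ _) p = proj₂ (∧-true p)

partition-head≤ : ∀ {x} κ → IsPartition (x ∷ κ) → get κ 0 ≤ x
partition-head≤ []      p = z≤n
partition-head≤ (_ ∷ _) p = true-≤ᵇ (proj₁ (∧-true p))

partition-positive : ∀ {x} κ → IsPartition (x ∷ κ) → 1 ≤ x
partition-positive []      p = true-≤ᵇ p
partition-positive (y ∷ κ) p =
  ℕₚ.≤-trans (partition-positive κ (partition-tail (y ∷ κ) p)) (partition-head≤ (y ∷ κ) p)

get-decreasing : ∀ κ → IsPartition κ → ∀ i → get κ (suc i) ≤ get κ i
get-decreasing []      p i       = z≤n
get-decreasing (x ∷ κ) p zero    = partition-head≤ κ p
get-decreasing (x ∷ κ) p (suc i) = get-decreasing κ (partition-tail κ p) i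

get-≥length : ∀ κ i → length κ ≤ i → get κ i ≡ 0
get-≥length []      i       p       = refl
get-≥length (x ∷ κ) (suc i) (s≤s p) = get-≥length κ i p

get-positive : ∀ κ → IsPartition κ → ∀ i → i < length κ → 1 ≤ get κ i
get-positive (x ∷ κ) p zero    q       = partition-positive κ p
get-positive (x ∷ κ) p (suc i) (s≤s q) = get-positive κ (partition-tail κ p) i q

get-injective : ∀ κ ν → IsPartition κ → IsPartition ν → (∀ i → get κ i ≡ get ν i) → κ ≡ ν
get-injective []      []      p q e = refl
get-injective []      (y ∷ ν) p q e = contradiction (subst (1 ≤_) (sym (e 0)) (partition-positive ν q)) λ ()
get-injective (x ∷ κ) []      p q e = contradiction (subst (1 ≤_) (e 0) (partition-positive κ p)) λ ()
get-injective (x ∷ κ) (y ∷ ν) p q e =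
  cong₂ _∷_ (e 0) (get-injective κ ν (partition-tail κ p) (partition-tail ν q) (e ∘ suc))

size-sumTo : ∀ κ L → length κ ≤ L → size κ ≡ sumTo L (get κ)
size-sumTo []      zero    p       = refl
size-sumTo []      (suc L) p       = size-sumTo [] L z≤n
size-sumTo (x ∷ κ) (suc L) (s≤s p) = cong (x ℕ.+_) (size-sumTo κ L p)

EnumSpec : ℕ → ℕ → List ℕ → Set
EnumSpec m b κ = IsPartition κ × get κ 0 ≤ b × size κ ≡ m

EnumSpec-∷ : ∀ {m b} t κ → t < b ⊓ suc m → EnumSpec (m ∸ t) (suc t) κ → EnumSpec (suc m) b (suc t ∷ κ)
EnumSpec-∷ {m} {b} t κ t< (p , h , e) =
  partition-∷ κ (s≤s z≤n) p h ,
  ℕₚ.≤-trans t< (ℕₚ.m⊓n≤m b (suc m)) ,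
  cong suc (trans (cong (t ℕ.+_) e) (ℕₚ.m+[n∸m]≡n (ℕₚ.≤-pred (ℕₚ.≤-trans t< (ℕₚ.m⊓n≤n b (suc m))))))

partsF-EnumSpec : ∀ f m b → m ≤ f → All (EnumSpec m b) (partsF f m b)
partsF-EnumSpec zero    zero    b p = (refl , z≤n , refl) ∷ []
partsF-EnumSpec (suc f) zero    b p = (refl , z≤n , refl) ∷ []
partsF-EnumSpec (suc f) (suc m) b (s≤s m≤f) =
  Allₚ.concat⁺ (Allₚ.map⁺ (Allₚ.map⁺ (All.map
    (λ {t} t< → Allₚ.map⁺ (All.map (λ {κ} → EnumSpec-∷ t κ t<)
       (partsF-EnumSpec f (m ∸ t) (suc t) (ℕₚ.≤-trans (ℕₚ.m∸n≤m m t) m≤f))))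
    (Allₚ.all-upTo (b ⊓ suc m)))))

∑-partsF : ∀ f m b g → ∑ (partsF (suc f) (suc m) b) g ≡
           ∑< (b ⊓ suc m) (λ t → ∑ (partsF f (m ∸ t) (suc t)) (λ κ → g (suc t ∷ κ)))
∑-partsF f m b g = begin
  ∑ (partsF (suc f) (suc m) b) g
    ≡⟨ ∑-concatMap _ (range 1 (b ⊓ suc m)) g ⟩
  ∑ (range 1 (b ⊓ suc m)) (λ a → ∑ (map (a ∷_) (partsF f (suc m ∸ a) a)) g)
    ≡⟨ ∑-map suc (upTo (b ⊓ suc m)) _ ⟩
  ∑< (b ⊓ suc m) (λ t → ∑ (map (suc t ∷_) (partsF f (m ∸ t) (suc t))) g)
    ≡⟨ ∑-cong (upTo (b ⊓ suc m)) (λ t → ∑-map (suc t ∷_) (partsF f (m ∸ t) (suc t)) g) ⟩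
  ∑< (b ⊓ suc m) (λ t → ∑ (partsF f (m ∸ t) (suc t)) (λ κ → g (suc t ∷ κ))) ∎
  where open ≡-Reasoning

InBox : (lo hi : ℕ → ℕ) → List ℕ → Set
InBox lo hi κ = ∀ i → lo i ≤ get κ i × get κ i ≤ hi i

record Indicates (P : List ℕ → Set) (Q : List ℕ → Set) (g : List ℕ → ℤ) : Set where
  field
    one : ∀ κ → Q κ → P κ → g κ ≡ + 1
    nil : ∀ κ → Q κ → ¬ P κ → g κ ≡ + 0

open Indicates

-- The condition `hi (suc i) ≤ lo i` makes every point of the box weakly decreasing, so the points
-- of total m are exactly the partitions of m in the box. Choosing the first part matches choosing
-- the first coordinate. The bound on b says that the enumeration cuts off no such point, and it
-- persists: the next bound is the chosen part, which is at least `lo 0` and hence at least `hi 1`.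
∑-partsF-Box : ∀ L lo hi → (∀ i → L ≤ i → lo i ≡ 0) → (∀ i → L ≤ i → hi i ≡ 0) →
               (∀ i → hi (suc i) ≤ lo i) →
               ∀ f m b {g} → m ≤ f → hi 0 ⊓ m ≤ b → Indicates (InBox lo hi) (EnumSpec m b) g →
               ∑ (partsF f m b) g ≡ Box L lo hi (δ (+ m))
∑-partsF-Box zero lo hi lo₀ hi₀ chain zero zero b p q I =
  trans (ℤₚ.+-identityʳ _) (one I [] (refl , z≤n , refl) (λ i → ℕₚ.≤-reflexive (lo₀ i z≤n) , z≤n))
∑-partsF-Box zero lo hi lo₀ hi₀ chain (suc f) zero b p q I =
  trans (ℤₚ.+-identityʳ _) (one I [] (refl , z≤n , refl) (λ i → ℕₚ.≤-reflexive (lo₀ i z≤n) , z≤n))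
∑-partsF-Box zero lo hi lo₀ hi₀ chain (suc f) (suc m) b {g} p q I =
  ∑-zero (All.map (λ {κ} s → nil I κ s (out κ s)) (partsF-EnumSpec (suc f) (suc m) b p))
  where
  out : ∀ κ → EnumSpec (suc m) b κ → ¬ InBox lo hi κ
  out []      (_ , _ , ())
  out (x ∷ κ) (p , _) B = contradiction (ℕₚ.≤-trans (partition-positive κ p) (ℕₚ.≤-trans (proj₂ (B 0)) (ℕₚ.≤-reflexive (hi₀ 0 z≤n)))) λ ()
∑-partsF-Box (suc L) lo hi lo₀ hi₀ chain f zero b {g} p q I = trans (enum₀ f) (lemma (lo 0) refl)
  where
  open ≡-Reasoning
  lo′ = lo ∘ suc
  hi′ = hi ∘ suc
  enum₀ : ∀ f → ∑ (partsF f 0 b) g ≡ g []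
  enum₀ zero    = ℤₚ.+-identityʳ _
  enum₀ (suc f) = ℤₚ.+-identityʳ _
  φ : ℕ → ℤ
  φ x = Box L lo′ hi′ (λ s → δ (+ 0) (x ℕ.+ s))
  φ-suc : ∀ x → φ (suc x) ≡ + 0
  φ-suc x = Box-zero L lo′ hi′ (λ _ → refl)
  lemma : ∀ l → lo 0 ≡ l → g [] ≡ ∑[ lo 0 , hi 0 ] φ
  lemma (suc l) e = trans
    (nil I [] (refl , z≤n , refl) (λ B → contradiction (subst (_≤ 0) e (proj₁ (B 0))) λ ()))
    (sym (∑[]-zero (lo 0) (hi 0) {φ} λ { zero 0≥ _ → contradiction (subst (_≤ 0) e 0≥) λ ()
                                   ; (suc x) _ _ → φ-suc x }))
  lemma zero e = begin
    g []                                ≡⟨ ℤₚ.+-identityʳ _ ⟨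
    ∑ (partsF 0 0 0) g                  ≡⟨ ∑-partsF-Box L lo′ hi′ (λ i p → lo₀ (suc i) (s≤s p)) (λ i p → hi₀ (suc i) (s≤s p))
                                              (chain ∘ suc) 0 0 0 z≤n (ℕₚ.m⊓n≤n (hi 1) 0) I′ ⟩
    φ 0                                 ≡⟨ ℤₚ.+-identityʳ _ ⟨
    φ 0 + + 0                           ≡⟨ +ˡ (φ 0) (∑<-zero (hi 0) (λ x _ → φ-suc x)) ⟨
    φ 0 + ∑< (hi 0) (φ ∘ suc)           ≡⟨ ∑<-suc (hi 0) φ ⟨
    ∑[ 0 , hi 0 ] φ                     ≡⟨ cong (λ l → ∑[ l , hi 0 ] φ) e ⟨
    ∑[ lo 0 , hi 0 ] φ                  ∎
    where
    cons : ∀ κ → EnumSpec 0 0 κ → InBox lo′ hi′ κ → InBox lo hi κ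
    cons []          s B zero    = ℕₚ.≤-reflexive e , z≤n
    cons []          s B (suc i) = B i
    cons (zero ∷ κ)  (p , _) = contradiction (partition-positive κ p) λ ()
    cons (suc x ∷ κ) (_ , () , _)
    tail : ∀ κ → EnumSpec 0 0 κ → InBox lo hi κ → InBox lo′ hi′ κ
    tail []          s B i = B (suc i)
    tail (zero ∷ κ)  (p , _) = contradiction (partition-positive κ p) λ ()
    tail (suc x ∷ κ) (_ , () , _)
    up : ∀ κ → EnumSpec 0 0 κ → EnumSpec 0 b κ
    up κ (p , h , s) = p , ℕₚ.≤-trans h z≤n , s
    I′ : Indicates (InBox lo′ hi′) (EnumSpec 0 0) g
    I′ .one κ s B = one I κ (up κ s) (cons κ s B)
    I′ .nil κ s B = nil I κ (up κ s) (B ∘ tail κ s)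
∑-partsF-Box (suc L) lo hi lo₀ hi₀ chain (suc f) (suc m) b {g} (s≤s m≤f) q I = begin
  ∑ (partsF (suc f) (suc m) b) g       ≡⟨ ∑-partsF f m b g ⟩
  ∑< M (λ t → ∑ (partsF f (m ∸ t) (suc t)) (λ κ → g (suc t ∷ κ)))
                                       ≡⟨ ∑<-cong M row ⟩
  ∑< M (G ∘ suc)                       ≡⟨ ℤₚ.+-identityˡ _ ⟨
  + 0 + ∑< M (G ∘ suc)                 ≡⟨ +ʳ G-0 ⟨
  G 0 + ∑< M (G ∘ suc)                 ≡⟨ ∑<-suc M G ⟨
  ∑< (suc M) G                         ≡⟨ ∑<-extend₂ (suc M) (suc (hi 0)) G (λ x → G-large x) (λ x p → G-out x (λ (_ , h) → ℕₚ.<⇒≱ p h)) ⟩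
  ∑< (suc (hi 0)) G                    ≡⟨ ∑[]-as-∑< (lo 0) (hi 0) (suc (hi 0)) φ G ℕₚ.≤-refl
                                            (λ x l h → G-in x (l , h))
                                            (λ x p → G-out x (λ (l , _) → ℕₚ.<⇒≱ p l))
                                            (λ x p → G-out x (λ (_ , h) → ℕₚ.<⇒≱ p h)) ⟨
  ∑[ lo 0 , hi 0 ] φ                   ∎
  where
  open ≡-Reasoning
  lo′ = lo ∘ suc
  hi′ = hi ∘ suc
  M = b ⊓ suc m
  φ : ℕ → ℤ
  φ x = Box L lo′ hi′ (λ s → δ (+ suc m) (x ℕ.+ s))
  inI : ∀ x → Dec (lo 0 ≤ x × x ≤ hi 0)
  inI x with lo 0 ℕ.≤? x | x ℕ.≤? hi 0
  ... | yes l | yes h = yes (l , h)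
  ... | no  l | _     = no (l ∘ proj₁)
  ... | _     | no h  = no (h ∘ proj₂)
  -- `φ` extended by zero outside the interval: the enumeration runs over first parts from 1 to M,
  -- the box from `lo 0` to `hi 0`, and both become sums of G over initial segments.
  G : ℕ → ℤ
  G x = if does (inI x) then φ x else + 0
  G-in : ∀ x → lo 0 ≤ x × x ≤ hi 0 → G x ≡ φ x
  G-in x p with inI x
  ... | yes _ = refl
  ... | no np = contradiction p np
  G-out : ∀ x → ¬ (lo 0 ≤ x × x ≤ hi 0) → G x ≡ + 0
  G-out x np with inI x
  ... | yes p = contradiction p np
  ... | no  _ = refl
  φ-large : ∀ x → suc m < x → φ x ≡ + 0
  φ-large x p = Box-zero L lo′ hi′ λ s → δ-≢ (suc m) (x ℕ.+ s) (ℕₚ.<⇒≢ (ℕₚ.≤-trans p (ℕₚ.m≤m+n x s)))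
  G-large : ∀ x → M < x → G x ≡ + 0
  G-large x p with inI x
  ... | no _ = refl
  ... | yes (_ , h) with x ℕ.≤? suc m
  ... | yes x≤ = contradiction (ℕₚ.⊓-glb (ℕₚ.≤-trans (ℕₚ.⊓-glb h x≤) q) x≤) (ℕₚ.<⇒≱ p)
  ... | no  x≰ = φ-large x (ℕₚ.≰⇒> x≰)
  -- Enumerated parts start at 1, so the value 0 must contribute nothing. It forces all later
  -- coordinates to be 0, and the total `suc m` is then missed.
  G-0 : G 0 ≡ + 0
  G-0 with inI 0
  ... | no _ = refl
  ... | yes (l , _) = Box-degenerate L lo′ hi′ _ (chain ∘ suc)
                        (ℕₚ.n≤0⇒n≡0 (ℕₚ.≤-trans (chain 0) l)) refl
  tail : ∀ {x κ} → InBox lo hi (x ∷ κ) → InBox lo′ hi′ κ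
  tail B i = B (suc i)
  row : ∀ t → t < M → ∑ (partsF f (m ∸ t) (suc t)) (λ κ → g (suc t ∷ κ)) ≡ G (suc t)
  row t t< with inI (suc t)
  ... | no np = ∑-zero (All.map (λ {κ} s → nil I (suc t ∷ κ) (EnumSpec-∷ t κ t< s) (λ B → np (B 0)))
                  (partsF-EnumSpec f (m ∸ t) (suc t) (ℕₚ.≤-trans (ℕₚ.m∸n≤m m t) m≤f)))
  ... | yes (l , h) = trans
      (∑-partsF-Box L lo′ hi′ (λ i p → lo₀ (suc i) (s≤s p)) (λ i p → hi₀ (suc i) (s≤s p)) (chain ∘ suc)
         f (m ∸ t) (suc t) (ℕₚ.≤-trans (ℕₚ.m∸n≤m m t) m≤f)
         (ℕₚ.≤-trans (ℕₚ.m⊓n≤m (hi 1) (m ∸ t)) (ℕₚ.≤-trans (chain 0) l)) I′)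
      (Box-cong L lo′ hi′ λ s → sym (trans
         (cong (λ k → δ (+ k) (t ℕ.+ s)) (sym (ℕₚ.m+[n∸m]≡n t≤m)))
         (δ-shift t (m ∸ t) s)))
    where
    t≤m : t ≤ m
    t≤m = ℕₚ.≤-pred (ℕₚ.≤-trans t< (ℕₚ.m⊓n≤n b (suc m)))
    cons : ∀ {κ} → InBox lo′ hi′ κ → InBox lo hi (suc t ∷ κ)
    cons B zero    = l , h
    cons B (suc i) = B i
    I′ : Indicates (InBox lo′ hi′) (EnumSpec (m ∸ t) (suc t)) (λ κ → g (suc t ∷ κ))
    I′ .one κ s B = one I (suc t ∷ κ) (EnumSpec-∷ t κ t< s) (cons B)
    I′ .nil κ s B = nil I (suc t ∷ κ) (EnumSpec-∷ t κ t< s) (B ∘ tail)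

-- With integer sizes one formula covers operators that raise and that lower the degree; a negative
-- size has no partitions.
parts : ℤ → List (List ℕ)
parts (+ m)    = partitions m
parts -[1+ m ] = []

PartitionOf : ℤ → List ℕ → Set
PartitionOf z κ = IsPartition κ × + size κ ≡ z

parts-PartitionOf : ∀ z → All (PartitionOf z) (parts z)
parts-PartitionOf (+ m)    = All.map (λ (p , _ , e) → p , cong +_ e) (partsF-EnumSpec m m m ℕₚ.≤-refl)
parts-PartitionOf -[1+ m ] = []

∑-parts-Box : ∀ L lo hi → (∀ i → L ≤ i → lo i ≡ 0) → (∀ i → L ≤ i → hi i ≡ 0) →
              (∀ i → hi (suc i) ≤ lo i) →
              ∀ z {g} → Indicates (InBox lo hi) (PartitionOf z) g →
              ∑ (parts z) g ≡ Box L lo hi (δ z)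
∑-parts-Box L lo hi lo₀ hi₀ chain (+ m) {g} I =
  ∑-partsF-Box L lo hi lo₀ hi₀ chain m m m ℕₚ.≤-refl (ℕₚ.m⊓n≤n (hi 0) m)
    (record { one = λ κ (p , _ , e) → one I κ (p , cong +_ e)
            ; nil = λ κ (p , _ , e) → nil I κ (p , cong +_ e) })
∑-parts-Box L lo hi lo₀ hi₀ chain -[1+ m ] I = sym (Box-zero L lo hi (λ _ → refl))

-- Horizontal and vertical strips

HorizontalStrip VerticalStrip : List ℕ → List ℕ → Set
HorizontalStrip λ′ μ = ∀ i → get μ i ≤ get λ′ i × get λ′ (suc i) ≤ get μ i
VerticalStrip   λ′ μ = ∀ i → get μ i ≤ get λ′ i × get λ′ i ≤ suc (get μ i)

allB-true : ∀ p xs → allB p xs ≡ true → All (λ x → p x ≡ true) xs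
allB-true p []       e = []
allB-true p (x ∷ xs) e = proj₁ (∧-true e) ∷ allB-true p xs (proj₂ (∧-true e))

true-allB : ∀ p {xs} → All (λ x → p x ≡ true) xs → allB p xs ≡ true
true-allB p []       = refl
true-allB p (e ∷ es) = true-∧ e (true-allB p es)

allB-upTo : ∀ p n → allB p (upTo n) ≡ true → ∀ i → i < n → p i ≡ true
allB-upTo p n e i i<n = Allₚ.applyUpTo⁻ id n (allB-true p (upTo n) e) i<n

get-≤⇒length-≤ : ∀ μ ν → IsPartition μ → (∀ i → get μ i ≤ get ν i) → length μ ≤ length ν
get-≤⇒length-≤ μ ν p h with length μ ℕ.≤? length ν
... | yes q = q
... | no ¬q = contradiction
  (ℕₚ.≤-trans (get-positive μ p (length ν) (ℕₚ.≰⇒> ¬q))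
     (ℕₚ.≤-trans (h (length ν)) (ℕₚ.≤-reflexive (get-≥length ν (length ν) ℕₚ.≤-refl)))) λ ()

horiz⇒HorizontalStrip : ∀ λ′ μ → horiz λ′ μ ≡ true → HorizontalStrip λ′ μ
horiz⇒HorizontalStrip λ′ μ e i with i ℕ.<? length λ′
... | yes i< = true-≤ᵇ (proj₁ h) , true-≤ᵇ (proj₂ h)
  where h = ∧-true (allB-upTo _ (length λ′) (proj₂ (∧-true e)) i i<)
... | no ¬i< = subst (_≤ get λ′ i) (sym (get-≥length μ i (ℕₚ.≤-trans (true-≤ᵇ (proj₁ (∧-true e))) (ℕₚ.≮⇒≥ ¬i<)))) z≤n
             , subst (_≤ get μ i) (sym (get-≥length λ′ (suc i) (ℕₚ.m≤n⇒m≤1+n (ℕₚ.≮⇒≥ ¬i<)))) z≤n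

HorizontalStrip⇒horiz : ∀ λ′ μ → IsPartition μ → HorizontalStrip λ′ μ → horiz λ′ μ ≡ true
HorizontalStrip⇒horiz λ′ μ p h = true-∧ (≤ᵇ-true (get-≤⇒length-≤ μ λ′ p (proj₁ ∘ h)))
  (true-allB _ (All.map (λ {i} _ → true-∧ (≤ᵇ-true (proj₁ (h i))) (≤ᵇ-true (proj₂ (h i)))) (Allₚ.all-upTo (length λ′))))

vert⇒VerticalStrip : ∀ λ′ μ → vert λ′ μ ≡ true → VerticalStrip λ′ μ
vert⇒VerticalStrip λ′ μ e i with i ℕ.<? length λ′
... | yes i< = true-≤ᵇ (proj₁ h) , true-≤ᵇ (proj₂ h)
  where h = ∧-true (allB-upTo _ (length λ′) (proj₂ (∧-true e)) i i<)
... | no ¬i< = subst (_≤ get λ′ i) (sym (get-≥length μ i (ℕₚ.≤-trans (true-≤ᵇ (proj₁ (∧-true e))) (ℕₚ.≮⇒≥ ¬i<)))) z≤n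
             , subst (_≤ suc (get μ i)) (sym (get-≥length λ′ i (ℕₚ.≮⇒≥ ¬i<))) z≤n

VerticalStrip⇒vert : ∀ λ′ μ → IsPartition μ → VerticalStrip λ′ μ → vert λ′ μ ≡ true
VerticalStrip⇒vert λ′ μ p h = true-∧ (≤ᵇ-true (get-≤⇒length-≤ μ λ′ p (proj₁ ∘ h)))
  (true-allB _ (All.map (λ {i} _ → true-∧ (≤ᵇ-true (proj₁ (h i))) (≤ᵇ-true (proj₂ (h i)))) (Allₚ.all-upTo (length λ′))))

ind : Bool → ℤ
ind true  = + 1
ind false = + 0

ind-*-Indicates : ∀ {P : List ℕ → Set} {z} (a b : List ℕ → Bool) →
                  (∀ κ → PartitionOf z κ → a κ ≡ true → b κ ≡ true → P κ) →
                  (∀ κ → PartitionOf z κ → P κ → a κ ≡ true × b κ ≡ true) →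
                  Indicates P (PartitionOf z) (λ κ → ind (a κ) * ind (b κ))
ind-*-Indicates a b f g .one κ p P with a κ | b κ | g κ p P
... | true | true | _ = refl
ind-*-Indicates a b f g .nil κ p ¬P with a κ | b κ | f κ p
... | true  | true  | h = contradiction (h refl refl) ¬P
... | true  | false | _ = refl
... | false | _     | _ = refl

-- Counting intermediate partitions

sumTo-cong : ∀ n {f g : ℕ → ℕ} → (∀ i → f i ≡ g i) → sumTo n f ≡ sumTo n g
sumTo-cong zero    e = refl
sumTo-cong (suc n) e = cong₂ ℕ._+_ (e 0) (sumTo-cong n (e ∘ suc))

sumTo-+ : ∀ n f g → sumTo n f ℕ.+ sumTo n g ≡ sumTo n (λ i → f i ℕ.+ g i)
sumTo-+ zero    f g = refl
sumTo-+ (suc n) f g = trans (interchange (f 0) _ (g 0) _) (cong (f 0 ℕ.+ g 0 ℕ.+_) (sumTo-+ n (f ∘ suc) (g ∘ suc)))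

sumTo-suc-zero : ∀ n f → f n ≡ 0 → sumTo (suc n) f ≡ sumTo n f
sumTo-suc-zero zero    f e = trans (ℕₚ.+-identityʳ (f 0)) e
sumTo-suc-zero (suc n) f e = cong (f 0 ℕ.+_) (sumTo-suc-zero n (f ∘ suc) e)

sumTo-mono : ∀ n {f g : ℕ → ℕ} → (∀ i → f i ≤ g i) → sumTo n f ≤ sumTo n g
sumTo-mono zero    h = z≤n
sumTo-mono (suc n) h = ℕₚ.+-mono-≤ (h 0) (sumTo-mono n (h ∘ suc))

sumTo-≤-≡ : ∀ n {f g : ℕ → ℕ} → (∀ i → f i ≤ g i) → sumTo n f ≡ sumTo n g → ∀ i → i < n → f i ≡ g i
sumTo-≤-≡ (suc n) {f} {g} h e i i< with ℕₚ.m≤n⇒m<n∨m≡n (h 0)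
... | inj₁ lt = contradiction e (ℕₚ.<⇒≢ (ℕₚ.+-mono-<-≤ lt (sumTo-mono n (h ∘ suc))))
sumTo-≤-≡ (suc n) {f} {g} h e zero    i<       | inj₂ eq = eq
sumTo-≤-≡ (suc n) {f} {g} h e (suc i) (s≤s i<) | inj₂ eq = sumTo-≤-≡ n (h ∘ suc)
  (ℕₚ.+-cancelˡ-≡ (g 0) _ _ (trans (cong (ℕ._+ sumTo n (f ∘ suc)) (sym eq)) e)) i i<

⊔+⊓ : ∀ m n → (m ⊔ n) ℕ.+ (m ⊓ n) ≡ m ℕ.+ n
⊔+⊓ zero    n       = ℕₚ.+-identityʳ n
⊔+⊓ (suc m) zero    = refl
⊔+⊓ (suc m) (suc n) = cong suc (trans (ℕₚ.+-suc _ _) (trans (cong suc (⊔+⊓ m n)) (sym (ℕₚ.+-suc m n))))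

δ-reflect : ∀ {T s} z z′ → z + z′ ≡ + T → s ≤ T → δ z (T ∸ s) ≡ δ z′ s
δ-reflect {T} {s} (+ m) (+ m′) e s≤T with m′ ℕ.≟ s
... | yes refl = trans (cong (δ (+ m)) (trans (cong (_∸ m′) (sym (ℤₚ.+-injective e))) (ℕₚ.m+n∸n≡m m m′)))
                       (trans (δ-refl m) (sym (δ-refl m′)))
... | no ne = trans (δ-≢ m (T ∸ s) λ m≡ → ne (ℕₚ.+-cancelˡ-≡ m _ _
                      (trans (ℤₚ.+-injective e) (trans (sym (ℕₚ.m∸n+n≡m s≤T)) (cong (ℕ._+ s) (sym m≡))))))
                    (sym (δ-≢ m′ s ne))
-- A negative partner pushes m above T, out of reach of T ∸ s; both sides are 0.
δ-reflect {T} {s} (+ m) -[1+ k ] e s≤T = δ-≢ m (T ∸ s) λ m≡ →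
  ℕₚ.<-irrefl refl (ℕₚ.<-≤-trans (ℤₚ.drop‿+<+ (subst (ℤ._< + m) e (ℤₚ.m⊖1+n<m m (suc k))))
    (ℕₚ.≤-trans (ℕₚ.≤-reflexive m≡) (ℕₚ.m∸n≤m T s)))
δ-reflect {T} {s} -[1+ k ] (+ m) e s≤T = sym (δ-≢ m s λ m≡ →
  ℕₚ.<-irrefl refl (ℕₚ.<-≤-trans (ℤₚ.drop‿+<+ (subst (ℤ._< + m) e (ℤₚ.m⊖1+n<m m (suc k))))
    (ℕₚ.≤-trans (ℕₚ.≤-reflexive m≡) s≤T)))
δ-reflect -[1+ k ] -[1+ k′ ] e s≤T = refl

module _ (λ′ ν : List ℕ) (pλ : IsPartition λ′) (pν : IsPartition ν) where

  private
    a b : ℕ → ℕ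
    a = get λ′
    b = get ν
    n : ℕ
    n = length λ′ ℕ.+ length ν
    a₀ : ∀ i → n ≤ i → a i ≡ 0
    a₀ i p = get-≥length λ′ i (ℕₚ.≤-trans (ℕₚ.m≤m+n _ _) p)
    b₀ : ∀ i → n ≤ i → b i ≡ 0
    b₀ i p = get-≥length ν i (ℕₚ.≤-trans (ℕₚ.m≤n+m _ _) p)
    |λ| : size λ′ ≡ sumTo n a
    |λ| = size-sumTo λ′ n (ℕₚ.m≤m+n _ _)
    |ν| : size ν ≡ sumTo n b
    |ν| = size-sumTo ν n (ℕₚ.m≤n+m _ _)

    ⊔-zero : ∀ {x y} → x ≡ 0 → y ≡ 0 → x ⊔ y ≡ 0
    ⊔-zero refl refl = refl

    ⊓-zeroˡ : ∀ {x} y → x ≡ 0 → x ⊓ y ≡ 0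
    ⊓-zeroˡ y refl = refl

  module Between where
    lo hi : ℕ → ℕ
    lo i = b i ⊔ a (suc i)
    hi zero    = a 0
    hi (suc i) = a (suc i) ⊓ b i

    -- `lo i` and `hi (suc i)` are the maximum and the minimum of the same pair `b i`, `a (suc i)`,
    -- so together they contribute its sum; only `hi 0 = a 0` stays single.
    total : sumTo (suc n) lo ℕ.+ sumTo (suc n) hi ≡ size λ′ ℕ.+ size ν
    total = begin
      sumTo (suc n) lo ℕ.+ (a 0 ℕ.+ sumTo n (hi ∘ suc))
        ≡⟨ cong (ℕ._+ (a 0 ℕ.+ sumTo n (hi ∘ suc))) (sumTo-suc-zero n lo (⊔-zero (b₀ n ℕₚ.≤-refl) (a₀ (suc n) (ℕₚ.n≤1+n n)))) ⟩
      sumTo n lo ℕ.+ (a 0 ℕ.+ sumTo n (hi ∘ suc))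
        ≡⟨ x∙yz≈y∙xz (sumTo n lo) (a 0) _ ⟩
      a 0 ℕ.+ (sumTo n lo ℕ.+ sumTo n (hi ∘ suc))
        ≡⟨ cong (a 0 ℕ.+_) (trans (sumTo-+ n lo (hi ∘ suc)) (sumTo-cong n λ i →
             trans (cong (lo i ℕ.+_) (ℕₚ.⊓-comm (a (suc i)) (b i))) (⊔+⊓ (b i) (a (suc i))))) ⟩
      a 0 ℕ.+ sumTo n (λ i → b i ℕ.+ a (suc i))
        ≡⟨ cong (a 0 ℕ.+_) (sumTo-+ n b (a ∘ suc)) ⟨
      a 0 ℕ.+ (sumTo n b ℕ.+ sumTo n (a ∘ suc))
        ≡⟨ x∙yz≈xz∙y (a 0) (sumTo n b) _ ⟩
      sumTo (suc n) a ℕ.+ sumTo n b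
        ≡⟨ cong₂ ℕ._+_ (trans (sumTo-suc-zero n a (a₀ n ℕₚ.≤-refl)) (sym |λ|)) (sym |ν|) ⟩
      size λ′ ℕ.+ size ν ∎
      where
      open ≡-Reasoning

    g : List ℕ → ℤ
    g κ = ind (horiz λ′ κ) * ind (horiz κ ν)

    count : ∀ z → ∑ (parts z) g ≡ Box (suc n) lo hi (δ z)
    count z = ∑-parts-Box (suc n) lo hi
      (λ i p → ⊔-zero (b₀ i (ℕₚ.≤-trans (ℕₚ.n≤1+n n) p)) (a₀ (suc i) (ℕₚ.≤-trans (ℕₚ.n≤1+n n) (ℕₚ.m≤n⇒m≤1+n p))))
      (λ { (suc i) (s≤s p) → ⊓-zeroˡ (b i) (a₀ (suc i) (ℕₚ.m≤n⇒m≤1+n p)) })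
      (λ i → ℕₚ.≤-trans (ℕₚ.m⊓n≤n (a (suc i)) (b i)) (ℕₚ.m≤m⊔n (b i) (a (suc i))))
      z (ind-*-Indicates (horiz λ′) (λ κ → horiz κ ν) into out)
      where
      into : ∀ κ → PartitionOf z κ → horiz λ′ κ ≡ true → horiz κ ν ≡ true → InBox lo hi κ
      into κ p h k i = ℕₚ.⊔-lub (proj₁ (K i)) (proj₂ (H i)) , upper i
        where
        H = horiz⇒HorizontalStrip λ′ κ h
        K = horiz⇒HorizontalStrip κ ν k
        upper : ∀ i → get κ i ≤ hi i
        upper zero    = proj₁ (H 0)
        upper (suc i) = ℕₚ.⊓-glb (proj₁ (H (suc i))) (proj₂ (K i))
      out : ∀ κ → PartitionOf z κ → InBox lo hi κ → horiz λ′ κ ≡ true × horiz κ ν ≡ true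
      out κ (p , _) B = HorizontalStrip⇒horiz λ′ κ p (λ i → upper i , ℕₚ.m⊔n≤o⇒n≤o (b i) (a (suc i)) (proj₁ (B i)))
                , HorizontalStrip⇒horiz κ ν pν (λ i → ℕₚ.m⊔n≤o⇒m≤o (b i) (a (suc i)) (proj₁ (B i))
                                                , ℕₚ.m≤n⊓o⇒m≤o (a (suc i)) (b i) (proj₂ (B (suc i))))
        where
        upper : ∀ i → get κ i ≤ a i
        upper zero    = proj₂ (B 0)
        upper (suc i) = ℕₚ.m≤n⊓o⇒m≤n (a (suc i)) (b i) (proj₂ (B (suc i)))

  -- Reflecting the box `Between` turns total z into |λ′| + |ν| - z. This is the coefficient form of
  -- h_a h_b = h_b h_a, and read adjointly of the commutation of the h_j^⊥.
  between-symmetric : ∀ z z′ → z + z′ ≡ + size λ′ + + size ν →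
    ∑ (parts z)  (λ κ → ind (horiz λ′ κ) * ind (horiz κ ν)) ≡
    ∑ (parts z′) (λ κ → ind (horiz λ′ κ) * ind (horiz κ ν))
  between-symmetric z z′ e = begin
    ∑ (parts z) g                                    ≡⟨ count z ⟩
    Box (suc n) lo hi (δ z)                          ≡⟨ Box-reflect (suc n) lo hi (δ z) ⟩
    Box (suc n) lo hi (λ s → δ z (Tot ∸ s))          ≡⟨ Box-cong-range (suc n) lo hi (λ s _ h →
                                                          δ-reflect z z′ (trans e (cong +_ (sym total))) (ℕₚ.≤-trans h (ℕₚ.m≤n+m _ (sumTo (suc n) lo)))) ⟩
    Box (suc n) lo hi (δ z′)                         ≡⟨ count z′ ⟨
    ∑ (parts z′) g                                   ∎
    where
    open ≡-Reasoning
    open Between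
    Tot = sumTo (suc n) lo ℕ.+ sumTo (suc n) hi

  module Below where
    lo hi : ℕ → ℕ
    lo i = a (suc i) ⊔ b (suc i)
    hi i = a i ⊓ b i

    -- `lo` lists the row maxima without the first one, `a 0 ⊔ b 0`. Putting it back pairs each
    -- maximum with the minimum of the same row.
    total : (a 0 ⊔ b 0) ℕ.+ (sumTo n lo ℕ.+ sumTo n hi) ≡ size λ′ ℕ.+ size ν
    total = begin
      (a 0 ⊔ b 0) ℕ.+ (sumTo n lo ℕ.+ sumTo n hi)
        ≡⟨ ℕₚ.+-assoc (a 0 ⊔ b 0) (sumTo n lo) (sumTo n hi) ⟨
      sumTo (suc n) (λ i → a i ⊔ b i) ℕ.+ sumTo n hi
        ≡⟨ cong (ℕ._+ sumTo n hi) (sumTo-suc-zero n (λ i → a i ⊔ b i) (⊔-zero (a₀ n ℕₚ.≤-refl) (b₀ n ℕₚ.≤-refl))) ⟩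
      sumTo n (λ i → a i ⊔ b i) ℕ.+ sumTo n hi
        ≡⟨ trans (sumTo-+ n _ hi) (sumTo-cong n (λ i → ⊔+⊓ (a i) (b i))) ⟩
      sumTo n (λ i → a i ℕ.+ b i)
        ≡⟨ sumTo-+ n a b ⟨
      sumTo n a ℕ.+ sumTo n b
        ≡⟨ cong₂ ℕ._+_ |λ| |ν| ⟨
      size λ′ ℕ.+ size ν ∎
      where open ≡-Reasoning

    count : ∀ z → ∑ (parts z) (λ κ → ind (horiz ν κ) * ind (horiz λ′ κ)) ≡ Box n lo hi (δ z)
    count z = ∑-parts-Box n lo hi
      (λ i p → ⊔-zero (a₀ (suc i) (ℕₚ.m≤n⇒m≤1+n p)) (b₀ (suc i) (ℕₚ.m≤n⇒m≤1+n p)))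
      (λ i p → ⊓-zeroˡ (b i) (a₀ i p))
      (λ i → ℕₚ.≤-trans (ℕₚ.m⊓n≤m (a (suc i)) (b (suc i))) (ℕₚ.m≤m⊔n (a (suc i)) (b (suc i))))
      z (ind-*-Indicates (horiz ν) (horiz λ′) into out)
      where
      into : ∀ κ → PartitionOf z κ → horiz ν κ ≡ true → horiz λ′ κ ≡ true → InBox lo hi κ
      into κ p k h i = ℕₚ.⊔-lub (proj₂ (H i)) (proj₂ (K i)) , ℕₚ.⊓-glb (proj₁ (H i)) (proj₁ (K i))
        where
        H = horiz⇒HorizontalStrip λ′ κ h
        K = horiz⇒HorizontalStrip ν κ k
      out : ∀ κ → PartitionOf z κ → InBox lo hi κ → horiz ν κ ≡ true × horiz λ′ κ ≡ true
      out κ (p , _) B = HorizontalStrip⇒horiz ν κ p (λ i → ℕₚ.m≤n⊓o⇒m≤o (a i) (b i) (proj₂ (B i))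
                                               , ℕₚ.m⊔n≤o⇒n≤o (a (suc i)) (b (suc i)) (proj₁ (B i)))
                , HorizontalStrip⇒horiz λ′ κ p (λ i → ℕₚ.m≤n⊓o⇒m≤n (a i) (b i) (proj₂ (B i))
                                               , ℕₚ.m⊔n≤o⇒m≤o (a (suc i)) (b (suc i)) (proj₁ (B i)))

  -- The first row of κ ⊇ λ′, ν is only bounded below (up to the cut-off c);
  -- the other rows range over the box `Below`.
  module Above (c : ℕ) where
    lo hi : ℕ → ℕ
    lo i = a i ⊔ b i
    hi zero    = c
    hi (suc i) = a i ⊓ b i

    count : ∀ t → t ≤ c → ∑ (parts (+ t)) (λ κ → ind (horiz κ ν) * ind (horiz κ λ′)) ≡ Box (suc n) lo hi (δ (+ t))
    count t t≤c = ∑-parts-Box (suc n) lo hi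
      (λ i p → ⊔-zero (a₀ i (ℕₚ.≤-trans (ℕₚ.n≤1+n n) p)) (b₀ i (ℕₚ.≤-trans (ℕₚ.n≤1+n n) p)))
      (λ { (suc i) (s≤s p) → ⊓-zeroˡ (b i) (a₀ i p) })
      (λ i → ℕₚ.≤-trans (ℕₚ.m⊓n≤m (a i) (b i)) (ℕₚ.m≤m⊔n (a i) (b i)))
      (+ t) (ind-*-Indicates (λ κ → horiz κ ν) (λ κ → horiz κ λ′) into out)
      where
      first≤ : ∀ κ → PartitionOf (+ t) κ → get κ 0 ≤ c
      first≤ []      _       = z≤n
      first≤ (x ∷ κ) (_ , e) = ℕₚ.≤-trans (ℕₚ.m≤m+n x (size κ)) (ℕₚ.≤-trans (ℕₚ.≤-reflexive (ℤₚ.+-injective e)) t≤c)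
      into : ∀ κ → PartitionOf (+ t) κ → horiz κ ν ≡ true → horiz κ λ′ ≡ true → InBox lo hi κ
      into κ p k h i = ℕₚ.⊔-lub (proj₁ (H i)) (proj₁ (K i)) , upper i
        where
        H = horiz⇒HorizontalStrip κ λ′ h
        K = horiz⇒HorizontalStrip κ ν k
        upper : ∀ i → get κ i ≤ hi i
        upper zero    = first≤ κ p
        upper (suc i) = ℕₚ.⊓-glb (proj₂ (H i)) (proj₂ (K i))
      out : ∀ κ → PartitionOf (+ t) κ → InBox lo hi κ → horiz κ ν ≡ true × horiz κ λ′ ≡ true
      out κ p B = HorizontalStrip⇒horiz κ ν pν (λ i → ℕₚ.m⊔n≤o⇒n≤o (a i) (b i) (proj₁ (B i))
                                                , ℕₚ.m≤n⊓o⇒m≤o (a i) (b i) (proj₂ (B (suc i))))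
                , HorizontalStrip⇒horiz κ λ′ pλ (λ i → ℕₚ.m⊔n≤o⇒m≤o (a i) (b i) (proj₁ (B i))
                                                , ℕₚ.m≤n⊓o⇒m≤n (a i) (b i) (proj₂ (B (suc i))))

  -- Lowering the first row by one matches the κ of size s + 1 whose first row exceeds the least
  -- possible value m with all κ of size s. In the remaining κ the first row is m, and the other
  -- rows form a point of the box `Below` of total s + 1 - m; reflecting that box gives total z.
  above-below : ∀ s z → z + + suc s ≡ + size λ′ + + size ν →
    ∑ (parts (+ suc s)) (λ κ → ind (horiz κ ν) * ind (horiz κ λ′)) ≡
    ∑ (parts (+ s)) (λ κ → ind (horiz κ ν) * ind (horiz κ λ′)) +
    ∑ (parts z) (λ κ → ind (horiz ν κ) * ind (horiz λ′ κ))
  above-below s z e = begin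
    ∑ (parts (+ suc s)) _            ≡⟨ count (suc s) ℕₚ.≤-refl ⟩
    ∑[ m , suc s ] (h (+ suc s))     ≡⟨ first-row ⟩
    ∑[ m , suc s ] (h (+ s)) + h (+ suc s) m
                                     ≡⟨ cong₂ _+_ (count s (ℕₚ.n≤1+n s)) below ⟨
    ∑ (parts (+ s)) _ + ∑ (parts z) _ ∎
    where
    open ≡-Reasoning
    open Above (suc s)
    m = a 0 ⊔ b 0
    lo′ = Below.lo
    hi′ = Below.hi
    h : ℤ → ℕ → ℤ
    h t x = Box n lo′ hi′ (λ r → δ t (x ℕ.+ r))
    h-large : ∀ t x → t < x → h (+ t) x ≡ + 0
    h-large t x p = Box-zero n lo′ hi′ λ r → δ-≢ t (x ℕ.+ r) (ℕₚ.<⇒≢ (ℕₚ.≤-trans p (ℕₚ.m≤m+n x r)))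
    first-row : ∑[ m , suc s ] (h (+ suc s)) ≡ ∑[ m , suc s ] (h (+ s)) + h (+ suc s) m
    first-row with m ℕ.≤? suc s
    ... | yes m≤ = begin
      ∑< (suc (suc s) ∸ m) (λ t → h (+ suc s) (m ℕ.+ t))      ≡⟨ cong (λ N → ∑< N (λ t → h (+ suc s) (m ℕ.+ t))) len ⟩
      ∑< (suc N) (λ t → h (+ suc s) (m ℕ.+ t))                ≡⟨ ∑<-suc N (λ t → h (+ suc s) (m ℕ.+ t)) ⟩
      h (+ suc s) (m ℕ.+ 0) + ∑< N (λ t → h (+ suc s) (m ℕ.+ suc t))
        ≡⟨ cong₂ _+_ (cong (h (+ suc s)) (ℕₚ.+-identityʳ m))
                     (∑<-cong N (λ t _ → cong (h (+ suc s)) (ℕₚ.+-suc m t))) ⟩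
      h (+ suc s) m + ∑< N (λ t → h (+ s) (m ℕ.+ t))          ≡⟨ ℤₚ.+-comm (h (+ suc s) m) _ ⟩
      ∑< N (λ t → h (+ s) (m ℕ.+ t)) + h (+ suc s) m          ≡⟨ +ʳ (ℤₚ.+-identityʳ (∑< N (λ t → h (+ s) (m ℕ.+ t)))) ⟨
      -- A first row of length s + 1 already exceeds the size s, so adding that zero term restores
      -- the full range.
      ∑< N (λ t → h (+ s) (m ℕ.+ t)) + + 0 + h (+ suc s) m    ≡⟨ +ʳ (+ˡ (∑< N (λ t → h (+ s) (m ℕ.+ t)))
                                                                   (h-large s (m ℕ.+ N) (ℕₚ.≤-reflexive (sym (ℕₚ.m+[n∸m]≡n m≤))))) ⟨
      ∑< N (λ t → h (+ s) (m ℕ.+ t)) + h (+ s) (m ℕ.+ N) + h (+ suc s) m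
                                                              ≡⟨ +ʳ (∑<-last N (λ t → h (+ s) (m ℕ.+ t))) ⟨
      ∑< (suc N) (λ t → h (+ s) (m ℕ.+ t)) + h (+ suc s) m    ≡⟨ cong (λ N → ∑< N (λ t → h (+ s) (m ℕ.+ t)) + h (+ suc s) m) len ⟨
      ∑< (suc (suc s) ∸ m) (λ t → h (+ s) (m ℕ.+ t)) + h (+ suc s) m ∎
      where
      N = suc s ∸ m
      len : suc (suc s) ∸ m ≡ suc N
      len = ℕₚ.+-∸-assoc 1 m≤
    ... | no m≰ = begin
      ∑[ m , suc s ] (h (+ suc s))   ≡⟨ empty (h (+ suc s)) ⟩
      + 0                            ≡⟨ cong₂ _+_ (empty (h (+ s))) (h-large (suc s) m (ℕₚ.≰⇒> m≰)) ⟨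
      ∑[ m , suc s ] (h (+ s)) + h (+ suc s) m ∎
      where
      empty : ∀ φ → ∑[ m , suc s ] φ ≡ + 0
      empty φ = ∑[]-zero m (suc s) {φ} λ x l u → contradiction (ℕₚ.≤-trans l u) m≰
    below : ∑ (parts z) (λ κ → ind (horiz ν κ) * ind (horiz λ′ κ)) ≡ h (+ suc s) m
    below = begin
      ∑ (parts z) _                                          ≡⟨ Below.count z ⟩
      Box n lo′ hi′ (δ z)                                    ≡⟨ Box-cong-range n lo′ hi′ (λ r _ r≤ → index r (ℕₚ.≤-trans r≤ (ℕₚ.m≤n+m _ (sumTo n lo′)))) ⟨
      Box n lo′ hi′ (λ r → δ (+ suc s) (m ℕ.+ (Tot ∸ r)))    ≡⟨ Box-reflect n lo′ hi′ (λ r → δ (+ suc s) (m ℕ.+ r)) ⟨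
      h (+ suc s) m                                          ∎
      where
      Tot = sumTo n lo′ ℕ.+ sumTo n hi′
      index : ∀ r → r ≤ Tot → δ (+ suc s) (m ℕ.+ (Tot ∸ r)) ≡ δ z r
      index r r≤ = trans (cong (δ (+ suc s)) (sym (ℕₚ.+-∸-assoc m r≤)))
        (δ-reflect (+ suc s) z (trans (ℤₚ.+-comm (+ suc s) z) (trans e (cong +_ (sym Below.total))))
                   (ℕₚ.≤-trans r≤ (ℕₚ.m≤n+m Tot m)))

-- Alternating counts with vertical strips

sign-suc : ∀ n → sign (suc n) ≡ - sign n
sign-suc zero          = refl
sign-suc (suc zero)    = refl
sign-suc (suc (suc n)) = sign-suc n

sign-+ : ∀ m n → sign (m ℕ.+ n) ≡ sign m * sign n
sign-+ zero    n = sym (ℤₚ.*-identityˡ (sign n))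
sign-+ (suc m) n = begin
  sign (suc (m ℕ.+ n))     ≡⟨ sign-suc (m ℕ.+ n) ⟩
  - sign (m ℕ.+ n)         ≡⟨ cong -_ (sign-+ m n) ⟩
  - (sign m * sign n)      ≡⟨ ℤₚ.neg-distribˡ-* (sign m) (sign n) ⟩
  - sign m * sign n        ≡⟨ cong (_* sign n) (sign-suc m) ⟨
  sign (suc m) * sign n    ∎
  where open ≡-Reasoning

sign-*-sign : ∀ n → sign n * sign n ≡ + 1
sign-*-sign zero          = refl
sign-*-sign (suc zero)    = refl
sign-*-sign (suc (suc n)) = sign-*-sign n

-- Proceed from the last row: where λ′ and ν first differ (counted from the
-- end), either the interval is empty or it consists of ν i and ν i + 1.
alternating-Box : ∀ L (a b : ℕ → ℕ) → (∀ i → b (suc i) ≤ b i) → (∀ i → L ≤ i → a i ≡ b i) →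
  (∀ i → a i ≡ b i) ⊎
  (∀ (w : ℕ → ℤ) → (∀ s → w (suc s) ≡ - w s) →
    Box L (λ i → b i ⊔ a (suc i)) (λ i → suc (b i) ⊓ a i) w ≡ + 0)
alternating-Box zero    a b dec e = inj₁ (λ i → e i z≤n)
alternating-Box (suc L) a b dec e with alternating-Box L (a ∘ suc) (b ∘ suc) (dec ∘ suc) (λ i p → e (suc i) (s≤s p))
... | inj₂ z = inj₂ λ w alt → ∑[]-zero (b 0 ⊔ a 1) (suc (b 0) ⊓ a 0) λ x _ _ →
  z (λ s → w (x ℕ.+ s)) (λ s → trans (cong w (ℕₚ.+-suc x s)) (alt (x ℕ.+ s)))
... | inj₁ eq with ℕₚ.<-cmp (a 0) (b 0)
... | tri≈ _ a≡b _ = inj₁ λ { zero → a≡b ; (suc i) → eq i }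
... | tri< a<b _ _ = inj₂ λ w alt → ∑[]-zero (b 0 ⊔ a 1) (suc (b 0) ⊓ a 0)
  {λ x → Box L (λ i → b (suc i) ⊔ a (suc (suc i))) (λ i → suc (b (suc i)) ⊓ a (suc i)) (λ s → w (x ℕ.+ s))} λ x l h →
  contradiction (ℕₚ.≤-trans (ℕₚ.m⊔n≤o⇒m≤o (b 0) (a 1) l) (ℕₚ.m≤n⊓o⇒m≤o (suc (b 0)) (a 0) h)) (ℕₚ.<⇒≱ a<b)
... | tri> _ _ a>b = inj₂ λ w alt → begin
  ∑[ b 0 ⊔ a 1 , suc (b 0) ⊓ a 0 ] (φ w)
    ≡⟨ cong₂ (λ l h → ∑[ l , h ] (φ w))
         (ℕₚ.m≥n⇒m⊔n≡m (ℕₚ.≤-trans (ℕₚ.≤-reflexive (eq 0)) (dec 0))) (ℕₚ.m≤n⇒m⊓n≡m a>b) ⟩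
  ∑[ b 0 , suc (b 0) ] (φ w)     ≡⟨ ∑[]-pair (b 0) (φ w) ⟩
  φ w (b 0) + φ w (suc (b 0))    ≡⟨ +ˡ (φ w (b 0)) (opposite w alt) ⟩
  φ w (b 0) + - φ w (b 0)        ≡⟨ ℤₚ.+-inverseʳ (φ w (b 0)) ⟩
  + 0                            ∎
  where
  open ≡-Reasoning
  lo′ hi′ : ℕ → ℕ
  lo′ i = b (suc i) ⊔ a (suc (suc i))
  hi′ i = suc (b (suc i)) ⊓ a (suc i)
  φ : (ℕ → ℤ) → ℕ → ℤ
  φ w x = Box L lo′ hi′ (λ s → w (x ℕ.+ s))
  opposite : ∀ w → (∀ s → w (suc s) ≡ - w s) → φ w (suc (b 0)) ≡ - φ w (b 0)
  opposite w alt = begin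
    φ w (suc (b 0))                                        ≡⟨ Box-cong L lo′ hi′ (λ s → trans (alt (b 0 ℕ.+ s)) (sym (ℤₚ.-1*i≡-i _))) ⟩
    Box L lo′ hi′ (λ s → -[1+ 0 ] * w (b 0 ℕ.+ s))         ≡⟨ Box-* L lo′ hi′ -[1+ 0 ] (λ s → w (b 0 ℕ.+ s)) ⟩
    -[1+ 0 ] * φ w (b 0)                                   ≡⟨ ℤₚ.-1*i≡-i (φ w (b 0)) ⟩
    - φ w (b 0)                                            ∎

∑<-δ : ∀ N (c : ℕ → ℤ) m j → j < N → ∑< N (λ i → c i * δ (+ (m ℕ.+ i)) (m ℕ.+ j)) ≡ c j
∑<-δ N c (suc m) j       p = ∑<-δ N c m j p
∑<-δ (suc N) c zero zero p = begin
  ∑< (suc N) (λ i → c i * δ (+ i) 0)                  ≡⟨ ∑<-suc N (λ i → c i * δ (+ i) 0) ⟩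
  c 0 * + 1 + ∑< N (λ i → c (suc i) * + 0)            ≡⟨ cong₂ _+_ (ℤₚ.*-identityʳ (c 0)) (∑<-zero N (λ i _ → ℤₚ.*-zeroʳ (c (suc i)))) ⟩
  c 0 + + 0                                           ≡⟨ ℤₚ.+-identityʳ (c 0) ⟩
  c 0                                                 ∎
  where open ≡-Reasoning
∑<-δ (suc N) c zero (suc j) (s≤s p) = begin
  ∑< (suc N) (λ i → c i * δ (+ i) (suc j))            ≡⟨ ∑<-suc N (λ i → c i * δ (+ i) (suc j)) ⟩
  c 0 * + 0 + ∑< N (λ i → c (suc i) * δ (+ i) j)      ≡⟨ cong₂ _+_ (ℤₚ.*-zeroʳ (c 0)) (∑<-δ N (c ∘ suc) 0 j p) ⟩
  + 0 + c (suc j)                                     ≡⟨ ℤₚ.+-identityˡ (c (suc j)) ⟩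
  c (suc j)                                           ∎
  where open ≡-Reasoning

≤-size-≡ : ∀ μ λ′ → IsPartition μ → IsPartition λ′ → (∀ i → get μ i ≤ get λ′ i) → size μ ≡ size λ′ → μ ≡ λ′
≤-size-≡ μ λ′ pμ pλ h e = get-injective μ λ′ pμ pλ eq
  where
  L = length μ ℕ.+ length λ′
  eq : ∀ i → get μ i ≡ get λ′ i
  eq i with i ℕ.<? L
  ... | yes i< = sumTo-≤-≡ L h (trans (sym (size-sumTo μ L (ℕₚ.m≤m+n _ _))) (trans e (size-sumTo λ′ L (ℕₚ.m≤n+m _ _)))) i i<
  ... | no ¬i< = trans (get-≥length μ i (ℕₚ.≤-trans (ℕₚ.m≤m+n _ _) (ℕₚ.≮⇒≥ ¬i<)))
                       (sym (get-≥length λ′ i (ℕₚ.≤-trans (ℕₚ.m≤n+m _ _) (ℕₚ.≮⇒≥ ¬i<))))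

-- Coefficient form of the vanishing of Σ (-1)^i e_i^⊥ h_{n+1-i}^⊥. The sum weights each
-- intermediate κ by (-1)^(|κ|-|ν|), an alternating weight on one box; equality of λ′ and ν, the
-- exception in `alternating-Box`, is excluded by the sizes.
∑-vert-horiz : ∀ λ′ ν n → IsPartition λ′ → IsPartition ν → size λ′ ≡ size ν ℕ.+ suc n →
  ∑< (suc (suc n)) (λ i → sign i * ∑ (parts (+ (size ν ℕ.+ i))) (λ κ → ind (vert κ ν) * ind (horiz λ′ κ))) ≡ + 0
∑-vert-horiz λ′ ν n pλ pν e with alternating-Box (length λ′ ℕ.+ length ν) (get λ′) (get ν) (get-decreasing ν pν)
  (λ i p → trans (get-≥length λ′ i (ℕₚ.≤-trans (ℕₚ.m≤m+n _ _) p)) (sym (get-≥length ν i (ℕₚ.≤-trans (ℕₚ.m≤n+m _ _) p))))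
... | inj₁ eq = contradiction (trans (sym (cong size (get-injective λ′ ν pλ pν eq))) e)
  (ℕₚ.<⇒≢ (ℕₚ.≤-trans (s≤s (ℕₚ.m≤m+n (size ν) n)) (ℕₚ.≤-reflexive (sym (ℕₚ.+-suc (size ν) n)))))
... | inj₂ z = begin
  ∑< (suc (suc n)) (λ i → sign i * ∑ (parts (+ (size ν ℕ.+ i))) (λ κ → ind (vert κ ν) * ind (horiz λ′ κ)))
    ≡⟨ ∑-cong (upTo (suc (suc n))) (λ i → trans (cong (sign i *_) (count (+ (size ν ℕ.+ i))))
                                       (sym (Box-* L lo hi (sign i) (δ (+ (size ν ℕ.+ i)))))) ⟩
  ∑< (suc (suc n)) (λ i → Box L lo hi (λ s → sign i * δ (+ (size ν ℕ.+ i)) s))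
    ≡⟨ Box-∑ (upTo (suc (suc n))) L lo hi (λ i s → sign i * δ (+ (size ν ℕ.+ i)) s) ⟨
  Box L lo hi (λ s → ∑< (suc (suc n)) (λ i → sign i * δ (+ (size ν ℕ.+ i)) s))
    ≡⟨ Box-cong-range L lo hi weight ⟩
  Box L lo hi (λ s → sign (size ν) * sign s)
    ≡⟨ z (λ s → sign (size ν) * sign s) (λ s → trans (cong (sign (size ν) *_) (sign-suc s)) (sym (ℤₚ.neg-distribʳ-* (sign (size ν)) (sign s)))) ⟩
  + 0 ∎
  where
  open ≡-Reasoning
  a b lo hi : ℕ → ℕ
  a = get λ′
  b = get ν
  L = length λ′ ℕ.+ length ν
  lo i = b i ⊔ a (suc i)
  hi i = suc (b i) ⊓ a i
  a₀ : ∀ i → L ≤ i → a i ≡ 0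
  a₀ i p = get-≥length λ′ i (ℕₚ.≤-trans (ℕₚ.m≤m+n _ _) p)
  b₀ : ∀ i → L ≤ i → b i ≡ 0
  b₀ i p = get-≥length ν i (ℕₚ.≤-trans (ℕₚ.m≤n+m _ _) p)
  count : ∀ z → ∑ (parts z) (λ κ → ind (vert κ ν) * ind (horiz λ′ κ)) ≡ Box L lo hi (δ z)
  count z = ∑-parts-Box L lo hi
    (λ i p → cong₂ _⊔_ (b₀ i p) (a₀ (suc i) (ℕₚ.m≤n⇒m≤1+n p)))
    (λ i p → trans (cong (suc (b i) ⊓_) (a₀ i p)) (ℕₚ.⊓-zeroʳ (suc (b i))))
    (λ i → ℕₚ.≤-trans (ℕₚ.m⊓n≤n (suc (b (suc i))) (a (suc i))) (ℕₚ.m≤n⊔m (b i) (a (suc i))))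
    z (ind-*-Indicates (λ κ → vert κ ν) (horiz λ′) into out)
    where
    into : ∀ κ → PartitionOf z κ → vert κ ν ≡ true → horiz λ′ κ ≡ true → InBox lo hi κ
    into κ p v h i = ℕₚ.⊔-lub (proj₁ (V i)) (proj₂ (H i)) , ℕₚ.⊓-glb (proj₂ (V i)) (proj₁ (H i))
      where
      H = horiz⇒HorizontalStrip λ′ κ h
      V = vert⇒VerticalStrip κ ν v
    out : ∀ κ → PartitionOf z κ → InBox lo hi κ → vert κ ν ≡ true × horiz λ′ κ ≡ true
    out κ (p , _) B = VerticalStrip⇒vert κ ν pν (λ i → ℕₚ.m⊔n≤o⇒m≤o (b i) (a (suc i)) (proj₁ (B i))
                                                     , ℕₚ.m≤n⊓o⇒m≤n (suc (b i)) (a i) (proj₂ (B i)))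
                    , HorizontalStrip⇒horiz λ′ κ p (λ i → ℕₚ.m≤n⊓o⇒m≤o (suc (b i)) (a i) (proj₂ (B i))
                                                        , ℕₚ.m⊔n≤o⇒n≤o (b i) (a (suc i)) (proj₁ (B i)))
  -- Totals in the box lie between |ν| and |λ′| = |ν| + n + 1, so exactly one i in the range hits s,
  -- namely s - |ν|. The factor `sign (size ν)` turns its sign into a function of s alone.
  weight : ∀ s → sumTo L lo ≤ s → s ≤ sumTo L hi →
           ∑< (suc (suc n)) (λ i → sign i * δ (+ (size ν ℕ.+ i)) s) ≡ sign (size ν) * sign s
  weight s l h = begin
    ∑< (suc (suc n)) (λ i → sign i * δ (+ (size ν ℕ.+ i)) s)
      ≡⟨ cong (λ s → ∑< (suc (suc n)) (λ i → sign i * δ (+ (size ν ℕ.+ i)) s)) s≡ ⟨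
    ∑< (suc (suc n)) (λ i → sign i * δ (+ (size ν ℕ.+ i)) (size ν ℕ.+ j))
      ≡⟨ ∑<-δ (suc (suc n)) sign (size ν) j (s≤s j≤) ⟩
    sign j                                    ≡⟨ ℤₚ.*-identityˡ (sign j) ⟨
    + 1 * sign j                              ≡⟨ cong (_* sign j) (sign-*-sign (size ν)) ⟨
    sign (size ν) * sign (size ν) * sign j    ≡⟨ ℤₚ.*-assoc (sign (size ν)) (sign (size ν)) (sign j) ⟩
    sign (size ν) * (sign (size ν) * sign j)  ≡⟨ cong (sign (size ν) *_) (sign-+ (size ν) j) ⟨
    sign (size ν) * sign (size ν ℕ.+ j)       ≡⟨ cong (λ s → sign (size ν) * sign s) s≡ ⟩
    sign (size ν) * sign s                    ∎
    where
    j = s ∸ size ν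
    |ν|≤ : size ν ≤ s
    |ν|≤ = ℕₚ.≤-trans (ℕₚ.≤-reflexive (size-sumTo ν L (ℕₚ.m≤n+m _ _)))
             (ℕₚ.≤-trans (sumTo-mono L (λ i → ℕₚ.m≤m⊔n (b i) (a (suc i)))) l)
    s≡ : size ν ℕ.+ j ≡ s
    s≡ = ℕₚ.m+[n∸m]≡n |ν|≤
    s≤ : s ≤ size ν ℕ.+ suc n
    s≤ = ℕₚ.≤-trans h (ℕₚ.≤-trans (sumTo-mono L (λ i → ℕₚ.m⊓n≤n (suc (b i)) (a i)))
           (ℕₚ.≤-reflexive (trans (sym (size-sumTo λ′ L (ℕₚ.m≤m+n _ _))) e)))
    j≤ : j ≤ suc n
    j≤ = ℕₚ.+-cancelˡ-≤ (size ν) _ _ (ℕₚ.≤-trans (ℕₚ.≤-reflexive s≡) s≤)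

-- The box lo = hi = ν has the single point ν.
∑-parts-singleton : ∀ ν → IsPartition ν → ∀ g → Indicates (_≡ ν) (PartitionOf (+ size ν)) g →
                    ∑ (parts (+ size ν)) g ≡ + 1
∑-parts-singleton ν pν g I = begin
  ∑ (parts (+ size ν)) g                                 ≡⟨ ∑-parts-Box (length ν) (get ν) (get ν)
                                                             (get-≥length ν) (get-≥length ν) (get-decreasing ν pν) (+ size ν) I′ ⟩
  Box (length ν) (get ν) (get ν) (δ (+ size ν))          ≡⟨ point (length ν) (get ν) (δ (+ size ν)) ⟩
  δ (+ size ν) (sumTo (length ν) (get ν))                ≡⟨ cong (δ (+ size ν)) (size-sumTo ν (length ν) ℕₚ.≤-refl) ⟨
  δ (+ size ν) (size ν)                                  ≡⟨ δ-refl (size ν) ⟩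
  + 1                                                    ∎
  where
  open ≡-Reasoning
  point : ∀ L f w → Box L f f w ≡ w (sumTo L f)
  point zero    f w = refl
  point (suc L) f w = trans (∑[]-singleton (f 0) (λ x → Box L (f ∘ suc) (f ∘ suc) (λ s → w (x ℕ.+ s))))
                            (point L (f ∘ suc) (λ s → w (f 0 ℕ.+ s)))
  I′ : Indicates (InBox (get ν) (get ν)) (PartitionOf (+ size ν)) g
  I′ .one κ q B = one I κ q (get-injective κ ν (proj₁ q) pν (λ i → ℕₚ.≤-antisym (proj₂ (B i)) (proj₁ (B i))))
  I′ .nil κ q ¬B = nil I κ q λ { refl → ¬B (λ i → ℕₚ.≤-refl , ℕₚ.≤-refl) }

ind-horiz-≡ : ∀ ν κ → IsPartition ν → PartitionOf (+ size ν) κ → κ ≢ ν → ind (horiz κ ν) ≡ + 0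
ind-horiz-≡ ν κ pν (pκ , e) ne with horiz κ ν in h
... | false = refl
... | true  = contradiction
  (sym (≤-size-≡ ν κ pν pκ (λ i → proj₁ (horiz⇒HorizontalStrip κ ν h i)) (sym (ℤₚ.+-injective e)))) ne

ind-vert-≡ : ∀ ν κ → IsPartition ν → PartitionOf (+ size ν) κ → κ ≢ ν → ind (vert κ ν) ≡ + 0
ind-vert-≡ ν κ pν (pκ , e) ne with vert κ ν in h
... | false = refl
... | true  = contradiction
  (sym (≤-size-≡ ν κ pν pκ (λ i → proj₁ (vert⇒VerticalStrip κ ν h i)) (sym (ℤₚ.+-injective e)))) ne

horiz-refl : ∀ ν → IsPartition ν → horiz ν ν ≡ true
horiz-refl ν p = HorizontalStrip⇒horiz ν ν p (λ i → ℕₚ.≤-refl , get-decreasing ν p i)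

vert-refl : ∀ ν → IsPartition ν → vert ν ν ≡ true
vert-refl ν p = VerticalStrip⇒vert ν ν p (λ i → ℕₚ.≤-refl , ℕₚ.n≤1+n _)

-- Linear operators on symmetric functions

-- coef f μ i is the coefficient of qⁱ s_μ in f.
record F : Set where
  no-eta-equality
  field
    coef : List ℕ → ℕ → ℤ

open F

infix 4 _≋_
record _≋_ (f g : F) : Set where
  field
    at : ∀ μ → IsPartition μ → ∀ i → coef f μ i ≡ coef g μ i

open _≋_

≋-refl : ∀ {f} → f ≋ f
≋-refl .at μ p i = refl

≋-sym : ∀ {f g} → f ≋ g → g ≋ f
≋-sym e .at μ p i = sym (at e μ p i)

≋-trans : ∀ {f g h} → f ≋ g → g ≋ h → f ≋ h
≋-trans e e′ .at μ p i = trans (at e μ p i) (at e′ μ p i)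

≋-setoid : Setoid _ _
≋-setoid = record
  { Carrier       = F
  ; _≈_           = _≋_
  ; isEquivalence = record { refl = ≋-refl ; sym = ≋-sym ; trans = ≋-trans }
  }

module ≋-Reasoning where
  open import Relation.Binary.Reasoning.Setoid ≋-setoid public

infixl 6 _⊕_
infixr 7 _⊙_
infixr 8 q·_

0F : F
0F .coef μ i = + 0

_⊕_ : F → F → F
(f ⊕ g) .coef μ i = coef f μ i + coef g μ i

_⊙_ : ℤ → F → F
(c ⊙ f) .coef μ i = c * coef f μ i

q·_ : F → F
(q· f) .coef μ zero    = + 0
(q· f) .coef μ (suc i) = coef f μ i

∑F : {A : Set} → List A → (A → F) → F
∑F xs φ .coef μ i = ∑ xs (λ x → coef (φ x) μ i)

∑F< : ℕ → (ℕ → F) → F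
∑F< n = ∑F (upTo n)

⊕-cong : ∀ {f f′ g g′} → f ≋ f′ → g ≋ g′ → f ⊕ g ≋ f′ ⊕ g′
⊕-cong e e′ .at μ p i = cong₂ _+_ (at e μ p i) (at e′ μ p i)

⊙-cong : ∀ c {f g} → f ≋ g → c ⊙ f ≋ c ⊙ g
⊙-cong c e .at μ p i = cong (c *_) (at e μ p i)

q·-cong : ∀ {f g} → f ≋ g → q· f ≋ q· g
q·-cong e .at μ p zero    = refl
q·-cong e .at μ p (suc i) = at e μ p i

∑F<-cong : ∀ n {φ ψ : ℕ → F} → (∀ x → x < n → φ x ≋ ψ x) → ∑F< n φ ≋ ∑F< n ψ
∑F<-cong n e .at μ p i = ∑<-cong n (λ x x< → at (e x x<) μ p i)

record Linear (T : F → F) : Set where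
  field
    lin-cong : ∀ {f g} → f ≋ g → T f ≋ T g
    lin-⊕    : ∀ f g → T (f ⊕ g) ≋ T f ⊕ T g
    lin-⊙    : ∀ c f → T (c ⊙ f) ≋ c ⊙ T f
    lin-q    : ∀ f → T (q· f) ≋ q· T f

open Linear

lin-0 : ∀ {T} → Linear T → T 0F ≋ 0F
lin-0 {T} l .at μ p i = trans (at (lin-cong l (record { at = λ μ p i → refl })) μ p i) (at (lin-⊙ l (+ 0) 0F) μ p i)

lin-∑ : ∀ {T} {A : Set} → Linear T → (xs : List A) (φ : A → F) → T (∑F xs φ) ≋ ∑F xs (λ x → T (φ x))
lin-∑ l []       φ .at μ p i =
  trans (at (lin-cong l (record { at = λ μ p i → refl })) μ p i) (at (lin-0 l) μ p i)
lin-∑ {T} l (x ∷ xs) φ .at μ p i = begin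
  coef (T (∑F (x ∷ xs) φ)) μ i                          ≡⟨ at (lin-cong l (record { at = λ μ p i → refl })) μ p i ⟩
  coef (T (φ x ⊕ ∑F xs φ)) μ i                          ≡⟨ at (lin-⊕ l (φ x) (∑F xs φ)) μ p i ⟩
  coef (T (φ x)) μ i + coef (T (∑F xs φ)) μ i           ≡⟨ +ˡ (coef (T (φ x)) μ i) (at (lin-∑ l xs φ) μ p i) ⟩
  coef (∑F (x ∷ xs) (λ x → T (φ x))) μ i                ∎
  where open ≡-Reasoning

-- Operators with integer kernels

-- The operator with matrix k that lowers the degree by d: the coefficient at ν is fed by partitions
-- of size |ν| + d only.
op : (List ℕ → List ℕ → ℤ) → ℤ → F → F
op k d f .coef ν i = ∑ (parts (+ size ν + d)) (λ μ → k ν μ * coef f μ i)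

op-cong-at : ∀ k d {f g : F} ν i → (∀ μ → PartitionOf (+ size ν + d) μ → coef f μ i ≡ coef g μ i) →
             coef (op k d f) ν i ≡ coef (op k d g) ν i
op-cong-at k d ν i e = ∑-cong-All (All.map (λ {μ} pμ → cong (k ν μ *_) (e μ pμ)) (parts-PartitionOf (+ size ν + d)))

op-linear : ∀ k d → Linear (op k d)
op-linear k d .lin-cong {f} {g} e .at ν p i = op-cong-at k d {f} {g} ν i (λ μ pμ → at e μ (proj₁ pμ) i)
op-linear k d .lin-⊕ f g .at ν p i =
  trans (∑-cong (parts (+ size ν + d)) (λ μ → ℤₚ.*-distribˡ-+ (k ν μ) (coef f μ i) (coef g μ i))) (∑-+ (parts (+ size ν + d)) _ _)
op-linear k d .lin-⊙ c f .at ν p i =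
  trans (∑-cong (parts (+ size ν + d)) (λ μ → swap (k ν μ) c (coef f μ i))) (∑-* (parts (+ size ν + d)) c (λ μ → k ν μ * coef f μ i))
  where
  swap : ∀ x y z → x * (y * z) ≡ y * (x * z)
  swap = solve-∀
op-linear k d .lin-q f .at ν p zero    =
  trans (∑-cong (parts (+ size ν + d)) (λ μ → ℤₚ.*-zeroʳ (k ν μ))) (∑-0 (parts (+ size ν + d)))
op-linear k d .lin-q f .at ν p (suc i) = refl

op-kernel : ∀ {k k′} d → (∀ ν λ′ → IsPartition ν → PartitionOf (+ size ν + d) λ′ → k ν λ′ ≡ k′ ν λ′) →
            ∀ f → op k d f ≋ op k′ d f
op-kernel d e f .at ν p i = ∑-cong-All (All.map (λ {μ} pμ → cong (_* coef f μ i) (e ν μ p pμ)) (parts-PartitionOf (+ size ν + d)))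

op-⊕ : ∀ k k′ d f → op (λ ν λ′ → k ν λ′ + k′ ν λ′) d f ≋ op k d f ⊕ op k′ d f
op-⊕ k k′ d f .at ν p i =
  trans (∑-cong (parts (+ size ν + d)) (λ μ → ℤₚ.*-distribʳ-+ (coef f μ i) (k ν μ) (k′ ν μ))) (∑-+ (parts (+ size ν + d)) _ _)

compose : (List ℕ → List ℕ → ℤ) → ℤ → (List ℕ → List ℕ → ℤ) → List ℕ → List ℕ → ℤ
compose k d k′ ν λ′ = ∑ (parts (+ size ν + d)) (λ μ → k ν μ * k′ μ λ′)

op-∘ : ∀ k d k′ d′ {e} → d + d′ ≡ e → ∀ f → op k d (op k′ d′ f) ≋ op (compose k d k′) e f
op-∘ k d k′ d′ refl f .at ν p i = begin
  ∑ Ps (λ μ → k ν μ * ∑ (parts (+ size μ + d′)) (λ λ′ → k′ μ λ′ * coef f λ′ i))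
    ≡⟨ ∑-cong-All (All.map (λ {μ} pμ → inner μ pμ) (parts-PartitionOf (+ size ν + d))) ⟩
  ∑ Ps (λ μ → ∑ Qs (λ λ′ → k ν μ * k′ μ λ′ * coef f λ′ i))
    ≡⟨ ∑-swap Ps Qs (λ μ λ′ → k ν μ * k′ μ λ′ * coef f λ′ i) ⟩
  ∑ Qs (λ λ′ → ∑ Ps (λ μ → k ν μ * k′ μ λ′ * coef f λ′ i))
    ≡⟨ ∑-cong Qs (λ λ′ → ∑-*ʳ Ps (λ μ → k ν μ * k′ μ λ′) (coef f λ′ i)) ⟩
  ∑ Qs (λ λ′ → compose k d k′ ν λ′ * coef f λ′ i) ∎
  where
  open ≡-Reasoning
  Ps = parts (+ size ν + d)
  Qs = parts (+ size ν + (d + d′))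
  inner : ∀ μ → PartitionOf (+ size ν + d) μ →
          k ν μ * ∑ (parts (+ size μ + d′)) (λ λ′ → k′ μ λ′ * coef f λ′ i) ≡ ∑ Qs (λ λ′ → k ν μ * k′ μ λ′ * coef f λ′ i)
  inner μ (_ , e) = begin
    k ν μ * ∑ (parts (+ size μ + d′)) (λ λ′ → k′ μ λ′ * coef f λ′ i)
      ≡⟨ cong (λ z → k ν μ * ∑ (parts z) (λ λ′ → k′ μ λ′ * coef f λ′ i)) (trans (cong (_+ d′) e) (ℤₚ.+-assoc (+ size ν) d d′)) ⟩
    k ν μ * ∑ Qs (λ λ′ → k′ μ λ′ * coef f λ′ i)
      ≡⟨ ∑-* Qs (k ν μ) (λ λ′ → k′ μ λ′ * coef f λ′ i) ⟨
    ∑ Qs (λ λ′ → k ν μ * (k′ μ λ′ * coef f λ′ i))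
      ≡⟨ ∑-cong Qs (λ λ′ → ℤₚ.*-assoc (k ν μ) (k′ μ λ′) (coef f λ′ i)) ⟨
    ∑ Qs (λ λ′ → k ν μ * k′ μ λ′ * coef f λ′ i) ∎

op-identity : ∀ k → (∀ ν → IsPartition ν → Indicates (_≡ ν) (PartitionOf (+ size ν)) (k ν)) → ∀ f → op k (+ 0) f ≋ f
op-identity k I f .at ν p i = begin
  ∑ (parts (+ size ν + + 0)) (λ μ → k ν μ * coef f μ i)   ≡⟨ cong (λ z → ∑ (parts z) (λ μ → k ν μ * coef f μ i)) (ℤₚ.+-identityʳ (+ size ν)) ⟩
  ∑ (parts (+ size ν)) (λ μ → k ν μ * coef f μ i)         ≡⟨ ∑-cong-All (All.map (λ {μ} → diagonal μ) (parts-PartitionOf (+ size ν))) ⟩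
  ∑ (parts (+ size ν)) (λ μ → k ν μ * coef f ν i)         ≡⟨ ∑-*ʳ (parts (+ size ν)) (k ν) (coef f ν i) ⟩
  ∑ (parts (+ size ν)) (k ν) * coef f ν i                 ≡⟨ cong (_* coef f ν i) (∑-parts-singleton ν p (k ν) (I ν p)) ⟩
  + 1 * coef f ν i                                        ≡⟨ ℤₚ.*-identityˡ (coef f ν i) ⟩
  coef f ν i                                              ∎
  where
  open ≡-Reasoning
  diagonal : ∀ μ → PartitionOf (+ size ν) μ → k ν μ * coef f μ i ≡ k ν μ * coef f ν i
  diagonal μ pμ with Listₚ.≡-dec ℕ._≟_ μ ν
  ... | yes refl = refl
  ... | no ne = trans (cong (_* coef f μ i) (nil (I ν p) μ pμ ne)) (cong (_* coef f ν i) (sym (nil (I ν p) μ pμ ne)))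

-- H r is multiplication by h_r, P j is the adjoint of multiplication by h_j
-- and E r is (-1)ʳ times the adjoint of multiplication by e_r.
opaque
  H : ℤ → F → F
  H r = op (λ ν μ → ind (horiz ν μ)) (- r)

  P E : ℕ → F → F
  P j = op (λ ν μ → ind (horiz μ ν)) (+ j)
  E r = op (λ ν μ → sign r * ind (vert μ ν)) (+ r)

  H-linear : ∀ r → Linear (H r)
  H-linear r = op-linear (λ ν μ → ind (horiz ν μ)) (- r)

  P-linear : ∀ j → Linear (P j)
  P-linear j = op-linear (λ ν μ → ind (horiz μ ν)) (+ j)

  E-linear : ∀ r → Linear (E r)
  E-linear r = op-linear (λ ν μ → sign r * ind (vert μ ν)) (+ r)

opaque
  unfolding H P E

  H-comm : ∀ a b f → H a (H b f) ≋ H b (H a f)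
  H-comm a b f = begin
    H a (H b f)      ≈⟨ op-∘ k (- a) k (- b) refl f ⟩
    op (compose k (- a) k) (- a + - b) f ≈⟨ op-kernel (- a + - b) (λ ν λ′ pν pλ →
         between-symmetric ν λ′ pν (proj₁ pλ) (+ size ν + - a) (+ size ν + - b)
           (trans (arith (+ size ν) (- a) (- b)) (+ˡ (+ size ν) (sym (proj₂ pλ))))) f ⟩
    op (compose k (- b) k) (- a + - b) f ≈⟨ op-∘ k (- b) k (- a) (ℤₚ.+-comm (- b) (- a)) f ⟨
    H b (H a f)      ∎
    where
    open ≋-Reasoning
    k : List ℕ → List ℕ → ℤ
    k ν μ = ind (horiz ν μ)
    arith : ∀ n x y → (n + x) + (n + y) ≡ n + (n + (x + y))
    arith = solve-∀

  P-comm : ∀ a b f → P a (P b f) ≋ P b (P a f)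
  P-comm a b f = begin
    P a (P b f)      ≈⟨ op-∘ k (+ a) k (+ b) refl f ⟩
    op (compose k (+ a) k) (+ a + + b) f ≈⟨ op-kernel (+ a + + b) kernel f ⟩
    op (compose k (+ b) k) (+ a + + b) f ≈⟨ op-∘ k (+ b) k (+ a) (ℤₚ.+-comm (+ b) (+ a)) f ⟨
    P b (P a f)      ∎
    where
    open ≋-Reasoning
    k : List ℕ → List ℕ → ℤ
    k ν μ = ind (horiz μ ν)
    arith : ∀ n x y → (n + x) + (n + y) ≡ n + (x + y) + n
    arith = solve-∀
    flip : ∀ z ν λ′ → ∑ (parts z) (λ μ → ind (horiz μ ν) * ind (horiz λ′ μ)) ≡
                      ∑ (parts z) (λ μ → ind (horiz λ′ μ) * ind (horiz μ ν))
    flip z ν λ′ = ∑-cong (parts z) (λ μ → ℤₚ.*-comm (ind (horiz μ ν)) (ind (horiz λ′ μ)))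
    kernel : ∀ ν λ′ → IsPartition ν → PartitionOf (+ size ν + (+ a + + b)) λ′ →
             compose k (+ a) k ν λ′ ≡ compose k (+ b) k ν λ′
    kernel ν λ′ pν pλ = trans (flip (+ size ν + + a) ν λ′) (trans
      (between-symmetric λ′ ν (proj₁ pλ) pν (+ size ν + + a) (+ size ν + + b)
        (trans (arith (+ size ν) (+ a) (+ b)) (+ʳ {c = + size ν} (sym (proj₂ pλ)))))
      (sym (flip (+ size ν + + b) ν λ′)))

  -- One step of h_j^⊥ h_r = Σ_i h_{r-i} h_{j-i}^⊥. In this form only two neighbouring sizes of
  -- partitions above λ′ and ν are compared, as in `above-below`.
  P-H : ∀ j r f → P (suc j) (H r f) ≋ P j (H (r - + 1) f) ⊕ H r (P (suc j) f)
  P-H j r f = begin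
    P (suc j) (H r f)                                   ≈⟨ op-∘ u (+ suc j) v (- r) refl f ⟩
    op (compose u (+ suc j) v) e f                      ≈⟨ op-kernel e kernel f ⟩
    op (λ ν λ′ → compose u (+ j) v ν λ′ + compose v (- r) u ν λ′) e f ≈⟨ op-⊕ (compose u (+ j) v) (compose v (- r) u) e f ⟩
    op (compose u (+ j) v) e f ⊕ op (compose v (- r) u) e f
      ≈⟨ ⊕-cong (op-∘ u (+ j) v (- (r - + 1)) (arith (+ j) r) f) (op-∘ v (- r) u (+ suc j) (ℤₚ.+-comm (- r) (+ suc j)) f) ⟨
    P j (H (r - + 1) f) ⊕ H r (P (suc j) f)             ∎
    where
    open ≋-Reasoning
    u v : List ℕ → List ℕ → ℤ
    u ν μ = ind (horiz μ ν)
    v ν μ = ind (horiz ν μ)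
    e : ℤ
    e = + suc j + - r
    arith : ∀ x r → x + - (r - + 1) ≡ + 1 + x + - r
    arith = solve-∀
    arith′ : ∀ n r x → (n + - r) + (n + x) ≡ (n + (x + - r)) + n
    arith′ = solve-∀
    kernel : ∀ ν λ′ → IsPartition ν → PartitionOf (+ size ν + e) λ′ →
             compose u (+ suc j) v ν λ′ ≡ compose u (+ j) v ν λ′ + compose v (- r) u ν λ′
    kernel ν λ′ pν pλ = trans
      (cong (λ z → ∑ (parts z) (λ μ → u ν μ * v μ λ′)) (cong +_ (ℕₚ.+-suc (size ν) j)))
      (above-below λ′ ν (proj₁ pλ) pν (size ν ℕ.+ j) (+ size ν + - r)
        (trans (+ˡ (+ size ν + - r) (cong +_ (sym (ℕₚ.+-suc (size ν) j))))
          (trans (arith′ (+ size ν) r (+ suc j)) (+ʳ (sym (proj₂ pλ))))))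

  P-0 : ∀ f → P 0 f ≋ f
  P-0 = op-identity (λ ν μ → ind (horiz μ ν)) λ ν p → record
    { one = λ { κ _ refl → cong ind (horiz-refl ν p) } ; nil = λ κ q → ind-horiz-≡ ν κ p q }

  E-0 : ∀ f → E 0 f ≋ f
  E-0 = op-identity (λ ν μ → + 1 * ind (vert μ ν)) λ ν p → record
    { one = λ { κ _ refl → cong (λ b → + 1 * ind b) (vert-refl ν p) }
    ; nil = λ κ q ne → cong (+ 1 *_) (ind-vert-≡ ν κ p q ne) }

  -- Adjoint of the relation Σ (-1)^i e_i h_{n+1-i} = 0. It determines every E from the P, and the
  -- commutation relations of E are all deduced from it.
  ∑-E-P : ∀ n f → ∑F< (suc (suc n)) (λ i → E i (P (suc n ∸ i) f)) ≋ 0F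
  ∑-E-P n f .at ν p i = begin
    ∑< N (λ r → coef (E r (P (suc n ∸ r) f)) ν i)
      ≡⟨ ∑<-cong N (λ r r< → at (op-∘ (e r) (+ r) u (+ (suc n ∸ r)) (cong +_ (ℕₚ.m+[n∸m]≡n (ℕₚ.≤-pred r<))) f) ν p i) ⟩
    ∑< N (λ r → ∑ Ps (λ λ′ → compose (e r) (+ r) u ν λ′ * coef f λ′ i))
      ≡⟨ ∑-swap (upTo N) Ps (λ r λ′ → compose (e r) (+ r) u ν λ′ * coef f λ′ i) ⟩
    ∑ Ps (λ λ′ → ∑< N (λ r → compose (e r) (+ r) u ν λ′ * coef f λ′ i))
      ≡⟨ ∑-zero (All.map (λ {λ′} pλ → vanish λ′ pλ) (parts-PartitionOf (+ size ν + + suc n))) ⟩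
    + 0 ∎
    where
    open ≡-Reasoning
    N : ℕ
    N = suc (suc n)
    Ps : List (List ℕ)
    Ps = parts (+ size ν + + suc n)
    e : ℕ → List ℕ → List ℕ → ℤ
    e r ν μ = sign r * ind (vert μ ν)
    u : List ℕ → List ℕ → ℤ
    u ν μ = ind (horiz μ ν)
    vanish : ∀ λ′ → PartitionOf (+ size ν + + suc n) λ′ → ∑< N (λ r → compose (e r) (+ r) u ν λ′ * coef f λ′ i) ≡ + 0
    vanish λ′ (pλ , s) = begin
      ∑< N (λ r → compose (e r) (+ r) u ν λ′ * coef f λ′ i)
        ≡⟨ ∑-*ʳ (upTo N) (λ r → compose (e r) (+ r) u ν λ′) (coef f λ′ i) ⟩
      ∑< N (λ r → compose (e r) (+ r) u ν λ′) * coef f λ′ i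
        ≡⟨ cong (_* coef f λ′ i) (∑-cong (upTo N) (λ r → trans
             (∑-cong (parts (+ (size ν ℕ.+ r))) (λ μ → ℤₚ.*-assoc (sign r) (ind (vert μ ν)) (ind (horiz λ′ μ))))
             (∑-* (parts (+ (size ν ℕ.+ r))) (sign r) (λ μ → ind (vert μ ν) * ind (horiz λ′ μ))))) ⟩
      ∑< N (λ r → sign r * ∑ (parts (+ (size ν ℕ.+ r))) (λ μ → ind (vert μ ν) * ind (horiz λ′ μ))) * coef f λ′ i
        ≡⟨ cong (_* coef f λ′ i) (∑-vert-horiz λ′ ν n pλ p (ℤₚ.+-injective s)) ⟩
      + 0 * coef f λ′ i ≡⟨ ℤₚ.*-zeroˡ (coef f λ′ i) ⟩
      + 0 ∎

-- Commutation of the Pieri operators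

E-recurrence : ∀ n f → ∑F< (suc n) (λ i → E i (P (suc n ∸ i) f)) ⊕ E (suc n) f ≋ 0F
E-recurrence n f .at ν p k = begin
  ∑< (suc n) t + coef (E (suc n) f) ν k    ≡⟨ +ˡ (∑< (suc n) t) last ⟨
  ∑< (suc n) t + t (suc n)                 ≡⟨ ∑<-last (suc n) t ⟨
  ∑< (suc (suc n)) t                       ≡⟨ at (∑-E-P n f) ν p k ⟩
  + 0                                      ∎
  where
  open ≡-Reasoning
  t : ℕ → ℤ
  t i = coef (E i (P (suc n ∸ i) f)) ν k
  last : t (suc n) ≡ coef (E (suc n) f) ν k
  last = trans (cong (λ m → coef (E (suc n) (P m f)) ν k) (ℕₚ.n∸n≡0 n))
               (at (lin-cong (E-linear (suc n)) (P-0 f)) ν p k)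

-- By `E-recurrence`, E (n+1) is minus a sum of products of a P and an E of smaller index. Strong
-- induction moves T through each of these products.
commutes-with-E : ∀ {T} → Linear T → (∀ j f → T (P j f) ≋ P j (T f)) → ∀ n f → T (E n f) ≋ E n (T f)
commutes-with-E {T} l c = <-rec _ step
  where
  open ≡-Reasoning
  step : ∀ n → (∀ {m} → m < n → ∀ f → T (E m f) ≋ E m (T f)) → ∀ f → T (E n f) ≋ E n (T f)
  step zero    rec f = ≋-trans (lin-cong l (E-0 f)) (≋-sym (E-0 (T f)))
  step (suc n) rec f .at ν p k = ℤG.∙-cancelˡ (∑< (suc n) t′) _ _ (begin
    ∑< (suc n) t′ + coef (T (E (suc n) f)) ν k        ≡⟨ +ʳ (∑<-cong (suc n) term) ⟨
    ∑< (suc n) t + coef (T (E (suc n) f)) ν k         ≡⟨ +ʳ (at (lin-∑ l (upTo (suc n)) (λ i → E i (P (suc n ∸ i) f))) ν p k) ⟨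
    coef (T Σ₀) ν k + coef (T (E (suc n) f)) ν k      ≡⟨ at (lin-⊕ l Σ₀ (E (suc n) f)) ν p k ⟨
    coef (T (Σ₀ ⊕ E (suc n) f)) ν k                   ≡⟨ at (lin-cong l (E-recurrence n f)) ν p k ⟩
    coef (T 0F) ν k                                   ≡⟨ at (lin-0 l) ν p k ⟩
    + 0                                               ≡⟨ at (E-recurrence n (T f)) ν p k ⟨
    ∑< (suc n) t′ + coef (E (suc n) (T f)) ν k        ∎)
    where
    Σ₀ = ∑F< (suc n) (λ i → E i (P (suc n ∸ i) f))
    t t′ : ℕ → ℤ
    t  i = coef (T (E i (P (suc n ∸ i) f))) ν k
    t′ i = coef (E i (P (suc n ∸ i) (T f))) ν k
    term : ∀ i → i < suc n → t i ≡ t′ i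
    term i i< = at (≋-trans (rec i< (P (suc n ∸ i) f)) (lin-cong (E-linear i) (c (suc n ∸ i) f))) ν p k

P-E-comm : ∀ j n f → P j (E n f) ≋ E n (P j f)
P-E-comm j = commutes-with-E (P-linear j) (P-comm j)

E-comm : ∀ m n f → E m (E n f) ≋ E n (E m f)
E-comm m = commutes-with-E (E-linear m) (λ j f → ≋-sym (P-E-comm j m f))

-- Signed form of e_{n+1}^⊥ h_s = h_s e_{n+1}^⊥ + h_{s-1} e_n^⊥. Applying the recurrence to H s f
-- and moving H s past every P with `P-H` leaves terms with E of smaller index, to which the
-- induction hypothesis applies.
E-H : ∀ n s f → E (suc n) (H s f) ⊕ H (s - + 1) (E n f) ≋ H s (E (suc n) f)
E-H = <-rec _ step
  where
  open ≡-Reasoning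
  -- The complete sum Σ E_i P_{n-i} is the identity for n = 0 and zero otherwise, so it commutes
  -- with H s in either case.
  ∑EP-H : ∀ n s f → ∑F< (suc n) (λ i → E i (P (n ∸ i) (H s f))) ≋ H s (∑F< (suc n) (λ i → E i (P (n ∸ i) f)))
  ∑EP-H zero    s f = ≋-trans (single (H s f)) (≋-sym (lin-cong (H-linear s) (single f)))
    where
    single : ∀ f → ∑F< 1 (λ i → E i (P (0 ∸ i) f)) ≋ f
    single f .at ν p k = trans (ℤₚ.+-identityʳ _) (trans (at (E-0 (P 0 f)) ν p k) (at (P-0 f) ν p k))
  ∑EP-H (suc n) s f = ≋-trans (∑-E-P n (H s f)) (≋-sym (≋-trans (lin-cong (H-linear s) (∑-E-P n f)) (lin-0 (H-linear s))))

  solve₃ : ∀ {A B Q R X Y} → (A + B) + Q + X ≡ + 0 → Q + A ≡ R → R + Y ≡ + 0 → X + B ≡ Y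
  solve₃ {A} {B} {Q} {R} {X} {Y} e₁ refl e₃ = ℤG.∙-cancelˡ (Q + A) _ _ (trans (shuffle A B Q X) (trans e₁ (sym e₃)))
    where
    shuffle : ∀ A B Q X → (Q + A) + (X + B) ≡ (A + B) + Q + X
    shuffle = solve-∀

  step : ∀ n → (∀ {m} → m < n → ∀ s f → E (suc m) (H s f) ⊕ H (s - + 1) (E m f) ≋ H s (E (suc m) f)) →
         ∀ s f → E (suc n) (H s f) ⊕ H (s - + 1) (E n f) ≋ H s (E (suc n) f)
  step n rec s f .at ν p k = trans (+ˡ (coef (E (suc n) (H s f)) ν k) (sym a-n)) (solve₃ {∑< n a} {a n} {∑< (suc n) c} {∑< (suc n) d} eq₁ eq₂ eq₃)
    where
    a b c d : ℕ → ℤ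
    a i = coef (H (s - + 1) (E i (P (n ∸ i) f))) ν k
    b i = coef (E i (P (n ∸ i) (H (s - + 1) f))) ν k
    c i = coef (E i (H s (P (suc n ∸ i) f))) ν k
    d i = coef (H s (E i (P (suc n ∸ i) f))) ν k
    a-n : a n ≡ coef (H (s - + 1) (E n f)) ν k
    a-n = trans (cong (λ m → coef (H (s - + 1) (E n (P m f))) ν k) (ℕₚ.n∸n≡0 n))
                (at (lin-cong (H-linear (s - + 1)) (lin-cong (E-linear n) (P-0 f))) ν p k)
    split : ∀ i → i < suc n → coef (E i (P (suc n ∸ i) (H s f))) ν k ≡ b i + c i
    split i i< rewrite ℕₚ.+-∸-assoc 1 (ℕₚ.≤-pred i<) =
      trans (at (lin-cong (E-linear i) (P-H (n ∸ i) s f)) ν p k) (at (lin-⊕ (E-linear i) _ _) ν p k)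
    ∑b : ∑< (suc n) b ≡ ∑< n a + a n
    ∑b = begin
      ∑< (suc n) b    ≡⟨ at (∑EP-H n (s - + 1) f) ν p k ⟩
      coef (H (s - + 1) (∑F< (suc n) (λ i → E i (P (n ∸ i) f)))) ν k
                      ≡⟨ at (lin-∑ (H-linear (s - + 1)) (upTo (suc n)) (λ i → E i (P (n ∸ i) f))) ν p k ⟩
      ∑< (suc n) a    ≡⟨ ∑<-last n a ⟩
      ∑< n a + a n    ∎
    eq₁ : (∑< n a + a n) + ∑< (suc n) c + coef (E (suc n) (H s f)) ν k ≡ + 0
    eq₁ = begin
      (∑< n a + a n) + ∑< (suc n) c + coef (E (suc n) (H s f)) ν k      ≡⟨ +ʳ (+ʳ ∑b) ⟨
      ∑< (suc n) b + ∑< (suc n) c + coef (E (suc n) (H s f)) ν k        ≡⟨ +ʳ (∑-+ (upTo (suc n)) b c) ⟨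
      ∑< (suc n) (λ i → b i + c i) + coef (E (suc n) (H s f)) ν k       ≡⟨ +ʳ (∑<-cong (suc n) split) ⟨
      ∑< (suc n) (λ i → coef (E i (P (suc n ∸ i) (H s f))) ν k) + coef (E (suc n) (H s f)) ν k
                                                                        ≡⟨ at (E-recurrence n (H s f)) ν p k ⟩
      + 0                                                               ∎
    c-0 : c 0 ≡ d 0
    c-0 = at (≋-trans (E-0 _) (≋-sym (lin-cong (H-linear s) (E-0 _)))) ν p k
    -- The induction hypothesis at i merges `c (suc i)` and `a i` into `d (suc i)`. Only `a n` finds
    -- no partner, and it is the correction term of the claim.
    eq₂ : ∑< (suc n) c + ∑< n a ≡ ∑< (suc n) d
    eq₂ = begin
      ∑< (suc n) c + ∑< n a                        ≡⟨ +ʳ (∑<-suc n c) ⟩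
      c 0 + ∑< n (c ∘ suc) + ∑< n a                ≡⟨ ℤₚ.+-assoc (c 0) (∑< n (c ∘ suc)) (∑< n a) ⟩
      c 0 + (∑< n (c ∘ suc) + ∑< n a)              ≡⟨ cong₂ _+_ c-0 (sym (∑-+ (upTo n) (c ∘ suc) a)) ⟩
      d 0 + ∑< n (λ i → c (suc i) + a i)           ≡⟨ +ˡ (d 0) (∑<-cong n (λ i i< → at (rec i< s (P (n ∸ i) f)) ν p k)) ⟩
      d 0 + ∑< n (d ∘ suc)                         ≡⟨ ∑<-suc n d ⟨
      ∑< (suc n) d                                 ∎
    eq₃ : ∑< (suc n) d + coef (H s (E (suc n) f)) ν k ≡ + 0
    eq₃ = begin
      ∑< (suc n) d + coef (H s (E (suc n) f)) ν k    ≡⟨ +ʳ (at (lin-∑ (H-linear s) (upTo (suc n)) (λ i → E i (P (suc n ∸ i) f))) ν p k) ⟨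
      coef (H s Σ₀) ν k + coef (H s (E (suc n) f)) ν k ≡⟨ at (lin-⊕ (H-linear s) Σ₀ (E (suc n) f)) ν p k ⟨
      coef (H s (Σ₀ ⊕ E (suc n) f)) ν k              ≡⟨ at (lin-cong (H-linear s) (E-recurrence n f)) ν p k ⟩
      coef (H s 0F) ν k                              ≡⟨ at (lin-0 (H-linear s)) ν p k ⟩
      + 0                                            ∎
      where
      Σ₀ = ∑F< (suc n) (λ i → E i (P (suc n ∸ i) f))

-- 𝕊 and 𝔹 as locally finite sums

∘-linear : ∀ {T U} → Linear T → Linear U → Linear (T ∘ U)
∘-linear {T} {U} l m .lin-cong e = lin-cong l (lin-cong m e)
∘-linear {T} {U} l m .lin-⊕ f g = ≋-trans (lin-cong l (lin-⊕ m f g)) (lin-⊕ l (U f) (U g))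
∘-linear {T} {U} l m .lin-⊙ c f = ≋-trans (lin-cong l (lin-⊙ m c f)) (lin-⊙ l c (U f))
∘-linear {T} {U} l m .lin-q f = ≋-trans (lin-cong l (lin-q m f)) (lin-q l (U f))

q·-linear : Linear q·_
q·-linear .lin-cong e = q·-cong e
q·-linear .lin-⊕ f g .at ν p zero    = refl
q·-linear .lin-⊕ f g .at ν p (suc i) = refl
q·-linear .lin-⊙ c f .at ν p zero    = sym (ℤₚ.*-zeroʳ c)
q·-linear .lin-⊙ c f .at ν p (suc i) = refl
q·-linear .lin-q f = ≋-refl

q^ : ℕ → F → F
q^ zero    f = f
q^ (suc j) f = q· q^ j f

q^-linear : ∀ j → Linear (q^ j)
q^-linear zero    = record { lin-cong = id ; lin-⊕ = λ f g → ≋-refl ; lin-⊙ = λ c f → ≋-refl ; lin-q = λ f → ≋-refl }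
q^-linear (suc j) = ∘-linear q·-linear (q^-linear j)

lin-q^ : ∀ {T} → Linear T → ∀ j f → T (q^ j f) ≋ q^ j (T f)
lin-q^ l zero    f = ≋-refl
lin-q^ l (suc j) f = ≋-trans (lin-q l (q^ j f)) (q·-cong (lin-q^ l j f))

q^-vanish : ∀ j f ν → (∀ i → coef f ν i ≡ + 0) → ∀ i → coef (q^ j f) ν i ≡ + 0
q^-vanish zero    f ν z i       = z i
q^-vanish (suc j) f ν z zero    = refl
q^-vanish (suc j) f ν z (suc i) = q^-vanish j f ν z i

-- The cut-off N depends on the coefficient ν, as it does in `S` and `B`.
∑Op : (List ℕ → ℕ) → (ℕ → F → F) → F → F
∑Op N T f .coef ν i = ∑< (N ν) (λ r → coef (T r f) ν i)

∑Op-linear : ∀ N {T} → (∀ r → Linear (T r)) → Linear (∑Op N T)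
∑Op-linear N l .lin-cong e .at ν p i = ∑<-cong (N ν) (λ r _ → at (lin-cong (l r) e) ν p i)
∑Op-linear N {T} l .lin-⊕ f g .at ν p i =
  trans (∑<-cong (N ν) (λ r _ → at (lin-⊕ (l r) f g) ν p i))
        (∑-+ (upTo (N ν)) (λ r → coef (T r f) ν i) (λ r → coef (T r g) ν i))
∑Op-linear N {T} l .lin-⊙ c f .at ν p i =
  trans (∑<-cong (N ν) (λ r _ → at (lin-⊙ (l r) c f) ν p i)) (∑-* (upTo (N ν)) c (λ r → coef (T r f) ν i))
∑Op-linear N {T} l .lin-q f .at ν p zero    = ∑<-zero (N ν) (λ r _ → at (lin-q (l r) f) ν p zero)
∑Op-linear N {T} l .lin-q f .at ν p (suc i) = ∑<-cong (N ν) (λ r _ → at (lin-q (l r) f) ν p (suc i))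

-- Terms beyond `N ν` miss the coefficient at ν, terms beyond R vanish altogether; so the two
-- cut-offs agree. With a uniform R a linear operator can be moved inside the sum.
∑Op-finite : ∀ N T f R → (∀ ν → IsPartition ν → ∀ i r → N ν ≤ r → coef (T r f) ν i ≡ + 0) →
             (∀ r → R ≤ r → T r f ≋ 0F) → ∑Op N T f ≋ ∑F< R (λ r → T r f)
∑Op-finite N T f R z z′ .at ν p i =
  ∑<-extend₂ (N ν) R (λ r → coef (T r f) ν i) (z ν p i) (λ r le → at (z′ r le) ν p i)

-- Degree at most z. The bound is an integer so that it can fall below 0 under the adjoints, which
-- forces the function to vanish.
record Bd (z : ℤ) (f : F) : Set where
  field
    above : ∀ ν → IsPartition ν → z ℤ.< + size ν → ∀ i → coef f ν i ≡ + 0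

open Bd

Bd-⊕ : ∀ {z f g} → Bd z f → Bd z g → Bd z (f ⊕ g)
Bd-⊕ b c .above ν p lt i = cong₂ _+_ (above b ν p lt i) (above c ν p lt i)

Bd-⊙ : ∀ {z f} c → Bd z f → Bd z (c ⊙ f)
Bd-⊙ c b .above ν p lt i = trans (cong (c *_) (above b ν p lt i)) (ℤₚ.*-zeroʳ c)

Bd-q· : ∀ {z f} → Bd z f → Bd z (q· f)
Bd-q· b .above ν p lt zero    = refl
Bd-q· b .above ν p lt (suc i) = above b ν p lt i

Bd-q^ : ∀ {z f} j → Bd z f → Bd z (q^ j f)
Bd-q^ zero    b = b
Bd-q^ (suc j) b = Bd-q· (Bd-q^ j b)

Bd-∑Op : ∀ {z f} N {T} → (∀ r → Bd z (T r f)) → Bd z (∑Op N T f)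
Bd-∑Op N b .above ν p lt i = ∑<-zero (N ν) (λ r _ → above (b r) ν p lt i)

Bd-mono : ∀ {z z′ f} → z ℤ.≤ z′ → Bd z f → Bd z′ f
Bd-mono le b .above ν p lt i = above b ν p (ℤₚ.≤-<-trans le lt) i

Bd-op : ∀ {z f} k d → Bd z f → Bd (z - d) (op k d f)
Bd-op {z} {f} k d b .above ν p lt i =
  ∑-zero (All.map (λ {μ} pμ → trans (cong (k ν μ *_) (above b μ (proj₁ pμ) (larger μ (proj₂ pμ)) i)) (ℤₚ.*-zeroʳ (k ν μ)))
                  (parts-PartitionOf (+ size ν + d)))
  where
  cancel : ∀ z d → z - d + d ≡ z
  cancel = solve-∀
  larger : ∀ μ → + size μ ≡ + size ν + d → z ℤ.< + size μ
  larger μ e = subst₂ ℤ._<_ (cancel z d) (sym e) (ℤₚ.+-monoˡ-< d lt)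

Bd-vanish : ∀ {z f} → z ℤ.< + 0 → Bd z f → f ≋ 0F
Bd-vanish lt b .at ν p i = above b ν p (ℤₚ.<-≤-trans lt (ℤ.+≤+ z≤n)) i

parts-negative : ∀ {z} → z ℤ.< + 0 → parts z ≡ []
parts-negative {+ n}      (ℤ.+<+ ())
parts-negative { -[1+ n ]} lt = refl

z<n⇒z-n<0 : ∀ {z n} → z ℤ.< n → z - n ℤ.< + 0
z<n⇒z-n<0 {z} {n} lt = subst (z - n ℤ.<_) (ℤₚ.+-inverseʳ n) (ℤₚ.+-monoˡ-< (- n) lt)

opaque
  unfolding H P E

  Bd-H : ∀ {z f} a → Bd z f → Bd (z + a) (H a f)
  Bd-H {z} {f} a b = subst (λ x → Bd (z + x) (H a f)) (ℤₚ.neg-involutive a) (Bd-op (λ ν μ → ind (horiz ν μ)) (- a) b)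

  Bd-P : ∀ {z f} j → Bd z f → Bd (z - + j) (P j f)
  Bd-P j b = Bd-op (λ ν μ → ind (horiz μ ν)) (+ j) b

  Bd-E : ∀ {z f} r → Bd z f → Bd (z - + r) (E r f)
  Bd-E r b = Bd-op (λ ν μ → sign r * ind (vert μ ν)) (+ r) b

  H-large : ∀ b f ν i → + size ν ℤ.< b → coef (H b f) ν i ≡ + 0
  H-large b f ν i lt = cong (λ ps → ∑ ps (λ μ → ind (horiz ν μ) * coef f μ i)) (parts-negative (z<n⇒z-n<0 lt))

  -- At a negative index the sum runs over partitions larger than ν, and none of them can be
  -- contained in ν as a horizontal strip requires.
  H-negative : ∀ r f → H -[1+ r ] f ≋ 0F
  H-negative r f .at ν p i = ∑-zero (All.map (λ {μ} → outside μ) (parts-PartitionOf (+ size ν + + suc r)))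
    where
    outside : ∀ μ → PartitionOf (+ size ν + + suc r) μ → ind (horiz ν μ) * coef f μ i ≡ + 0
    outside μ (pμ , e) with horiz ν μ in h
    ... | false = ℤₚ.*-zeroˡ (coef f μ i)
    ... | true  = contradiction (ℤₚ.+-injective e) (ℕₚ.<⇒≢ (ℕₚ.≤-<-trans smaller (ℕₚ.≤-trans (s≤s (ℕₚ.m≤m+n (size ν) r)) (ℕₚ.≤-reflexive (sym (ℕₚ.+-suc (size ν) r))))))
      where
      smaller : size μ ≤ size ν
      smaller = subst₂ _≤_ (sym (size-sumTo μ (length μ ℕ.+ length ν) (ℕₚ.m≤m+n _ _)))
                  (sym (size-sumTo ν (length μ ℕ.+ length ν) (ℕₚ.m≤n+m _ _)))
                  (sumTo-mono (length μ ℕ.+ length ν) (λ i → proj₁ (horiz⇒HorizontalStrip ν μ h i)))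

P-vanish : ∀ {z f} j → z ℤ.< + j → Bd z f → P j f ≋ 0F
P-vanish j lt b = Bd-vanish (z<n⇒z-n<0 lt) (Bd-P j b)

E-vanish : ∀ {z f} r → z ℤ.< + r → Bd z f → E r f ≋ 0F
E-vanish r lt b = Bd-vanish (z<n⇒z-n<0 lt) (Bd-E r b)

bound : ℤ → List ℕ → ℕ
bound a ν = suc (size ν ℕ.+ ℤ.∣ a ∣)

-- The truncation at |ν| + |a| loses nothing: past it the index a + r exceeds |ν|, and
-- multiplication by h_{a+r} cannot reach ν.
beyond-bound : ∀ a ν r → bound a ν ≤ r → + size ν ℤ.< a + + r
beyond-bound (+ m)    ν r le = ℤ.+<+ (ℕₚ.≤-trans (s≤s (ℕₚ.m≤m+n (size ν) m)) (ℕₚ.≤-trans le (ℕₚ.m≤n+m r m)))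
beyond-bound -[1+ m ] ν r le = subst (+ size ν ℤ.<_) (sym (ℤₚ.⊖-≥ (ℕₚ.≤-trans (ℕₚ.m≤n+m (suc m) (size ν)) (ℕₚ.<⇒≤ le))))
  (ℤ.+<+ (subst (_≤ r ∸ suc m) (ℕₚ.m+n∸n≡m (suc (size ν)) (suc m)) (ℕₚ.∸-monoˡ-≤ (suc m) le)))

S′ : ℤ → F → F
S′ a = ∑Op (bound a) (λ r f → H (a + + r) (E r f))

S′-linear : ∀ a → Linear (S′ a)
S′-linear a = ∑Op-linear (bound a) (λ r → ∘-linear (H-linear (a + + r)) (E-linear r))

S′-finite : ∀ {z f} a R → z ℤ.< + R → Bd z f → S′ a f ≋ ∑F< R (λ r → H (a + + r) (E r f))
S′-finite {z} {f} a R lt b = ∑Op-finite (bound a) (λ r f → H (a + + r) (E r f)) f R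
  (λ ν p i r le → H-large (a + + r) (E r f) ν i (beyond-bound a ν r le))
  (λ r le → ≋-trans (lin-cong (H-linear (a + + r)) (E-vanish r (ℤₚ.<-≤-trans lt (ℤ.+≤+ le)) b)) (lin-0 (H-linear (a + + r))))

Bd-S′ : ∀ {z f} a → Bd z f → Bd (z + a) (S′ a f)
Bd-S′ {z} {f} a b = Bd-∑Op (bound a) λ r → subst (λ x → Bd x (H (a + + r) (E r f))) (degree z a (+ r)) (Bd-H (a + + r) (Bd-E r b))
  where
  degree : ∀ z a r → z - r + (a + r) ≡ z + a
  degree = solve-∀

S′-large : ∀ a f ν → + size ν ℤ.< a → ∀ i → coef (S′ a f) ν i ≡ + 0
S′-large a f ν lt i = ∑<-zero (bound a ν) λ r _ →
  H-large (a + + r) (E r f) ν i (ℤₚ.<-≤-trans lt (ℤₚ.i≤i+j a (+ r)))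

B′ : ℤ → F → F
B′ a = ∑Op (bound a) (λ j f → q^ j (S′ (a + + j) (P j f)))

B′-linear : ∀ a → Linear (B′ a)
B′-linear a = ∑Op-linear (bound a) (λ j → ∘-linear (q^-linear j) (∘-linear (S′-linear (a + + j)) (P-linear j)))

B′-finite : ∀ {z f} a R → z ℤ.< + R → Bd z f → B′ a f ≋ ∑F< R (λ j → q^ j (S′ (a + + j) (P j f)))
B′-finite {z} {f} a R lt b = ∑Op-finite (bound a) (λ j f → q^ j (S′ (a + + j) (P j f))) f R
  (λ ν p i j le → q^-vanish j (S′ (a + + j) (P j f)) ν (S′-large (a + + j) (P j f) ν (beyond-bound a ν j le)) i)
  (λ j le → ≋-trans (lin-cong (l j) (P-vanish j (ℤₚ.<-≤-trans lt (ℤ.+≤+ le)) b)) (lin-0 (l j)))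
  where
  l : ∀ j → Linear (q^ j ∘ S′ (a + + j))
  l j = ∘-linear (q^-linear j) (S′-linear (a + + j))

Bd-B′ : ∀ {z f} a → Bd z f → Bd (z + a) (B′ a f)
Bd-B′ {z} {f} a b = Bd-∑Op (bound a) λ j → Bd-q^ j
  (subst (λ x → Bd x (S′ (a + + j) (P j f))) (degree z a (+ j)) (Bd-S′ (a + + j) (Bd-P j b)))
  where
  degree : ∀ z a r → z - r + (a + r) ≡ z + a
  degree = solve-∀

-- Exchange relations for 𝕊 and 𝔹

z<suc∣z∣+ : ∀ z n → z ℤ.< + suc (ℤ.∣ z ∣ ℕ.+ n)
z<suc∣z∣+ (+ m)    n = ℤ.+<+ (s≤s (ℕₚ.m≤m+n m n))
z<suc∣z∣+ -[1+ m ] n = ℤ.-<+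

Bd-minus : ∀ {z f} r → Bd (z - + r) f → Bd z f
Bd-minus {z} r = Bd-mono (ℤₚ.i-j≤i z (+ r))

-- The product of 𝕊_a and 𝕊_b with all multiplications moved to the left of all adjoints.
-- Multiplications commute among themselves and so do adjoints, which makes it symmetric in a and b.
normalOrderedS : ℕ → ℤ → ℤ → F → F
normalOrderedS R a b f = ∑F< R (λ r → ∑F< R (λ s → H (a + + r) (H (b + + s) (E r (E s f)))))

normalOrderedS-symmetric : ∀ R a b f → normalOrderedS R a b f ≋ normalOrderedS R b a f
normalOrderedS-symmetric R a b f .at ν p i = trans
  (∑-swap (upTo R) (upTo R) (λ r s → coef (H (a + + r) (H (b + + s) (E r (E s f)))) ν i))
  (∑<-cong R λ s _ → ∑<-cong R λ r _ → at (≋-trans (H-comm (a + + r) (b + + s) (E r (E s f)))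
    (lin-cong (H-linear (b + + s)) (lin-cong (H-linear (a + + r)) (E-comm r s f)))) ν p i)

S′-S′-finite : ∀ {z f} a b R → z ℤ.< + R → z + b ℤ.< + R → Bd z f →
  S′ a (S′ b f) ≋ ∑F< R (λ r → ∑F< R (λ s → H (a + + r) (E r (H (b + + s) (E s f)))))
S′-S′-finite {z} {f} a b R lt lt′ bd = ≋-trans (S′-finite a R lt′ (Bd-S′ b bd)) (∑F<-cong R λ r _ →
  ≋-trans (lin-cong (l r) (S′-finite b R lt bd)) (lin-∑ (l r) (upTo R) (λ s → H (b + + s) (E s f))))
  where
  l : ∀ r → Linear (H (a + + r) ∘ E r)
  l r = ∘-linear (H-linear (a + + r)) (E-linear r)

-- Moving E (r+1) past H (b+s) by `E-H` costs a term H (b+s-1) E r. Since a + (r+1) = (a+1) + r,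
-- these corrections sum to the normally ordered product at (a+1, b-1).
S′-S′ : ∀ {z f} a b R → z ℤ.< + R → z + b ℤ.< + suc R → Bd z f →
        S′ a (S′ b f) ⊕ normalOrderedS (suc R) (a + + 1) (b - + 1) f ≋ normalOrderedS (suc R) a b f
S′-S′ {z} {f} a b R lt lt′ bd .at ν p i = begin
  coef (S′ a (S′ b f)) ν i + ∑< (suc R) (λ r → ∑< (suc R) (v r))
    ≡⟨ cong₂ _+_ (at (S′-S′-finite a b (suc R) (ℤₚ.<-trans lt (ℤ.+<+ ℕₚ.≤-refl)) lt′ bd) ν p i) drop-last ⟩
  ∑< (suc R) (λ r → ∑< (suc R) (t r)) + ∑< R (λ r → ∑< (suc R) (v r))
    ≡⟨ +ʳ (∑<-suc R (λ r → ∑< (suc R) (t r))) ⟩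
  ∑< (suc R) (t 0) + ∑< R (λ r → ∑< (suc R) (t (suc r))) + ∑< R (λ r → ∑< (suc R) (v r))
    ≡⟨ ℤₚ.+-assoc (∑< (suc R) (t 0)) _ _ ⟩
  ∑< (suc R) (t 0) + (∑< R (λ r → ∑< (suc R) (t (suc r))) + ∑< R (λ r → ∑< (suc R) (v r)))
    ≡⟨ cong₂ _+_ (∑<-cong (suc R) (λ s _ → t-0 s)) (sym (∑-+ (upTo R) (λ r → ∑< (suc R) (t (suc r))) (λ r → ∑< (suc R) (v r)))) ⟩
  ∑< (suc R) (u 0) + ∑< R (λ r → ∑< (suc R) (t (suc r)) + ∑< (suc R) (v r))
    ≡⟨ +ˡ (∑< (suc R) (u 0)) (∑<-cong R (λ r _ → trans (sym (∑-+ (upTo (suc R)) (t (suc r)) (v r))) (∑<-cong (suc R) (λ s _ → t-suc r s)))) ⟩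
  ∑< (suc R) (u 0) + ∑< R (λ r → ∑< (suc R) (u (suc r)))
    ≡⟨ ∑<-suc R (λ r → ∑< (suc R) (u r)) ⟨
  ∑< (suc R) (λ r → ∑< (suc R) (u r)) ∎
  where
  open ≡-Reasoning
  t u v : ℕ → ℕ → ℤ
  t r s = coef (H (a + + r) (E r (H (b + + s) (E s f)))) ν i
  u r s = coef (H (a + + r) (H (b + + s) (E r (E s f)))) ν i
  v r s = coef (H (a + + 1 + + r) (H (b - + 1 + + s) (E r (E s f)))) ν i
  -- The index shift leaves the row r = R of the second product unmatched; it vanishes because R
  -- exceeds the degree bound z.
  drop-last : ∑< (suc R) (λ r → ∑< (suc R) (v r)) ≡ ∑< R (λ r → ∑< (suc R) (v r))
  drop-last = begin
    ∑< (suc R) (λ r → ∑< (suc R) (v r))         ≡⟨ ∑<-last R (λ r → ∑< (suc R) (v r)) ⟩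
    ∑< R (λ r → ∑< (suc R) (v r)) + ∑< (suc R) (v R)
      ≡⟨ +ˡ (∑< R (λ r → ∑< (suc R) (v r))) (∑<-zero (suc R) (λ s _ → at (last s) ν p i)) ⟩
    ∑< R (λ r → ∑< (suc R) (v r)) + + 0         ≡⟨ ℤₚ.+-identityʳ _ ⟩
    ∑< R (λ r → ∑< (suc R) (v r))               ∎
    where
    last : ∀ s → H (a + + 1 + + R) (H (b - + 1 + + s) (E R (E s f))) ≋ 0F
    last s = ≋-trans (lin-cong l (E-vanish R lt (Bd-minus s (Bd-E s bd)))) (lin-0 l)
      where l = ∘-linear (H-linear (a + + 1 + + R)) (H-linear (b - + 1 + + s))
  t-0 : ∀ s → t 0 s ≡ u 0 s
  t-0 s = at (lin-cong (H-linear (a + + 0)) (≋-trans (E-0 (H (b + + s) (E s f)))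
            (≋-sym (lin-cong (H-linear (b + + s)) (E-0 (E s f)))))) ν p i
  t-suc : ∀ r s → t (suc r) s + v r s ≡ u (suc r) s
  t-suc r s = begin
    t (suc r) s + v r s
      ≡⟨ +ˡ (t (suc r) s) (cong₂ (λ x y → coef (H x (H y (E r (E s f)))) ν i) (shift a (+ r)) (shift′ b (+ s))) ⟩
    t (suc r) s + coef (H (a + + suc r) (H (b + + s - + 1) (E r (E s f)))) ν i
      ≡⟨ at (lin-⊕ (H-linear (a + + suc r)) (E (suc r) (H (b + + s) (E s f))) (H (b + + s - + 1) (E r (E s f)))) ν p i ⟨
    coef (H (a + + suc r) (E (suc r) (H (b + + s) (E s f)) ⊕ H (b + + s - + 1) (E r (E s f)))) ν i
      ≡⟨ at (lin-cong (H-linear (a + + suc r)) (E-H r (b + + s) (E s f))) ν p i ⟩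
    u (suc r) s ∎
    where
    shift : ∀ a r → a + + 1 + r ≡ a + (+ 1 + r)
    shift = solve-∀
    shift′ : ∀ b s → b - + 1 + s ≡ b + s - + 1
    shift′ = solve-∀

-- By `S′-S′` the two products are N(a,b) - N(a+1,b-1) and N(b-1,a+1) - N(b,a), which cancel by the
-- symmetry of N.
S′-anticommute : ∀ {z f} a b → Bd z f → S′ a (S′ b f) ⊕ S′ (b - + 1) (S′ (a + + 1) f) ≋ 0F
S′-anticommute {z} {f} a b bd .at ν p i = cancel
  {coef (S′ a (S′ b f)) ν i} {coef (S′ (b - + 1) (S′ (a + + 1) f)) ν i}
  (at (S′-S′ a b R z< (z<suc (z + b) (ℕₚ.≤-trans (ℕₚ.m≤m+n ℤ.∣ z + b ∣ _) (ℕₚ.m≤n+m _ ℤ.∣ z ∣))) bd) ν p i)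
  (trans (+ˡ (coef (S′ (b - + 1) (S′ (a + + 1) f)) ν i) (cong₂ (λ x y → coef (normalOrderedS (suc R) x y f) ν i) (sym (down-up b)) (sym (up-down a))))
         (at (S′-S′ (b - + 1) (a + + 1) R z< (z<suc (z + (a + + 1)) (ℕₚ.≤-trans (ℕₚ.m≤n+m ℤ.∣ z + (a + + 1) ∣ ℤ.∣ z + b ∣) (ℕₚ.m≤n+m _ ℤ.∣ z ∣))) bd) ν p i))
  (at (normalOrderedS-symmetric (suc R) b a f) ν p i) (at (normalOrderedS-symmetric (suc R) (b - + 1) (a + + 1) f) ν p i)
  where
  R : ℕ
  R = suc (ℤ.∣ z ∣ ℕ.+ (ℤ.∣ z + b ∣ ℕ.+ ℤ.∣ z + (a + + 1) ∣))
  z< : z ℤ.< + R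
  z< = z<suc∣z∣+ z _
  z<suc : ∀ x → ℤ.∣ x ∣ ≤ ℤ.∣ z ∣ ℕ.+ (ℤ.∣ z + b ∣ ℕ.+ ℤ.∣ z + (a + + 1) ∣) → x ℤ.< + suc R
  z<suc x le = ℤₚ.<-≤-trans (z<suc∣z∣+ x 0) (ℤ.+≤+ (s≤s (ℕₚ.m≤n⇒m≤1+n (ℕₚ.≤-trans (ℕₚ.≤-reflexive (ℕₚ.+-identityʳ ℤ.∣ x ∣)) le))))
  down-up : ∀ b → b - + 1 + + 1 ≡ b
  down-up = solve-∀
  up-down : ∀ a → a + + 1 - + 1 ≡ a
  up-down = solve-∀
  cancel : ∀ {x y m n m′ n′} → x + n ≡ m → y + m′ ≡ n′ → m′ ≡ m → n′ ≡ n → x + y ≡ + 0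
  cancel {x} {y} {m} {n} refl e refl refl = ℤG.∙-cancelˡ m (x + y) (+ 0) (trans (shuffle x y n) (trans (+ˡ x e) (sym (ℤₚ.+-identityʳ m))))
    where
    shuffle : ∀ x y n → x + n + (x + y) ≡ x + (y + (x + n))
    shuffle = solve-∀

-- `P-H` applied to each summand: the adjoints E commute with P, so 𝕊_b passes through P exactly as
-- h_b does.
P-S′ : ∀ {z f} j b → Bd z f → P (suc j) (S′ b f) ≋ P j (S′ (b - + 1) f) ⊕ S′ b (P (suc j) f)
P-S′ {z} {f} j b bd .at ν p i = begin
  coef (P (suc j) (S′ b f)) ν i
    ≡⟨ at (≋-trans (lin-cong (P-linear (suc j)) (S′-finite b R lt bd)) (lin-∑ (P-linear (suc j)) (upTo R) (λ r → H (b + + r) (E r f)))) ν p i ⟩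
  ∑< R (λ r → coef (P (suc j) (H (b + + r) (E r f))) ν i)
    ≡⟨ ∑<-cong R (λ r _ → term r) ⟩
  ∑< R (λ r → x r + y r)
    ≡⟨ ∑-+ (upTo R) x y ⟩
  ∑< R x + ∑< R y
    ≡⟨ cong₂ _+_
         (at (≋-trans (lin-cong (P-linear j) (S′-finite (b - + 1) R lt bd)) (lin-∑ (P-linear j) (upTo R) (λ r → H (b - + 1 + + r) (E r f)))) ν p i)
         (at (S′-finite b R lt (Bd-minus (suc j) (Bd-P (suc j) bd))) ν p i) ⟨
  coef (P j (S′ (b - + 1) f)) ν i + coef (S′ b (P (suc j) f)) ν i ∎
  where
  open ≡-Reasoning
  R = suc (ℤ.∣ z ∣ ℕ.+ 0)
  lt = z<suc∣z∣+ z 0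
  x y : ℕ → ℤ
  x r = coef (P j (H (b - + 1 + + r) (E r f))) ν i
  y r = coef (H (b + + r) (E r (P (suc j) f))) ν i
  shift : ∀ b r → b + r - + 1 ≡ b - + 1 + r
  shift = solve-∀
  term : ∀ r → coef (P (suc j) (H (b + + r) (E r f))) ν i ≡ x r + y r
  term r = trans (at (P-H j (b + + r) (E r f)) ν p i)
    (cong₂ _+_ (cong (λ k → coef (P j (H k (E r f))) ν i) (shift b (+ r)))
               (at (lin-cong (H-linear (b + + r)) (P-E-comm (suc j) r f)) ν p i))

normalOrderedB : ℕ → ℤ → ℤ → F → F
normalOrderedB R a b f = ∑F< R (λ j → ∑F< R (λ k → q^ j (q^ k (S′ (a + + j) (S′ (b + + k) (P j (P k f)))))))

-- Termwise: the summand (j,k) of the first product cancels the summand (k,j) of the second, by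
-- `S′-anticommute` at (a+j, b+k).
normalOrderedB-antisymmetric : ∀ {z f} R a b → Bd z f → normalOrderedB R a b f ⊕ normalOrderedB R (b - + 1) (a + + 1) f ≋ 0F
normalOrderedB-antisymmetric {z} {f} R a b bd .at ν p i = begin
  ∑< R (λ j → ∑< R (x j)) + ∑< R (λ k → ∑< R (y k))
    ≡⟨ +ˡ (∑< R (λ j → ∑< R (x j))) (∑-swap (upTo R) (upTo R) y) ⟩
  ∑< R (λ j → ∑< R (x j)) + ∑< R (λ j → ∑< R (λ k → y k j))
    ≡⟨ ∑-+ (upTo R) (λ j → ∑< R (x j)) (λ j → ∑< R (λ k → y k j)) ⟨
  ∑< R (λ j → ∑< R (x j) + ∑< R (λ k → y k j))
    ≡⟨ ∑<-zero R (λ j _ → trans (sym (∑-+ (upTo R) (x j) (λ k → y k j))) (∑<-zero R (λ k _ → cancel j k))) ⟩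
  + 0 ∎
  where
  open ≡-Reasoning
  x y : ℕ → ℕ → ℤ
  x j k = coef (q^ j (q^ k (S′ (a + + j) (S′ (b + + k) (P j (P k f)))))) ν i
  y k j = coef (q^ k (q^ j (S′ (b - + 1 + + k) (S′ (a + + 1 + + j) (P k (P j f)))))) ν i
  shift : ∀ b k → b - + 1 + k ≡ b + k - + 1
  shift = solve-∀
  shift′ : ∀ a j → a + + 1 + j ≡ a + j + + 1
  shift′ = solve-∀
  cancel : ∀ j k → x j k + y k j ≡ + 0
  cancel j k = begin
    x j k + y k j
      ≡⟨ +ˡ (x j k) (cong₂ (λ m n → coef (q^ k (q^ j (S′ m (S′ n (P k (P j f)))))) ν i) (shift b (+ k)) (shift′ a (+ j))) ⟩
    x j k + coef (q^ k (q^ j (S′ (b + + k - + 1) (S′ (a + + j + + 1) (P k (P j f)))))) ν i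
      ≡⟨ +ˡ (x j k) (at (≋-trans (lin-q^ (q^-linear k) j _) (lin-cong l (lin-cong (S′-linear (b + + k - + 1))
           (lin-cong (S′-linear (a + + j + + 1)) (P-comm k j f))))) ν p i) ⟩
    x j k + coef (q^ j (q^ k (S′ (b + + k - + 1) (S′ (a + + j + + 1) (P j (P k f)))))) ν i
      ≡⟨ at (lin-⊕ l (S′ (a + + j) (S′ (b + + k) (P j (P k f)))) (S′ (b + + k - + 1) (S′ (a + + j + + 1) (P j (P k f))))) ν p i ⟨
    coef (q^ j (q^ k (S′ (a + + j) (S′ (b + + k) (P j (P k f))) ⊕ S′ (b + + k - + 1) (S′ (a + + j + + 1) (P j (P k f)))))) ν i
      ≡⟨ at (≋-trans (lin-cong l (S′-anticommute (a + + j) (b + + k) (Bd-minus {z} j (Bd-P j (Bd-minus {z} k (Bd-P k bd)))))) (lin-0 l)) ν p i ⟩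
    + 0 ∎
    where
    l : Linear (q^ j ∘ q^ k)
    l = ∘-linear (q^-linear j) (q^-linear k)

-- The cut-offs are kept separate because the index shift in `B′-B′` shortens only the outer sum.
B′-B′-finite : ∀ {z f} a b R R′ → z ℤ.< + R′ → z + b ℤ.< + R → Bd z f →
  B′ a (B′ b f) ≋ ∑F< R (λ j → ∑F< R′ (λ k → q^ j (S′ (a + + j) (P j (q^ k (S′ (b + + k) (P k f)))))))
B′-B′-finite {z} {f} a b R R′ lt lt′ bd = ≋-trans (B′-finite a R lt′ (Bd-B′ b bd)) (∑F<-cong R λ j _ →
  ≋-trans (lin-cong (l j) (B′-finite b R′ lt bd)) (lin-∑ (l j) (upTo R′) (λ k → q^ k (S′ (b + + k) (P k f)))))
  where
  l : ∀ j → Linear (q^ j ∘ (S′ (a + + j) ∘ P j))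
  l j = ∘-linear (q^-linear j) (∘-linear (S′-linear (a + + j)) (P-linear j))

-- Moving P (j+1) past 𝕊_{b+k} leaves the extra term P j 𝕊_{b+k-1}. With q^(j+1) = q q^j and a +
-- (j+1) = (a+1) + j, these terms sum to q 𝔹_{a+1} 𝔹_{b-1}.
B′-B′ : ∀ {z f} a b R → z ℤ.< + suc R → z + b ℤ.< + suc R → z + (b - + 1) ℤ.< + R → Bd z f →
        B′ a (B′ b f) ≋ normalOrderedB (suc R) a b f ⊕ q· B′ (a + + 1) (B′ (b - + 1) f)
B′-B′ {z} {f} a b R lt lt′ lt″ bd .at ν p i = begin
  coef (B′ a (B′ b f)) ν i                     ≡⟨ at (B′-B′-finite a b (suc R) (suc R) lt lt′ bd) ν p i ⟩
  ∑< (suc R) (λ j → ∑< (suc R) (t j))          ≡⟨ ∑<-suc R (λ j → ∑< (suc R) (t j)) ⟩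
  ∑< (suc R) (t 0) + ∑< R (λ j → ∑< (suc R) (t (suc j)))
    ≡⟨ cong₂ _+_ (∑<-cong (suc R) (λ k _ → t-0 k))
                 (∑<-cong R (λ j _ → trans (∑<-cong (suc R) (λ k _ → t-suc j k)) (∑-+ (upTo (suc R)) (m (suc j)) (w j)))) ⟩
  ∑< (suc R) (m 0) + ∑< R (λ j → ∑< (suc R) (m (suc j)) + ∑< (suc R) (w j))
    ≡⟨ +ˡ (∑< (suc R) (m 0)) (∑-+ (upTo R) (λ j → ∑< (suc R) (m (suc j))) (λ j → ∑< (suc R) (w j))) ⟩
  ∑< (suc R) (m 0) + (∑< R (λ j → ∑< (suc R) (m (suc j))) + ∑< R (λ j → ∑< (suc R) (w j)))
    ≡⟨ ℤₚ.+-assoc (∑< (suc R) (m 0)) _ _ ⟨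
  ∑< (suc R) (m 0) + ∑< R (λ j → ∑< (suc R) (m (suc j))) + ∑< R (λ j → ∑< (suc R) (w j))
    ≡⟨ cong₂ _+_ (sym (∑<-suc R (λ j → ∑< (suc R) (m j)))) (sym (at second ν p i)) ⟩
  coef (normalOrderedB (suc R) a b f ⊕ q· B′ (a + + 1) (B′ (b - + 1) f)) ν i ∎
  where
  open ≡-Reasoning
  W : ℕ → ℕ → F
  W j k = q^ j (S′ (a + + 1 + + j) (P j (q^ k (S′ (b - + 1 + + k) (P k f)))))
  t m w : ℕ → ℕ → ℤ
  t j k = coef (q^ j (S′ (a + + j) (P j (q^ k (S′ (b + + k) (P k f)))))) ν i
  m j k = coef (q^ j (q^ k (S′ (a + + j) (S′ (b + + k) (P j (P k f)))))) ν i
  w j k = coef (q· W j k) ν i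
  second : q· B′ (a + + 1) (B′ (b - + 1) f) ≋ ∑F< R (λ j → ∑F< (suc R) (λ k → q· W j k))
  second = ≋-trans (q·-cong (B′-B′-finite (a + + 1) (b - + 1) R (suc R) lt lt″ bd))
    (≋-trans (lin-∑ q·-linear (upTo R) (λ j → ∑F< (suc R) (W j))) (∑F<-cong R (λ j _ → lin-∑ q·-linear (upTo (suc R)) (W j))))
  t-0 : ∀ k → t 0 k ≡ m 0 k
  t-0 k = at (≋-trans (lin-cong S₀ (P-0 _)) (≋-trans (lin-q^ S₀ k _)
    (lin-cong (q^-linear k) (lin-cong S₀ (lin-cong (S′-linear (b + + k)) (≋-sym (P-0 (P k f)))))))) ν p i
    where
    S₀ : Linear (S′ (a + + 0))
    S₀ = S′-linear (a + + 0)
  t-suc : ∀ j k → t (suc j) k ≡ m (suc j) k + w j k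
  t-suc j k = begin
    t (suc j) k
      ≡⟨ at (lin-cong outer (≋-trans (lin-q^ (P-linear (suc j)) k (S′ (b + + k) (P k f)))
           (lin-cong (q^-linear k) (P-S′ j (b + + k) (Bd-minus {z} k (Bd-P k bd)))))) ν p i ⟩
    coef (q^ (suc j) (S′ (a + + suc j) (q^ k (X ⊕ Y)))) ν i
      ≡⟨ at (lin-⊕ (∘-linear outer (q^-linear k)) X Y) ν p i ⟩
    coef (q^ (suc j) (S′ (a + + suc j) (q^ k X))) ν i + coef (q^ (suc j) (S′ (a + + suc j) (q^ k Y))) ν i
      ≡⟨ ℤₚ.+-comm (coef (q^ (suc j) (S′ (a + + suc j) (q^ k X))) ν i) _ ⟩
    coef (q^ (suc j) (S′ (a + + suc j) (q^ k Y))) ν i + coef (q^ (suc j) (S′ (a + + suc j) (q^ k X))) ν i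
      ≡⟨ cong₂ _+_ (at (lin-cong (q^-linear (suc j)) (lin-q^ (S′-linear (a + + suc j)) k Y)) ν p i) w≡ ⟩
    m (suc j) k + w j k ∎
    where
    X Y : F
    X = P j (S′ (b + + k - + 1) (P k f))
    Y = S′ (b + + k) (P (suc j) (P k f))
    outer : Linear (q^ (suc j) ∘ S′ (a + + suc j))
    outer = ∘-linear (q^-linear (suc j)) (S′-linear (a + + suc j))
    shift : ∀ a j → a + (+ 1 + j) ≡ a + + 1 + j
    shift = solve-∀
    shift′ : ∀ b k → b + k - + 1 ≡ b - + 1 + k
    shift′ = solve-∀
    w≡ : coef (q^ (suc j) (S′ (a + + suc j) (q^ k X))) ν i ≡ w j k
    w≡ = trans (cong₂ (λ x y → coef (q^ (suc j) (S′ x (q^ k (P j (S′ y (P k f)))))) ν i) (shift a (+ j)) (shift′ b (+ k)))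
               (at (lin-cong (∘-linear (q^-linear (suc j)) (S′-linear (a + + 1 + + j)))
                     (≋-sym (lin-q^ (P-linear j) k (S′ (b - + 1 + + k) (P k f))))) ν p i)

-- `B′-B′` is applied at (a, b) and at (b-1, a+1); the two normally ordered parts cancel and only
-- the multiples of q remain.
B′-exchange : ∀ {z f} a b → Bd z f →
  B′ a (B′ b f) ⊕ B′ (b - + 1) (B′ (a + + 1) f) ≋ q· (B′ (a + + 1) (B′ (b - + 1) f)) ⊕ q· (B′ b (B′ a f))
B′-exchange {z} {f} a b bd .at ν p i = begin
  coef (B′ a (B′ b f)) ν i + coef (B′ (b - + 1) (B′ (a + + 1) f)) ν i
    ≡⟨ cong₂ _+_ (at (B′-B′ a b R (lt z bz) (lt (z + b) bb) (lt′ (z + (b - + 1)) bb′) bd) ν p i)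
                 (at (B′-B′ (b - + 1) (a + + 1) R (lt z bz) (lt (z + (a + + 1)) ba) (lt′ (z + (a + + 1 - + 1)) ba′) bd) ν p i) ⟩
  (m + x) + (m′ + y)             ≡⟨ shuffle m x m′ y ⟩
  (m + m′) + (x + y)             ≡⟨ +ʳ (at (normalOrderedB-antisymmetric (suc R) a b bd) ν p i) ⟩
  + 0 + (x + y)                  ≡⟨ ℤₚ.+-identityˡ (x + y) ⟩
  x + y                          ≡⟨ +ˡ x (cong₂ (λ c d → coef (q· (B′ c (B′ d f))) ν i) (down-up b) (up-down a)) ⟩
  x + coef (q· (B′ b (B′ a f))) ν i ∎
  where
  open ≡-Reasoning
  n₁ n₂ n₃ n₄ n₅ R : ℕ
  n₁ = ℤ.∣ z ∣
  n₂ = ℤ.∣ z + b ∣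
  n₃ = ℤ.∣ z + (b - + 1) ∣
  n₄ = ℤ.∣ z + (a + + 1) ∣
  n₅ = ℤ.∣ z + (a + + 1 - + 1) ∣
  R = suc (n₁ ℕ.+ (n₂ ℕ.+ (n₃ ℕ.+ (n₄ ℕ.+ n₅))))
  lt′ : ∀ x → ℤ.∣ x ∣ ≤ n₁ ℕ.+ (n₂ ℕ.+ (n₃ ℕ.+ (n₄ ℕ.+ n₅))) → x ℤ.< + R
  lt′ x le = ℤₚ.<-≤-trans (z<suc∣z∣+ x 0) (ℤ.+≤+ (s≤s (ℕₚ.≤-trans (ℕₚ.≤-reflexive (ℕₚ.+-identityʳ ℤ.∣ x ∣)) le)))
  lt : ∀ x → ℤ.∣ x ∣ ≤ n₁ ℕ.+ (n₂ ℕ.+ (n₃ ℕ.+ (n₄ ℕ.+ n₅))) → x ℤ.< + suc R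
  lt x le = ℤₚ.<-trans (lt′ x le) (ℤ.+<+ ℕₚ.≤-refl)
  bz : n₁ ≤ n₁ ℕ.+ (n₂ ℕ.+ (n₃ ℕ.+ (n₄ ℕ.+ n₅)))
  bz = ℕₚ.m≤m+n n₁ _
  bb : n₂ ≤ n₁ ℕ.+ (n₂ ℕ.+ (n₃ ℕ.+ (n₄ ℕ.+ n₅)))
  bb = ℕₚ.≤-trans (ℕₚ.m≤m+n n₂ _) (ℕₚ.m≤n+m _ n₁)
  bb′ : n₃ ≤ n₁ ℕ.+ (n₂ ℕ.+ (n₃ ℕ.+ (n₄ ℕ.+ n₅)))
  bb′ = ℕₚ.≤-trans (ℕₚ.m≤m+n n₃ _) (ℕₚ.≤-trans (ℕₚ.m≤n+m _ n₂) (ℕₚ.m≤n+m _ n₁))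
  ba : n₄ ≤ n₁ ℕ.+ (n₂ ℕ.+ (n₃ ℕ.+ (n₄ ℕ.+ n₅)))
  ba = ℕₚ.≤-trans (ℕₚ.m≤m+n n₄ n₅) (ℕₚ.≤-trans (ℕₚ.m≤n+m _ n₃) (ℕₚ.≤-trans (ℕₚ.m≤n+m _ n₂) (ℕₚ.m≤n+m _ n₁)))
  ba′ : n₅ ≤ n₁ ℕ.+ (n₂ ℕ.+ (n₃ ℕ.+ (n₄ ℕ.+ n₅)))
  ba′ = ℕₚ.≤-trans (ℕₚ.m≤n+m n₅ n₄) (ℕₚ.≤-trans (ℕₚ.m≤n+m _ n₃) (ℕₚ.≤-trans (ℕₚ.m≤n+m _ n₂) (ℕₚ.m≤n+m _ n₁)))
  m m′ x y : ℤ
  m  = coef (normalOrderedB (suc R) a b f) ν i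
  m′ = coef (normalOrderedB (suc R) (b - + 1) (a + + 1) f) ν i
  x  = coef (q· (B′ (a + + 1) (B′ (b - + 1) f))) ν i
  y  = coef (q· (B′ (b - + 1 + + 1) (B′ (a + + 1 - + 1) f))) ν i
  shuffle : ∀ m x m′ y → (m + x) + (m′ + y) ≡ (m + m′) + (x + y)
  shuffle = solve-∀
  down-up : ∀ b → b - + 1 + + 1 ≡ b
  down-up = solve-∀
  up-down : ∀ a → a + + 1 - + 1 ≡ a
  up-down = solve-∀

-- The span of the words 𝔹₂ᵃ 𝔹₁₁ᶜ (1)

Bounded : F → Set
Bounded f = ∃ λ z → Bd z f

-- The interface between the analysis of 𝔹 and the algebra of words. The last three fields are the
-- exchange relation at (1,2), (0,1) and (0,2).
record QuadraticRelations (b₀ b₁ b₂ : F → F) : Set where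
  field
    linear₀  : Linear b₀
    linear₁  : Linear b₁
    linear₂  : Linear b₂
    bounded₀ : ∀ {f} → Bounded f → Bounded (b₀ f)
    bounded₁ : ∀ {f} → Bounded f → Bounded (b₁ f)
    bounded₂ : ∀ {f} → Bounded f → Bounded (b₂ f)
    b₁b₂     : ∀ {f} → Bounded f → b₁ (b₂ f) ≋ q· b₂ (b₁ f)
    b₀b₁     : ∀ {f} → Bounded f → b₀ (b₁ f) ≋ q· b₁ (b₀ f)
    b₀b₂     : ∀ {f} → Bounded f → b₀ (b₂ f) ⊕ b₁ (b₁ f) ≋ q· b₁ (b₁ f) ⊕ q· b₂ (b₀ f)

B′-QuadraticRelations : QuadraticRelations (B′ (+ 0)) (B′ (+ 1)) (B′ (+ 2))
B′-QuadraticRelations = record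
  { linear₀ = B′-linear (+ 0) ; linear₁ = B′-linear (+ 1) ; linear₂ = B′-linear (+ 2)
  ; bounded₀ = λ (z , b) → z + + 0 , Bd-B′ (+ 0) b
  ; bounded₁ = λ (z , b) → z + + 1 , Bd-B′ (+ 1) b
  ; bounded₂ = λ (z , b) → z + + 2 , Bd-B′ (+ 2) b
  ; b₁b₂ = λ {f} (z , b) → halve {B′ (+ 1) (B′ (+ 2) f)} {q· B′ (+ 2) (B′ (+ 1) f)} (B′-exchange (+ 1) (+ 2) b)
  ; b₀b₁ = λ {f} (z , b) → halve {B′ (+ 0) (B′ (+ 1) f)} {q· B′ (+ 1) (B′ (+ 0) f)} (B′-exchange (+ 0) (+ 1) b)
  ; b₀b₂ = λ (z , b) → B′-exchange (+ 0) (+ 2) b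
  }
  where
  double : ∀ x → x + x ≡ x * + 2
  double = solve-∀
  -- For b = a + 1 the two terms on each side of the exchange relation coincide, and the factor 2
  -- cancels in ℤ.
  halve : ∀ {f g} → f ⊕ f ≋ g ⊕ g → f ≋ g
  halve {f} {g} e .at μ p i = ℤₚ.*-cancelʳ-≡ (coef f μ i) (coef g μ i) (+ 2)
    (trans (sym (double (coef f μ i))) (trans (at e μ p i) (double (coef g μ i))))

module Words (b₀ b₁ b₂ : F → F) (rel : QuadraticRelations b₀ b₁ b₂)
             (𝟙 : F) (bounded-𝟙 : Bounded 𝟙) (b₀𝟙 : b₀ 𝟙 ≋ 𝟙) where

  open QuadraticRelations rel

  infixl 6 _⊖_
  _⊖_ : F → F → F
  f ⊖ g = f ⊕ -[1+ 0 ] ⊙ g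

  b₁₁ : F → F
  b₁₁ f = b₁ (b₁ f) ⊖ b₂ (b₀ f)

  linear₁₁ : Linear b₁₁
  linear₁₁ .lin-cong e = ⊕-cong (lin-cong linear₁ (lin-cong linear₁ e)) (⊙-cong -[1+ 0 ] (lin-cong linear₂ (lin-cong linear₀ e)))
  linear₁₁ .lin-⊕ f g .at μ p i = trans
    (cong₂ (λ x y → x + -[1+ 0 ] * y) (at (lin-⊕ (∘-linear linear₁ linear₁) f g) μ p i) (at (lin-⊕ (∘-linear linear₂ linear₀) f g) μ p i))
    (arith (coef (b₁ (b₁ f)) μ i) (coef (b₁ (b₁ g)) μ i) (coef (b₂ (b₀ f)) μ i) (coef (b₂ (b₀ g)) μ i))
    where
    arith : ∀ x y z w → (x + y) + -[1+ 0 ] * (z + w) ≡ (x + -[1+ 0 ] * z) + (y + -[1+ 0 ] * w)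
    arith = solve-∀
  linear₁₁ .lin-⊙ c f .at μ p i = trans
    (cong₂ (λ x y → x + -[1+ 0 ] * y) (at (lin-⊙ (∘-linear linear₁ linear₁) c f) μ p i) (at (lin-⊙ (∘-linear linear₂ linear₀) c f) μ p i))
    (arith c (coef (b₁ (b₁ f)) μ i) (coef (b₂ (b₀ f)) μ i))
    where
    arith : ∀ c x y → c * x + -[1+ 0 ] * (c * y) ≡ c * (x + -[1+ 0 ] * y)
    arith = solve-∀
  linear₁₁ .lin-q f = ≋-trans
    (⊕-cong (lin-q (∘-linear linear₁ linear₁) f) (⊙-cong -[1+ 0 ] (lin-q (∘-linear linear₂ linear₀) f)))
    (≋-trans (⊕-cong ≋-refl (≋-sym (lin-⊙ q·-linear -[1+ 0 ] (b₂ (b₀ f))))) (≋-sym (lin-⊕ q·-linear (b₁ (b₁ f)) (-[1+ 0 ] ⊙ b₂ (b₀ f)))))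

  lin-⊖ : ∀ {T} → Linear T → ∀ f g → T (f ⊖ g) ≋ T f ⊖ T g
  lin-⊖ l f g = ≋-trans (lin-⊕ l f (-[1+ 0 ] ⊙ g)) (⊕-cong ≋-refl (lin-⊙ l -[1+ 0 ] g))

  Bounded-⊕ : ∀ {f g} → Bounded f → Bounded g → Bounded (f ⊕ g)
  Bounded-⊕ (z , b) (z′ , b′) = z ℤ.⊔ z′ , Bd-⊕ (Bd-mono (ℤₚ.i≤i⊔j z z′) b) (Bd-mono (ℤₚ.i≤j⊔i z z′) b′)

  bounded₁₁ : ∀ {f} → Bounded f → Bounded (b₁₁ f)
  bounded₁₁ b with bounded₂ (bounded₀ b)
  ... | z , b′ = Bounded-⊕ (bounded₁ (bounded₁ b)) (z , Bd-⊙ -[1+ 0 ] b′)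

  -- Both b₁b₂b₀ and b₂b₀b₁ equal q b₂b₁b₀.
  b₁b₁₁ : ∀ {f} → Bounded f → b₁ (b₁₁ f) ≋ b₁₁ (b₁ f)
  b₁b₁₁ {f} b = begin
    b₁ (b₁ (b₁ f) ⊖ b₂ (b₀ f))                 ≈⟨ lin-⊖ linear₁ (b₁ (b₁ f)) (b₂ (b₀ f)) ⟩
    b₁ (b₁ (b₁ f)) ⊖ b₁ (b₂ (b₀ f))            ≈⟨ ⊕-cong ≋-refl (⊙-cong -[1+ 0 ] (≋-trans (b₁b₂ (bounded₀ b))
                                                    (≋-sym (≋-trans (lin-cong linear₂ (b₀b₁ b)) (lin-q linear₂ (b₁ (b₀ f))))))) ⟩
    b₁ (b₁ (b₁ f)) ⊖ b₂ (b₀ (b₁ f))            ∎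
    where open ≋-Reasoning

  -- Multiplication by q² - q + 1 and by (q - 1)².
  Φ₆ Ψ : F → F
  Φ₆ f = q· q· f ⊖ q· f ⊕ f
  Ψ  f = q· q· f ⊖ (+ 2) ⊙ q· f ⊕ f

  private
    -- With x = 𝔹₁𝔹₁, y = 𝔹₂𝔹₀ and z = 𝔹₀𝔹₂ = q y + (q - 1) x (each followed
    -- by a common operator), q² x - z = (q² - q + 1) (x - y) + (q - 1)² y.
    rearrange : ∀ {x y z} → z ⊕ x ≋ q· x ⊕ q· y → q· q· x ⊖ z ≋ Φ₆ (x ⊖ y) ⊕ Ψ y
    rearrange {x} {y} {z} e .at μ p i = trans
      (cong (λ t → coef (q· q· x) μ i + -[1+ 0 ] * t) z≡)
      (case i)
      where
      z≡ : coef z μ i ≡ coef (q· x) μ i + coef (q· y) μ i - coef x μ i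
      z≡ = trans (sym (peel (coef z μ i) (coef x μ i))) (cong (_- coef x μ i) (at e μ p i))
        where
        peel : ∀ a b → a + b - b ≡ a
        peel = solve-∀
      arith : ∀ Qx qx qy qy′ Qy x y →
        qy′ ≡ qy → Qx + -[1+ 0 ] * (qx + qy - x) ≡
        ((Qx + -[1+ 0 ] * Qy) + -[1+ 0 ] * (qx + -[1+ 0 ] * qy)) + (x + -[1+ 0 ] * y) + ((Qy + -[1+ 0 ] * (+ 2 * qy′)) + y)
      arith Qx qx qy qy′ Qy x y refl = solve-arith Qx qx qy Qy x y
        where
        solve-arith : ∀ Qx qx qy Qy x y → Qx + -[1+ 0 ] * (qx + qy - x) ≡
          ((Qx + -[1+ 0 ] * Qy) + -[1+ 0 ] * (qx + -[1+ 0 ] * qy)) + (x + -[1+ 0 ] * y) + ((Qy + -[1+ 0 ] * (+ 2 * qy)) + y)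
        solve-arith = solve-∀
      -- `q·` computes by cases on the exponent and the identity reaches up to q², hence the
      -- exponents 0, 1 and the rest.
      case : ∀ i → coef (q· q· x) μ i + -[1+ 0 ] * (coef (q· x) μ i + coef (q· y) μ i - coef x μ i) ≡ coef (Φ₆ (x ⊖ y) ⊕ Ψ y) μ i
      case zero          = arith (+ 0) (+ 0) (+ 0) (+ 0) (+ 0) (coef x μ 0) (coef y μ 0) refl
      case (suc zero)    = arith (+ 0) (coef x μ 0) (coef y μ 0) (coef y μ 0) (+ 0) (coef x μ 1) (coef y μ 1) refl
      case (suc (suc i)) = arith (coef x μ i) (coef x μ (suc i)) (coef y μ (suc i)) _ (coef y μ i) (coef x μ (suc (suc i))) (coef y μ (suc (suc i))) refl

  Φ₆-cong : ∀ {f g} → f ≋ g → Φ₆ f ≋ Φ₆ g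
  Φ₆-cong e = ⊕-cong (⊕-cong (q·-cong (q·-cong e)) (⊙-cong -[1+ 0 ] (q·-cong e))) e

  -- Here b₁b₁b₂ = q² b₂b₁b₁, and `rearrange` is used with b₂ as the common operator on the left.
  b₁₁b₂ : ∀ {f} → Bounded f → b₁₁ (b₂ f) ≋ Φ₆ (b₂ (b₁₁ f)) ⊕ Ψ (b₂ (b₂ (b₀ f)))
  b₁₁b₂ {f} b = begin
    b₁ (b₁ (b₂ f)) ⊖ b₂ (b₀ (b₂ f))                       ≈⟨ ⊕-cong (≋-trans (lin-cong linear₁ (b₁b₂ b))
                                                               (≋-trans (lin-q linear₁ (b₂ (b₁ f))) (q·-cong (b₁b₂ (bounded₁ b))))) ≋-refl ⟩
    q· q· b₂ (b₁ (b₁ f)) ⊖ b₂ (b₀ (b₂ f))                 ≈⟨ rearrange exchange ⟩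
    Φ₆ (b₂ (b₁ (b₁ f)) ⊖ b₂ (b₂ (b₀ f))) ⊕ Ψ (b₂ (b₂ (b₀ f)))
      ≈⟨ ⊕-cong (Φ₆-cong (lin-⊖ linear₂ (b₁ (b₁ f)) (b₂ (b₀ f)))) ≋-refl ⟨
    Φ₆ (b₂ (b₁₁ f)) ⊕ Ψ (b₂ (b₂ (b₀ f)))                  ∎
    where
    open ≋-Reasoning
    exchange : b₂ (b₀ (b₂ f)) ⊕ b₂ (b₁ (b₁ f)) ≋ q· b₂ (b₁ (b₁ f)) ⊕ q· b₂ (b₂ (b₀ f))
    exchange = begin
      b₂ (b₀ (b₂ f)) ⊕ b₂ (b₁ (b₁ f))             ≈⟨ lin-⊕ linear₂ (b₀ (b₂ f)) (b₁ (b₁ f)) ⟨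
      b₂ (b₀ (b₂ f) ⊕ b₁ (b₁ f))                  ≈⟨ lin-cong linear₂ (b₀b₂ b) ⟩
      b₂ (q· b₁ (b₁ f) ⊕ q· b₂ (b₀ f))            ≈⟨ lin-⊕ linear₂ (q· b₁ (b₁ f)) (q· b₂ (b₀ f)) ⟩
      b₂ (q· b₁ (b₁ f)) ⊕ b₂ (q· b₂ (b₀ f))       ≈⟨ ⊕-cong (lin-q linear₂ (b₁ (b₁ f))) (lin-q linear₂ (b₂ (b₀ f))) ⟩
      q· b₂ (b₁ (b₁ f)) ⊕ q· b₂ (b₂ (b₀ f))       ∎

  -- The mirror image of `b₁₁b₂`: b₀b₁b₁ = q² b₁b₁b₀, and the common operator b₀ now stands on the
  -- right.
  b₀b₁₁ : ∀ {f} → Bounded f → b₀ (b₁₁ f) ≋ Φ₆ (b₁₁ (b₀ f)) ⊕ Ψ (b₂ (b₀ (b₀ f)))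
  b₀b₁₁ {f} b = begin
    b₀ (b₁ (b₁ f) ⊖ b₂ (b₀ f))                    ≈⟨ lin-⊖ linear₀ (b₁ (b₁ f)) (b₂ (b₀ f)) ⟩
    b₀ (b₁ (b₁ f)) ⊖ b₀ (b₂ (b₀ f))               ≈⟨ ⊕-cong (≋-trans (b₀b₁ (bounded₁ b))
                                                       (q·-cong (≋-trans (lin-cong linear₁ (b₀b₁ b)) (lin-q linear₁ (b₁ (b₀ f)))))) ≋-refl ⟩
    q· q· b₁ (b₁ (b₀ f)) ⊖ b₀ (b₂ (b₀ f))         ≈⟨ rearrange (b₀b₂ (bounded₀ b)) ⟩
    Φ₆ (b₁₁ (b₀ f)) ⊕ Ψ (b₂ (b₀ (b₀ f)))          ∎
    where open ≋-Reasoning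

  -- Since b₁ does not preserve the span, b₁b₁ is replaced by b₁₁ + b₂b₀; this gives the
  -- coefficients q - 1 and 2q - 1.
  b₀b₂′ : ∀ {f} → Bounded f → b₀ (b₂ f) ≋ (q· b₁₁ f ⊖ b₁₁ f) ⊕ ((+ 2) ⊙ q· b₂ (b₀ f) ⊖ b₂ (b₀ f))
  b₀b₂′ {f} b .at μ p i = ℤG.∙-cancelʳ (coef (b₁ (b₁ f)) μ i) _ _ (trans (at (b₀b₂ b) μ p i) (case i))
    where
    arith : ∀ qx qy x y → qx + qy ≡ ((qx + -[1+ 0 ] * qy) + -[1+ 0 ] * (x + -[1+ 0 ] * y)) + (+ 2 * qy + -[1+ 0 ] * y) + x
    arith = solve-∀
    case : ∀ i → coef (q· b₁ (b₁ f) ⊕ q· b₂ (b₀ f)) μ i ≡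
                 coef ((q· b₁₁ f ⊖ b₁₁ f) ⊕ ((+ 2) ⊙ q· b₂ (b₀ f) ⊖ b₂ (b₀ f))) μ i + coef (b₁ (b₁ f)) μ i
    case zero    = arith (+ 0) (+ 0) (coef (b₁ (b₁ f)) μ 0) (coef (b₂ (b₀ f)) μ 0)
    case (suc i) = arith (coef (b₁ (b₁ f)) μ i) (coef (b₂ (b₀ f)) μ i) (coef (b₁ (b₁ f)) μ (suc i)) (coef (b₂ (b₀ f)) μ (suc i))

  word : ℕ → ℕ → F
  word (suc a) c       = b₂ (word a c)
  word zero    (suc c) = b₁₁ (word zero c)
  word zero    zero    = 𝟙

  bounded-word : ∀ a c → Bounded (word a c)
  bounded-word (suc a) c       = bounded₂ (bounded-word a c)
  bounded-word zero    (suc c) = bounded₁₁ (bounded-word zero c)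
  bounded-word zero    zero    = bounded-𝟙

  -- The ℤ[q]-span of the words with n letters. b₂ and b₁₁ add a letter and b₀ keeps their number,
  -- so n can serve as the measure of the recursion below.
  data Span (n : ℕ) : F → Set where
    gen : ∀ a c {f} → a ℕ.+ c ≡ n → f ≋ word a c → Span n f
    add : ∀ {f g h} → Span n g → Span n h → f ≋ g ⊕ h → Span n f
    scl : ∀ c {f g} → Span n g → f ≋ c ⊙ g → Span n f
    shf : ∀ {f g} → Span n g → f ≋ q· g → Span n f

  Span-map : ∀ {T n m} → Linear T → (∀ a c → a ℕ.+ c ≡ n → Span m (T (word a c))) → ∀ {f} → Span n f → Span m (T f)
  Span-≋ : ∀ {n f g} → f ≋ g → Span n g → Span n f
  Span-≋ e (gen a c s e′) = gen a c s (≋-trans e e′)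
  Span-≋ e (add s t e′)   = add s t (≋-trans e e′)
  Span-≋ e (scl c s e′)   = scl c s (≋-trans e e′)
  Span-≋ e (shf s e′)     = shf s (≋-trans e e′)
  Span-map l h (gen a c s e) = Span-≋ (lin-cong l e) (h a c s)
  Span-map l h (add s t e)   = add (Span-map l h s) (Span-map l h t) (≋-trans (lin-cong l e) (lin-⊕ l _ _))
  Span-map l h (scl c s e)   = scl c (Span-map l h s) (≋-trans (lin-cong l e) (lin-⊙ l c _))
  Span-map l h (shf s e)     = shf (Span-map l h s) (≋-trans (lin-cong l e) (lin-q l _))

  Span-⊕ : ∀ {n f g} → Span n f → Span n g → Span n (f ⊕ g)
  Span-⊕ s t = add s t ≋-refl

  Span-⊙ : ∀ {n f} c → Span n f → Span n (c ⊙ f)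
  Span-⊙ c s = scl c s ≋-refl

  Span-q : ∀ {n f} → Span n f → Span n (q· f)
  Span-q s = shf s ≋-refl

  Span-⊖ : ∀ {n f g} → Span n f → Span n g → Span n (f ⊖ g)
  Span-⊖ s t = Span-⊕ s (Span-⊙ -[1+ 0 ] t)

  Span-Φ₆ : ∀ {n f} → Span n f → Span n (Φ₆ f)
  Span-Φ₆ s = Span-⊕ (Span-⊖ (Span-q (Span-q s)) (Span-q s)) s

  Span-Ψ : ∀ {n f} → Span n f → Span n (Ψ f)
  Span-Ψ s = Span-⊕ (Span-⊖ (Span-q (Span-q s)) (Span-⊙ (+ 2) (Span-q s))) s

  Span-b₂ : ∀ {n f} → Span n f → Span (suc n) (b₂ f)
  Span-b₂ = Span-map linear₂ (λ a c s → gen (suc a) c (cong suc s) ≋-refl)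

  -- Pushing b₀ or b₁₁ past the first letter leaves b₀ and b₁₁ applied to words with one letter
  -- fewer, up to outer operators that act on smaller spans. The recursion on n ends with `b₀𝟙`, or
  -- with b₁₁ meeting a word without b₂.
  Span-b₀   : ∀ n {f} → Span n f → Span n (b₀ f)
  Span-b₁₁  : ∀ n {f} → Span n f → Span (suc n) (b₁₁ f)
  Span-b₀-word  : ∀ n a c → a ℕ.+ c ≡ n → Span n (b₀ (word a c))
  Span-b₁₁-word : ∀ n a c → a ℕ.+ c ≡ n → Span (suc n) (b₁₁ (word a c))

  Span-b₀  n = Span-map linear₀ (Span-b₀-word n)
  Span-b₁₁ n = Span-map linear₁₁ (Span-b₁₁-word n)

  Span-b₀-word n       zero    zero    refl = gen 0 0 refl b₀𝟙
  Span-b₀-word (suc n) zero    (suc n) refl = Span-≋ (b₀b₁₁ (bounded-word 0 n))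
    (Span-⊕ (Span-Φ₆ (Span-b₁₁ n s)) (Span-Ψ (Span-b₂ (Span-b₀ n s))))
    where
    s : Span n (b₀ (word 0 n))
    s = Span-b₀-word n 0 n refl
  Span-b₀-word (suc n) (suc a) c e = Span-≋ (b₀b₂′ (bounded-word a c))
    (Span-⊕ (Span-⊖ (Span-q t) t) (Span-⊖ (Span-⊙ (+ 2) (Span-q s)) s))
    where
    s : Span (suc n) (b₂ (b₀ (word a c)))
    s = Span-b₂ (Span-b₀-word n a c (ℕₚ.suc-injective e))
    t : Span (suc n) (b₁₁ (word a c))
    t = Span-b₁₁-word n a c (ℕₚ.suc-injective e)

  Span-b₁₁-word n       zero    c e = gen 0 (suc c) (cong suc e) ≋-refl
  Span-b₁₁-word (suc n) (suc a) c e = Span-≋ (b₁₁b₂ (bounded-word a c))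
    (Span-⊕ (Span-Φ₆ (Span-b₂ (Span-b₁₁-word n a c e′)))
            (Span-Ψ (Span-b₂ (Span-b₂ (Span-b₀-word n a c e′)))))
    where
    e′ : a ℕ.+ c ≡ n
    e′ = ℕₚ.suc-injective e

  -- Like `word 0`, but from any starting function: an odd number of ones leads to 𝔹₁₁ᶜ 𝔹₁ (1).
  iterate : ℕ → F → F
  iterate zero    f = f
  iterate (suc c) f = b₁₁ (iterate c f)

  b₁-iterate : ∀ c {f} → Bounded f → b₁ (iterate c f) ≋ iterate c (b₁ f)
  b₁-iterate zero    b = ≋-refl
  b₁-iterate (suc c) {f} b = ≋-trans (b₁b₁₁ (bounded-iterate c)) (lin-cong linear₁₁ (b₁-iterate c b))
    where
    bounded-iterate : ∀ c → Bounded (iterate c f)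
    bounded-iterate zero    = b
    bounded-iterate (suc c) = bounded₁₁ (bounded-iterate c)

-- Translation of the operators on SF

⟦_⟧ : SF → F
⟦ f ⟧ .coef μ i = coeffP (f μ) i

≋⇒≈ : ∀ {f g} → ⟦ f ⟧ ≋ ⟦ g ⟧ → f ≈ g
≋⇒≈ e = at e

coeffP-+P : ∀ p r i → coeffP (p +P r) i ≡ coeffP p i + coeffP r i
coeffP-+P []      r       i       = sym (ℤₚ.+-identityˡ _)
coeffP-+P (a ∷ p) []      i       = sym (ℤₚ.+-identityʳ _)
coeffP-+P (a ∷ p) (b ∷ r) zero    = refl
coeffP-+P (a ∷ p) (b ∷ r) (suc i) = coeffP-+P p r i

coeffP-cscaleP : ∀ c p i → coeffP (cscaleP c p) i ≡ c * coeffP p i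
coeffP-cscaleP c []      i       = sym (ℤₚ.*-zeroʳ c)
coeffP-cscaleP c (a ∷ p) zero    = refl
coeffP-cscaleP c (a ∷ p) (suc i) = coeffP-cscaleP c p i

coeffP-sumP : ∀ {A : Set} (xs : List A) (φ : A → ZPoly) i → coeffP (sumP (map φ xs)) i ≡ ∑ xs (λ x → coeffP (φ x) i)
coeffP-sumP []       φ i = refl
coeffP-sumP (x ∷ xs) φ i = trans (coeffP-+P (φ x) (sumP (map φ xs)) i) (+ˡ (coeffP (φ x) i) (coeffP-sumP xs φ i))

coeffP-sumOver : ∀ μs b f i → coeffP (sumOver μs b f) i ≡ ∑ μs (λ μ → ind (b μ) * coeffP (f μ) i)
coeffP-sumOver μs b f i = trans (coeffP-sumP μs (λ μ → if b μ then f μ else []) i) (∑-cong μs term)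
  where
  term : ∀ μ → coeffP (if b μ then f μ else []) i ≡ ind (b μ) * coeffP (f μ) i
  term μ with b μ
  ... | true  = sym (ℤₚ.*-identityˡ _)
  ... | false = sym (ℤₚ.*-zeroˡ (coeffP (f μ) i))

coeffP-shiftP : ∀ j p g ν → (∀ i → coeffP p i ≡ coef g ν i) → ∀ i → coeffP (shiftP j p) i ≡ coef (q^ j g) ν i
coeffP-shiftP zero    p g ν e i       = e i
coeffP-shiftP (suc j) p g ν e zero    = refl
coeffP-shiftP (suc j) p g ν e (suc i) = coeffP-shiftP j p g ν e i

opaque
  unfolding H P E

  ⟦hPerp⟧ : ∀ j f → ⟦ hPerp j f ⟧ ≋ P j ⟦ f ⟧
  ⟦hPerp⟧ j f .at ν p i = coeffP-sumOver (partitions (size ν ℕ.+ j)) (λ μ → horiz μ ν) f i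

  ⟦ePerp⟧ : ∀ r f → sign r ⊙ ⟦ ePerp r f ⟧ ≋ E r ⟦ f ⟧
  ⟦ePerp⟧ r f .at ν p i = trans (cong (sign r *_) (coeffP-sumOver μs (λ μ → vert μ ν) f i))
    (trans (sym (∑-* μs (sign r) (λ μ → ind (vert μ ν) * coeffP (f μ) i)))
           (∑-cong μs (λ μ → sym (ℤₚ.*-assoc (sign r) (ind (vert μ ν)) (coeffP (f μ) i)))))
    where
    μs : List (List ℕ)
    μs = partitions (size ν ℕ.+ r)

  ⟦hMul⟧ : ∀ r f → ⟦ hMul r f ⟧ ≋ H (+ r) ⟦ f ⟧
  ⟦hMul⟧ r f .at ν p i with r ℕ.≤ᵇ size ν in e
  ... | true  = trans (coeffP-sumOver (partitions (size ν ∸ r)) (horiz ν) f i)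
    (cong (λ z → ∑ (parts z) (λ μ → ind (horiz ν μ) * coeffP (f μ) i))
          (sym (trans (ℤₚ.m-n≡m⊖n (size ν) r) (ℤₚ.⊖-≥ (true-≤ᵇ {r} {size ν} e)))))
  ... | false = sym (H-large (+ r) ⟦ f ⟧ ν i (ℤ.+<+ (ℕₚ.≰⇒> λ le → contradiction (trans (sym e) (≤ᵇ-true le)) λ ())))

⟦hMulℤ⟧ : ∀ z f → ⟦ hMulℤ z f ⟧ ≋ H z ⟦ f ⟧
⟦hMulℤ⟧ (+ r)    f = ⟦hMul⟧ r f
⟦hMulℤ⟧ -[1+ r ] f = ≋-sym (≋-trans (H-negative r ⟦ f ⟧) (record { at = λ ν p i → refl }))

⟦S⟧ : ∀ a f → ⟦ S a f ⟧ ≋ S′ a ⟦ f ⟧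
⟦S⟧ a f .at ν p i = trans (coeffP-sumP (upTo (bound a ν)) (λ r → cscaleP (sign r) (hMulℤ (a + + r) (ePerp r f) ν)) i)
  (∑-cong (upTo (bound a ν)) term)
  where
  term : ∀ r → coeffP (cscaleP (sign r) (hMulℤ (a + + r) (ePerp r f) ν)) i ≡ coef (H (a + + r) (E r ⟦ f ⟧)) ν i
  term r = trans (coeffP-cscaleP (sign r) (hMulℤ (a + + r) (ePerp r f) ν) i)
    (at (≋-trans (⊙-cong (sign r) (⟦hMulℤ⟧ (a + + r) (ePerp r f)))
        (≋-trans (≋-sym (lin-⊙ (H-linear (a + + r)) (sign r) ⟦ ePerp r f ⟧))
                 (lin-cong (H-linear (a + + r)) (⟦ePerp⟧ r f)))) ν p i)

⟦B⟧ : ∀ a f → ⟦ B a f ⟧ ≋ B′ a ⟦ f ⟧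
⟦B⟧ a f .at ν p i = trans (coeffP-sumP (upTo (bound a ν)) (λ j → shiftP j (S (a + + j) (hPerp j f) ν)) i)
  (∑-cong (upTo (bound a ν)) λ j → coeffP-shiftP j (S (a + + j) (hPerp j f) ν) (S′ (a + + j) (P j ⟦ f ⟧)) ν
     (at (≋-trans (⟦S⟧ (a + + j) (hPerp j f)) (lin-cong (S′-linear (a + + j)) (⟦hPerp⟧ j f))) ν p) i)

bounded-one : Bd (+ 0) ⟦ oneSF ⟧
bounded-one .above []      p (ℤ.+<+ ()) i
bounded-one .above (x ∷ ν) p lt i = refl

-- The function 1 has degree 0, so every adjoint of positive index kills it and only j = r = 0
-- survives.
B′-one : ∀ a → B′ a ⟦ oneSF ⟧ ≋ H a ⟦ oneSF ⟧
B′-one a = begin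
  B′ a 𝟙                                  ≈⟨ B′-finite a 1 (ℤ.+<+ (s≤s z≤n)) bounded-one ⟩
  ∑F< 1 (λ j → q^ j (S′ (a + + j) (P j 𝟙)))  ≈⟨ single (λ j → q^ j (S′ (a + + j) (P j 𝟙))) ⟩
  S′ (a + + 0) (P 0 𝟙)                    ≈⟨ lin-cong (S′-linear (a + + 0)) (P-0 𝟙) ⟩
  S′ (a + + 0) 𝟙                          ≈⟨ S′-finite (a + + 0) 1 (ℤ.+<+ (s≤s z≤n)) bounded-one ⟩
  ∑F< 1 (λ r → H (a + + 0 + + r) (E r 𝟙)) ≈⟨ single (λ r → H (a + + 0 + + r) (E r 𝟙)) ⟩
  H (a + + 0 + + 0) (E 0 𝟙)               ≈⟨ lin-cong (H-linear (a + + 0 + + 0)) (E-0 𝟙) ⟩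
  H (a + + 0 + + 0) 𝟙                     ≡⟨ cong (λ z → H z 𝟙) (trans (ℤₚ.+-identityʳ (a + + 0)) (ℤₚ.+-identityʳ a)) ⟩
  H a 𝟙                                   ∎
  where
  open ≋-Reasoning
  𝟙 : F
  𝟙 = ⟦ oneSF ⟧
  single : ∀ (φ : ℕ → F) → ∑F< 1 φ ≋ φ 0
  single φ .at ν p i = ℤₚ.+-identityʳ (coef (φ 0) ν i)

opaque
  unfolding H

  -- Only the empty partition contributes, which requires |ν| = a; `horiz ν []` then says that ν has
  -- at most one row.
  H-one : ∀ a ν → IsPartition ν → ∀ i → coef (H (+ a) ⟦ oneSF ⟧) ν i ≡
          (if size ν ℕ.≡ᵇ a then ind (horiz ν []) * coeffP (+ 1 ∷ []) i else + 0)
  H-one a ν p i with size ν ℕ.≡ᵇ a in e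
  ... | true  = trans (cong (λ z → ∑ (parts z) (λ μ → ind (horiz ν μ) * coeffP (oneSF μ) i))
                        (trans (cong (λ n → + n + - (+ a)) (ℕₚ.≡ᵇ⇒≡ (size ν) a (subst T (sym e) _))) (ℤₚ.+-inverseʳ (+ a))))
                      (ℤₚ.+-identityʳ _)
  ... | false = ∑-zero (All.map (λ {μ} → vanish μ) (parts-PartitionOf (+ size ν + - (+ a))))
    where
    vanish : ∀ μ → PartitionOf (+ size ν + - (+ a)) μ → ind (horiz ν μ) * coeffP (oneSF μ) i ≡ + 0
    vanish []      (_ , e′) = ⊥-elim (subst T e (ℕₚ.≡⇒≡ᵇ (size ν) a (ℤₚ.+-injective (ℤₚ.i-j≡0⇒i≡j (+ size ν) (+ a) (sym e′)))))
    vanish (x ∷ μ) _        = ℤₚ.*-zeroʳ (ind (horiz ν (x ∷ μ)))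

B′-zero-one : B′ (+ 0) ⟦ oneSF ⟧ ≋ ⟦ oneSF ⟧
B′-zero-one = ≋-trans (B′-one (+ 0)) (record { at = λ ν p i → trans (H-one 0 ν p i) (value ν p i) })
  where
  value : ∀ ν → IsPartition ν → ∀ i → (if size ν ℕ.≡ᵇ 0 then ind (horiz ν []) * coeffP (+ 1 ∷ []) i else + 0) ≡ coeffP (oneSF ν) i
  value []          p i = ℤₚ.*-identityˡ _
  value (zero ∷ ν)  p i = contradiction (partition-positive ν p) λ ()
  value (suc x ∷ ν) p i = refl

B-one : ∀ a → 1 ≤ a → B (+ a) oneSF ≈ schurRow a
B-one a 1≤a = ≋⇒≈ {B (+ a) oneSF} {schurRow a} (≋-trans (⟦B⟧ (+ a) oneSF) (≋-trans (B′-one (+ a))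
  (record { at = λ ν p i → trans (H-one a ν p i) (value a 1≤a ν p i) })))
  where
  value : ∀ a → 1 ≤ a → ∀ ν → IsPartition ν → ∀ i →
          (if size ν ℕ.≡ᵇ a then ind (horiz ν []) * coeffP (+ 1 ∷ []) i else + 0) ≡ coeffP (schurRow a ν) i
  value (suc a) 1≤a []      p i = refl
  value a 1≤a (x ∷ [])      p i rewrite ℕₚ.+-identityʳ x with x ℕ.≡ᵇ a
  ... | true  = ℤₚ.*-identityˡ _
  ... | false = refl
  value a 1≤a (x ∷ zero ∷ ν)  p i = contradiction (partition-positive ν (partition-tail {x} (zero ∷ ν) p)) λ ()
  value a 1≤a (x ∷ suc y ∷ ν) p i with size (x ∷ suc y ∷ ν) ℕ.≡ᵇ a
  ... | true  = refl
  ... | false = refl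

-- Generalized Hall–Littlewood polynomials of shape (2ᵃ, 1ᵐ)

open Words (B′ (+ 0)) (B′ (+ 1)) (B′ (+ 2)) B′-QuadraticRelations ⟦ oneSF ⟧ (+ 0 , bounded-one) B′-zero-one

coeffP-singleton-sum : ∀ p i → coeffP (cscaleP (+ 1) p +P []) i ≡ coeffP p i
coeffP-singleton-sum p i = trans (coeffP-+P (cscaleP (+ 1) p) [] i)
  (trans (ℤₚ.+-identityʳ _) (trans (coeffP-cscaleP (+ 1) p i) (ℤₚ.*-identityˡ _)))

⟦Bν-2⟧ : ∀ f → ⟦ Bν (2 ∷ []) f ⟧ ≋ B′ (+ 2) ⟦ f ⟧
⟦Bν-2⟧ f = ≋-trans (record { at = λ ν p i → coeffP-singleton-sum (B (+ 2) f ν) i }) (⟦B⟧ (+ 2) f)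

⟦Bν-1⟧ : ∀ f → ⟦ Bν (1 ∷ []) f ⟧ ≋ B′ (+ 1) ⟦ f ⟧
⟦Bν-1⟧ f = ≋-trans (record { at = λ ν p i → coeffP-singleton-sum (B (+ 1) f ν) i }) (⟦B⟧ (+ 1) f)

⟦B-B⟧ : ∀ a b f → ⟦ B a (B b f) ⟧ ≋ B′ a (B′ b ⟦ f ⟧)
⟦B-B⟧ a b f = ≋-trans (⟦B⟧ a (B b f)) (lin-cong (B′-linear a) (⟦B⟧ b f))

-- `perms 2` lists the transposition first: it gives -𝔹₂𝔹₀, and the identity gives 𝔹₁𝔹₁.
⟦Bν-11⟧ : ∀ f → ⟦ Bν (1 ∷ 1 ∷ []) f ⟧ ≋ b₁₁ ⟦ f ⟧
⟦Bν-11⟧ f .at ν p i = begin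
  coeffP (cscaleP (- + 1) p₂₀ +P (cscaleP (+ 1) p₁₁ +P [])) i
    ≡⟨ coeffP-+P (cscaleP (- + 1) p₂₀) (cscaleP (+ 1) p₁₁ +P []) i ⟩
  coeffP (cscaleP (- + 1) p₂₀) i + coeffP (cscaleP (+ 1) p₁₁ +P []) i
    ≡⟨ cong₂ _+_ (coeffP-cscaleP (- + 1) p₂₀ i) (coeffP-singleton-sum p₁₁ i) ⟩
  - + 1 * coeffP p₂₀ i + coeffP p₁₁ i
    ≡⟨ ℤₚ.+-comm (- + 1 * coeffP p₂₀ i) (coeffP p₁₁ i) ⟩
  coeffP p₁₁ i + - + 1 * coeffP p₂₀ i
    ≡⟨ cong₂ (λ x y → x + - + 1 * y) (at (⟦B-B⟧ (+ 1) (+ 1) f) ν p i) (at (⟦B-B⟧ (+ 2) (+ 0) f) ν p i) ⟩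
  coef (b₁₁ ⟦ f ⟧) ν i ∎
  where
  open ≡-Reasoning
  p₂₀ p₁₁ : ZPoly
  p₂₀ = B (+ 2) (B (+ 0) f) ν
  p₁₁ = B (+ 1) (B (+ 1) f) ν

double : ℕ → ℕ
double zero    = zero
double (suc c) = suc (suc (double c))

parity : ∀ m → ∃ λ c → m ≡ double c ⊎ m ≡ suc (double c)
parity zero    = 0 , inj₁ refl
parity (suc m) with parity m
... | c , inj₁ refl = c , inj₂ refl
... | c , inj₂ refl = suc c , inj₁ refl

twosOnes : ℕ → ℕ → List ℕ
twosOnes a m = replicate a 2 ++ replicate m 1

partition-twosOnes : ∀ a m → IsPartition (twosOnes a m) × get (twosOnes a m) 0 ≤ 2
partition-twosOnes zero    zero    = refl , z≤n
partition-twosOnes zero    (suc m) = partition-∷ (replicate m 1) (s≤s z≤n) (proj₁ (partition-twosOnes 0 m)) (head≤1 m) , s≤s z≤n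
  where
  head≤1 : ∀ m → get (replicate m 1) 0 ≤ 1
  head≤1 zero    = z≤n
  head≤1 (suc m) = s≤s z≤n
partition-twosOnes (suc a) m       =
  partition-∷ (twosOnes a m) (s≤s z≤n) (proj₁ (partition-twosOnes a m)) (proj₂ (partition-twosOnes a m)) , ℕₚ.≤-refl

KBounded-twosOnes : ∀ a m → KBounded 2 (twosOnes a m)
KBounded-twosOnes a m = true-∧ (proj₁ (partition-twosOnes a m)) (bounded a m)
  where
  bounded : ∀ a m → allB (λ x → x ℕ.≤ᵇ 2) (twosOnes a m) ≡ true
  bounded zero    zero    = refl
  bounded zero    (suc m) = bounded 0 m
  bounded (suc a) m       = bounded a m

-- For k = 2 a leading part 1 opens a piece of 3 - 1 = 2 parts. Fuel is spent once per piece while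
-- the length drops by two, so the induction needs any sufficient f rather than the exact length.
foldr-split-even : ∀ c f → double c ≤ f → ⟦ foldr Bν oneSF (splitF 2 f (replicate (double c) 1)) ⟧ ≋ iterate c ⟦ oneSF ⟧
foldr-split-even zero    zero    _ = ≋-refl
foldr-split-even zero    (suc f) _ = ≋-refl
foldr-split-even (suc c) (suc f) (s≤s le) = ≋-trans (⟦Bν-11⟧ (foldr Bν oneSF (splitF 2 f (replicate (double c) 1))))
  (lin-cong linear₁₁ (foldr-split-even c f (ℕₚ.≤-trans (ℕₚ.n≤1+n _) le)))

-- The unpaired part 1 is the last piece, so its 𝔹₁ acts directly on 1.
foldr-split-odd : ∀ c f → suc (double c) ≤ f →
  ⟦ foldr Bν oneSF (splitF 2 f (replicate (suc (double c)) 1)) ⟧ ≋ iterate c (B′ (+ 1) ⟦ oneSF ⟧)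
foldr-split-odd zero    (suc zero)    _ = ⟦Bν-1⟧ oneSF
foldr-split-odd zero    (suc (suc f)) _ = ⟦Bν-1⟧ oneSF
foldr-split-odd (suc c) (suc f) (s≤s le) = ≋-trans (⟦Bν-11⟧ (foldr Bν oneSF (splitF 2 f (replicate (suc (double c)) 1))))
  (lin-cong linear₁₁ (foldr-split-odd c f (ℕₚ.≤-trans (ℕₚ.n≤1+n _) le)))

⟦C-even⟧ : ∀ c → ⟦ C 2 (replicate (double c) 1) ⟧ ≋ iterate c ⟦ oneSF ⟧
⟦C-even⟧ c = foldr-split-even c _ (ℕₚ.≤-reflexive (sym (Listₚ.length-replicate (double c))))

⟦C-odd⟧ : ∀ c → ⟦ C 2 (replicate (suc (double c)) 1) ⟧ ≋ iterate c (B′ (+ 1) ⟦ oneSF ⟧)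
⟦C-odd⟧ c = foldr-split-odd c _ (ℕₚ.≤-reflexive (sym (Listₚ.length-replicate (suc (double c)))))

word-iterate : ∀ c → word 0 c ≡ iterate c ⟦ oneSF ⟧
word-iterate zero    = refl
word-iterate (suc c) = cong b₁₁ (word-iterate c)

-- A part 2 alone already has hook length 2, so it forms a piece by itself and contributes 𝔹₂.
⟦C-word⟧ : ∀ a c → ⟦ C 2 (twosOnes a (double c)) ⟧ ≋ word a c
⟦C-word⟧ zero    c = subst (⟦ C 2 (twosOnes 0 (double c)) ⟧ ≋_) (sym (word-iterate c)) (⟦C-even⟧ c)
⟦C-word⟧ (suc a) c = ≋-trans (⟦Bν-2⟧ (C 2 (twosOnes a (double c)))) (lin-cong (B′-linear (+ 2)) (⟦C-word⟧ a c))

-- Linear combinations of the C_λ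

act : ZPoly → F → F
act []      f = 0F
act (a ∷ p) f = a ⊙ f ⊕ q· act p f

act-one : ∀ f → act (+ 1 ∷ []) f ≋ f
act-one f .at ν p zero    = trans (ℤₚ.+-identityʳ _) (ℤₚ.*-identityˡ _)
act-one f .at ν p (suc i) = trans (ℤₚ.+-identityʳ _) (ℤₚ.*-identityˡ _)

act-cscaleP : ∀ c p f → act (cscaleP c p) f ≋ c ⊙ act p f
act-cscaleP c []      f .at ν _ i = sym (ℤₚ.*-zeroʳ c)
act-cscaleP c (a ∷ p) f .at ν π i = trans
  (cong₂ _+_ (ℤₚ.*-assoc c a (coef f ν i)) (at (≋-trans (q·-cong (act-cscaleP c p f)) (lin-⊙ q·-linear c (act p f))) ν π i))
  (sym (ℤₚ.*-distribˡ-+ c (a * coef f ν i) (coef (q· act p f) ν i)))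

act-shift : ∀ p f → act (+ 0 ∷ p) f ≋ q· act p f
act-shift p f .at ν _ i = ℤₚ.+-identityˡ _

⟦scaleSF⟧ : ∀ p f → ⟦ scaleSF p f ⟧ ≋ act p ⟦ f ⟧
⟦scaleSF⟧ []      f .at ν π i = refl
⟦scaleSF⟧ (a ∷ p) f .at ν π i = trans (coeffP-+P (cscaleP a (f ν)) (+ 0 ∷ (p *P f ν)) i)
  (cong₂ _+_ (coeffP-cscaleP a (f ν) i) (tail i))
  where
  tail : ∀ i → coeffP (+ 0 ∷ (p *P f ν)) i ≡ coef (q· act p ⟦ f ⟧) ν i
  tail zero    = refl
  tail (suc i) = at (⟦scaleSF⟧ p f) ν π i

Combination : Set
Combination = List (List ℕ × ZPoly)

⟦lin-∷⟧ : ∀ λ′ p cs → ⟦ lin 2 ((λ′ , p) ∷ cs) ⟧ ≋ act p ⟦ C 2 λ′ ⟧ ⊕ ⟦ lin 2 cs ⟧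
⟦lin-∷⟧ λ′ p cs .at ν π i = trans (coeffP-+P (scaleSF p (C 2 λ′) ν) (lin 2 cs ν) i) (+ʳ (at (⟦scaleSF⟧ p (C 2 λ′)) ν π i))

⟦lin-++⟧ : ∀ cs ds → ⟦ lin 2 (cs ++ ds) ⟧ ≋ ⟦ lin 2 cs ⟧ ⊕ ⟦ lin 2 ds ⟧
⟦lin-++⟧ []              ds .at ν π i = sym (ℤₚ.+-identityˡ _)
⟦lin-++⟧ ((λ′ , p) ∷ cs) ds .at ν π i = begin
  coef ⟦ lin 2 ((λ′ , p) ∷ (cs ++ ds)) ⟧ ν i       ≡⟨ at (⟦lin-∷⟧ λ′ p (cs ++ ds)) ν π i ⟩
  x + coef ⟦ lin 2 (cs ++ ds) ⟧ ν i                ≡⟨ +ˡ x (at (⟦lin-++⟧ cs ds) ν π i) ⟩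
  x + (y + z)                                      ≡⟨ ℤₚ.+-assoc x y z ⟨
  x + y + z                                        ≡⟨ +ʳ (at (⟦lin-∷⟧ λ′ p cs) ν π i) ⟨
  coef ⟦ lin 2 ((λ′ , p) ∷ cs) ⟧ ν i + z           ∎
  where
  open ≡-Reasoning
  x y z : ℤ
  x = coef (act p ⟦ C 2 λ′ ⟧) ν i
  y = coef ⟦ lin 2 cs ⟧ ν i
  z = coef ⟦ lin 2 ds ⟧ ν i

mapCoefficients : (ZPoly → ZPoly) → Combination → Combination
mapCoefficients φ = map (λ (λ′ , p) → λ′ , φ p)

⟦lin-map⟧ : ∀ {T} → Linear T → ∀ φ → (∀ p f → act (φ p) f ≋ T (act p f)) → ∀ cs →
            ⟦ lin 2 (mapCoefficients φ cs) ⟧ ≋ T ⟦ lin 2 cs ⟧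
⟦lin-map⟧ l φ e [] = ≋-trans (record { at = λ ν p i → refl })
  (≋-trans (≋-sym (lin-0 l)) (lin-cong l (record { at = λ ν p i → refl })))
⟦lin-map⟧ {T} l φ e ((λ′ , p) ∷ cs) = begin
  ⟦ lin 2 ((λ′ , φ p) ∷ mapCoefficients φ cs) ⟧            ≈⟨ ⟦lin-∷⟧ λ′ (φ p) (mapCoefficients φ cs) ⟩
  act (φ p) ⟦ C 2 λ′ ⟧ ⊕ ⟦ lin 2 (mapCoefficients φ cs) ⟧  ≈⟨ ⊕-cong (e p ⟦ C 2 λ′ ⟧) (⟦lin-map⟧ l φ e cs) ⟩
  T (act p ⟦ C 2 λ′ ⟧) ⊕ T ⟦ lin 2 cs ⟧                    ≈⟨ lin-⊕ l (act p ⟦ C 2 λ′ ⟧) ⟦ lin 2 cs ⟧ ⟨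
  T (act p ⟦ C 2 λ′ ⟧ ⊕ ⟦ lin 2 cs ⟧)                      ≈⟨ lin-cong l (⟦lin-∷⟧ λ′ p cs) ⟨
  T ⟦ lin 2 ((λ′ , p) ∷ cs) ⟧                              ∎
  where open ≋-Reasoning

NoHeadOne : List ℕ × ZPoly → Set
NoHeadOne (λ′ , _) = KBounded 2 λ′ × headIs 1 λ′ ≡ false

-- f lies in the kernel of T⁽²⁾₁.
Killed : F → Set
Killed f = ∃ λ cs → All NoHeadOne cs × f ≋ ⟦ lin 2 cs ⟧

Killed-map : ∀ {T f} → Linear T → ∀ φ → (∀ p f → act (φ p) f ≋ T (act p f)) → Killed f → Killed (T f)
Killed-map l φ e (cs , a , e′) = mapCoefficients φ cs , Allₚ.map⁺ (All.map id a) ,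
  ≋-trans (lin-cong l e′) (≋-sym (⟦lin-map⟧ l φ e cs))

⊙-linear : ∀ c → Linear (c ⊙_)
⊙-linear c .lin-cong = ⊙-cong c
⊙-linear c .lin-⊕ f g .at ν p i = ℤₚ.*-distribˡ-+ c (coef f ν i) (coef g ν i)
⊙-linear c .lin-⊙ d f .at ν p i = swap c d (coef f ν i)
  where
  swap : ∀ x y z → x * (y * z) ≡ y * (x * z)
  swap = solve-∀
⊙-linear c .lin-q f = ≋-sym (lin-⊙ q·-linear c f)

Killed-≋ : ∀ {f g} → f ≋ g → Killed g → Killed f
Killed-≋ e (cs , a , e′) = cs , a , ≋-trans e e′

⟦lin-singleton⟧ : ∀ λ′ → ⟦ C 2 λ′ ⟧ ≋ ⟦ lin 2 ((λ′ , + 1 ∷ []) ∷ []) ⟧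
⟦lin-singleton⟧ λ′ = ≋-sym (≋-trans (⟦lin-∷⟧ λ′ (+ 1 ∷ []) [])
  (≋-trans (⊕-cong (act-one ⟦ C 2 λ′ ⟧) ≋-refl) (record { at = λ ν p i → ℤₚ.+-identityʳ _ })))

-- 𝔹₂ turns each word into C_μ for some μ of shape (2^(a+1), 1^(2c)), whose first part is 2. Sums,
-- integer multiples and multiples of q carry over to the coefficients.
Killed-b₂ : ∀ {n f} → Span n f → Killed (B′ (+ 2) f)
Killed-b₂ (gen a c _ e) = (twosOnes (suc a) (double c) , + 1 ∷ []) ∷ [] , (KBounded-twosOnes (suc a) (double c) , refl) ∷ [] ,
  ≋-trans (lin-cong (B′-linear (+ 2)) e) (≋-trans (≋-sym (⟦C-word⟧ (suc a) c)) (⟦lin-singleton⟧ (twosOnes (suc a) (double c))))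
Killed-b₂ (add {g = g} {h} s t e) with Killed-b₂ s | Killed-b₂ t
... | cs , a , e₁ | ds , b , e₂ = cs ++ ds , Allₚ.++⁺ a b ,
  ≋-trans (lin-cong (B′-linear (+ 2)) e) (≋-trans (lin-⊕ (B′-linear (+ 2)) g h)
    (≋-trans (⊕-cong e₁ e₂) (≋-sym (⟦lin-++⟧ cs ds))))
Killed-b₂ (scl c {g = g} s e) = Killed-≋ (≋-trans (lin-cong (B′-linear (+ 2)) e) (lin-⊙ (B′-linear (+ 2)) c g))
  (Killed-map (⊙-linear c) (cscaleP c) (act-cscaleP c) (Killed-b₂ s))
Killed-b₂ (shf {g = g} s e) = Killed-≋ (≋-trans (lin-cong (B′-linear (+ 2)) e) (lin-q (B′-linear (+ 2)) g))
  (Killed-map q·-linear (+ 0 ∷_) act-shift (Killed-b₂ s))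

filterHead-NoHeadOne : ∀ {cs} → All NoHeadOne cs → filterHead 1 cs ≡ []
filterHead-NoHeadOne []                     = refl
filterHead-NoHeadOne {(λ′ , p) ∷ cs} ((_ , e) ∷ a) rewrite e = filterHead-NoHeadOne a

-- Evaluation of T₁ and T₂ and the recursion for 2-Schur functions

one≉zero : ¬ ((+ 1 ∷ []) ≈P [])
one≉zero e with e 0
... | ()

scale-one : ∀ f → ⟦ scaleSF (+ 1 ∷ []) f ⟧ ≋ ⟦ f ⟧
scale-one f = ≋-trans (⟦scaleSF⟧ (+ 1 ∷ []) f) (act-one ⟦ f ⟧)

-- The expansion is the single term C_λ with coefficient and denominator 1; its first part is i, so
-- the filter keeps it.
TRel-self : ∀ {i} xs {f} → KBounded 2 (i ∷ xs) → ⟦ f ⟧ ≋ ⟦ C 2 (i ∷ xs) ⟧ → TRel 2 i f (C 2 (i ∷ xs))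
TRel-self {i} xs {f} k e = + 1 ∷ [] , one≉zero , cs , k ∷ [] ,
  ≋⇒≈ {scaleSF (+ 1 ∷ []) f} {lin 2 cs} (≋-trans (scale-one f) (≋-trans e (⟦lin-singleton⟧ (i ∷ xs)))) ,
  ≋⇒≈ {scaleSF (+ 1 ∷ []) (C 2 (i ∷ xs))} {lin 2 (filterHead i cs)}
    (≋-trans (scale-one (C 2 (i ∷ xs))) (≋-trans (⟦lin-singleton⟧ (i ∷ xs)) (record { at = λ ν p j → cong (λ ds → coeffP (lin 2 ds ν) j) (sym keep) })))
  where
  cs : Combination
  cs = (i ∷ xs , + 1 ∷ []) ∷ []
  keep : filterHead i cs ≡ cs
  keep with i ℕ.≡ᵇ i in eq
  ... | true  = refl
  ... | false = ⊥-elim (subst T eq (ℕₚ.≡⇒≡ᵇ i i refl))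

TRel-ones : ∀ m → TRel 2 1 (B (+ 1) (C 2 (twosOnes 0 (suc m)))) (C 2 (twosOnes 0 (suc (suc m))))
TRel-ones m with parity m
-- The old number of ones is even. The new part is split off as the last piece, and 𝔹₁ reaches that
-- place by commuting with every 𝔹₁₁.
... | c , inj₂ refl = TRel-self (twosOnes 0 (suc (suc (double c)))) (KBounded-twosOnes 0 (suc (suc (suc (double c)))))
  (≋-trans (⟦B⟧ (+ 1) (C 2 (twosOnes 0 (double (suc c)))))
  (≋-trans (lin-cong (B′-linear (+ 1)) (⟦C-even⟧ (suc c)))
  (≋-trans (b₁-iterate (suc c) (+ 0 , bounded-one)) (≋-sym (⟦C-odd⟧ (suc c))))))
-- The old number of ones is odd, and the new part pairs up with the leftover one. The list `ds`
-- expands the correction 𝔹₂𝔹₀𝔹₁₁ᶜ(1), available because 𝔹₀𝔹₁₁ᶜ(1) lies in the span.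
... | c , inj₁ refl with Killed-b₂ (Span-b₀-word c 0 c refl)
... | ds , a , e = + 1 ∷ [] , one≉zero , cs , KBounded-twosOnes 0 (suc (suc (double c))) ∷ All.map proj₁ a ,
  ≋⇒≈ {scaleSF (+ 1 ∷ []) (B (+ 1) (C 2 (twosOnes 0 (suc (double c)))))} {lin 2 cs} (≋-trans (scale-one (B (+ 1) (C 2 (twosOnes 0 (suc (double c)))))) expansion) ,
  ≋⇒≈ {scaleSF (+ 1 ∷ []) (C 2 λ′)} {lin 2 (filterHead 1 cs)}
    (≋-trans (scale-one (C 2 λ′)) (≋-trans (⟦lin-singleton⟧ λ′)
      (record { at = λ ν p j → cong (λ ds → coeffP (lin 2 ((λ′ , + 1 ∷ []) ∷ ds) ν) j) (sym (filterHead-NoHeadOne a)) })))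
  where
  open ≋-Reasoning
  λ′ : List ℕ
  λ′ = twosOnes 0 (suc (suc (double c)))
  cs : Combination
  cs = (λ′ , + 1 ∷ []) ∷ ds
  w : F
  w = iterate c ⟦ oneSF ⟧
  split : ∀ f → B′ (+ 1) (B′ (+ 1) f) ≋ b₁₁ f ⊕ B′ (+ 2) (B′ (+ 0) f)
  split f .at ν p i = arith (coef (B′ (+ 1) (B′ (+ 1) f)) ν i) (coef (B′ (+ 2) (B′ (+ 0) f)) ν i)
    where
    arith : ∀ x y → x ≡ x + -[1+ 0 ] * y + y
    arith = solve-∀
  expansion : ⟦ B (+ 1) (C 2 (twosOnes 0 (suc (double c)))) ⟧ ≋ ⟦ lin 2 cs ⟧
  expansion = begin
    ⟦ B (+ 1) (C 2 (twosOnes 0 (suc (double c)))) ⟧      ≈⟨ ⟦B⟧ (+ 1) (C 2 (twosOnes 0 (suc (double c)))) ⟩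
    B′ (+ 1) ⟦ C 2 (twosOnes 0 (suc (double c))) ⟧       ≈⟨ lin-cong (B′-linear (+ 1)) (⟦C-odd⟧ c) ⟩
    B′ (+ 1) (iterate c (B′ (+ 1) ⟦ oneSF ⟧))            ≈⟨ lin-cong (B′-linear (+ 1)) (b₁-iterate c (+ 0 , bounded-one)) ⟨
    B′ (+ 1) (B′ (+ 1) w)                                ≈⟨ split w ⟩
    b₁₁ w ⊕ B′ (+ 2) (B′ (+ 0) w)                        ≈⟨ ⊕-cong (⟦C-even⟧ (suc c)) (≋-trans (≋-sym e)
                                                              (lin-cong (B′-linear (+ 2)) (lin-cong (B′-linear (+ 0)) word≋))) ⟨
    ⟦ C 2 λ′ ⟧ ⊕ ⟦ lin 2 ds ⟧                            ≈⟨ ⊕-cong (act-one ⟦ C 2 λ′ ⟧) ≋-refl ⟨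
    act (+ 1 ∷ []) ⟦ C 2 λ′ ⟧ ⊕ ⟦ lin 2 ds ⟧             ≈⟨ ⟦lin-∷⟧ λ′ (+ 1 ∷ []) ds ⟨
    ⟦ lin 2 cs ⟧                                         ∎
    where
    word≋ : word 0 c ≋ w
    word≋ = subst (word 0 c ≋_) (word-iterate c) ≋-refl

TRel-two : ∀ ℓ m → TRel 2 2 (B (+ 2) (C 2 (twosOnes ℓ m))) (C 2 (twosOnes (suc ℓ) m))
TRel-two ℓ m = TRel-self (twosOnes ℓ m) (KBounded-twosOnes (suc ℓ) m)
  (≋-trans (⟦B⟧ (+ 2) (C 2 (twosOnes ℓ m))) (≋-sym (⟦Bν-2⟧ (C 2 (twosOnes ℓ m)))))

-- Parts are added on the left, the ones before the twos. The recursion for 2-Schur functions starts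
-- at one part, so (1) and (2) are the base cases, where 𝔹_a(1) = h_a.
IsKSchur-twosOnes : ∀ ℓ m → 1 ≤ ℓ ℕ.+ m → IsKSchur 2 (twosOnes ℓ m) (C 2 (twosOnes ℓ m))
IsKSchur-twosOnes zero (suc zero) _ = kSingle (s≤s z≤n) (s≤s z≤n)
  λ ν p i → trans (coeffP-singleton-sum (B (+ 1) oneSF ν) i) (B-one 1 (s≤s z≤n) ν p i)
IsKSchur-twosOnes zero (suc (suc m)) _ =
  kStep (s≤s z≤n) (s≤s z≤n) (IsKSchur-twosOnes zero (suc m) (s≤s z≤n)) (TRel-ones m)
IsKSchur-twosOnes (suc zero) zero _ = kSingle (s≤s z≤n) (s≤s (s≤s z≤n))
  λ ν p i → trans (coeffP-singleton-sum (B (+ 2) oneSF ν) i) (B-one 2 (s≤s z≤n) ν p i)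
IsKSchur-twosOnes (suc zero) (suc m) _ =
  kStep (s≤s z≤n) (s≤s (s≤s z≤n)) (IsKSchur-twosOnes zero (suc m) (s≤s z≤n)) (TRel-two 0 (suc m))
IsKSchur-twosOnes (suc (suc ℓ)) m _ =
  kStep ℕₚ.≤-refl (s≤s (s≤s z≤n)) (IsKSchur-twosOnes (suc ℓ) m (s≤s z≤n)) (TRel-two (suc ℓ) m)

theorem5p4 : (n ℓ : ℕ) → 1 ≤ n → 2 ℕ.* ℓ ≤ n →
    IsKSchur 2 (twoOne n ℓ) (C 2 (twoOne n ℓ))
theorem5p4 n zero    1≤n _ = IsKSchur-twosOnes zero n 1≤n
theorem5p4 n (suc ℓ) _   _ = IsKSchur-twosOnes (suc ℓ) (n ∸ 2 ℕ.* suc ℓ) (s≤s z≤n)
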